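{- Let $\Gamma_1$ be a signed bipartite graph and $\Gamma_2$ be a signed graph. The spectrum of the signed Cartesian product $\Gamma_1\widetilde{\Box}\Gamma_2$ (resp. of the signed semi-strong product $\Gamma_1\widetilde{\bowtie}\Gamma_2$) is symmetric if and only if $\Gamma_1$ is balanced or the spectrum of $\Gamma_2$ is symmetric.
   Context: A signed graph $\Gamma=(G,\sigma)$ is a finite simple undirected graph $G$ together with a map $\sigma:E(G)\to\{+1,-1\}$. Its adjacency matrix $A(\Gamma)$ is the real symmetric matrix indexed by $V(G)$ whose $(u,v)$ entry is $\sigma(uv)$ if $u,v$ are adjacent and $0$ otherwise. The spectrum of $\Gamma$ is that of $A(\Gamma)$; it is symmetric if, counted with multiplicity, it is invariant under $x\mapsto -x$. Graph notions (order, bipartite) refer to $G$. A signed bipartite graph $\Gamma_1=(G_1,\sigma_1)$ of order $n$ is taken with a fixed bipartition $(V_1,V_2)$, $|V_1|=s$ (unique up to interchanging the classes when the graph is connected); it is balanced if $|V_1|=|V_2|$. Labeling the vertices of $V_1$ first, $A(\Gamma_1)=\begin{bmatrix}O_s&P\\P^T&O_{n-s}\end{bmatrix}$. For a signed graph $\Gamma_2=(G_2,\sigma_2)$ of order $m$, the signed Cartesian product $\Gamma_1\widetilde{\Box}\Gamma_2$ and the signed semi-strong product $\Gamma_1\widetilde{\bowtie}\Gamma_2$ are the signed graphs on $V(G_1)\times V(G_2)$ with adjacency matrices $$A(\Gamma_1\widetilde{\Box}\Gamma_2)=A(\Gamma_1)\otimes I_m+\begin{bmatrix}I_s&O\\O&-I_{n-s}\end{bmatrix}\otimes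 A(\Gamma_2),\qquad A(\Gamma_1\widetilde{\bowtie}\Gamma_2)=\begin{bmatrix}I_s&P\\P^T&-I_{n-s}\end{bmatrix}\otimes A(\Gamma_2),$$ where $\otimes$ is the Kronecker product. -}

module Defs where

open import Algebra.Bundles using (CommutativeMonoid)
open import Algebra.Bundles.Raw using (RawRing)
import Algebra.Definitions.RawSemiring as RawSemiringDefs
import Algebra.Properties.CommutativeSemigroup as CommutativeSemigroupProperties
open import Data.Fin.Base as Fin using (Fin; punchIn; remQuot)
import Data.Fin.Properties as Fin
open import Data.Fin.Subset using (Subset; _∈_; _∉_; ∣_∣; ∁)
open import Data.Fin.Subset.Properties using (_∈?_)
open import Data.Integer.Base as ℤ using (ℤ; 0ℤ; 1ℤ; -1ℤ)
import Data.Integer.Properties as ℤ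
open import Data.List.Base using (List; []; _∷_; map; foldr)
open import Data.Nat.Base as ℕ using (ℕ; zero; suc)
import Data.Nat.Properties as ℕ
open import Data.Product.Base using (∃-syntax; _×_; _,_; proj₁; proj₂)
open import Data.Rational.Base as ℚ using (ℚ; 0ℚ; 1ℚ; ½)
import Data.Rational.Properties as ℚ
open import Data.Sign.Base as Sign using (Sign)
open import Data.Sum.Base using (_⊎_; inj₁; inj₂)
open import Function.Base using (_on_)
open import Function.Bundles using (_⇔_)
open import Level using (0ℓ; _⊔_)
open import Relation.Binary.Core using (Rel)
open import Relation.Binary.Definitions using (Decidable; Symmetric; Irreflexive)
open import Relation.Binary.PropositionalEquality
open import Relation.Nullary.Decidable using (Dec; yes; no; _×-dec_; _⊎-dec_)
open import Relation.Nullary.Negation using (¬_; contradiction)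

------------------------------------------------------------------------
-- Real numbers: Cauchy sequences of rationals, with _≃_ as equality

record ℝ : Set where
  field
    seq    : ℕ → ℚ
    cauchy : ∀ ε → 0ℚ ℚ.< ε →
             ∃[ N ] (∀ m n → N ℕ.≤ m → N ℕ.≤ n → ℚ.∣ seq m ℚ.- seq n ∣ ℚ.< ε)

open ℝ public

infix 4 _≃_

_≃_ : Rel ℝ 0ℓ
x ≃ y = ∀ ε → 0ℚ ℚ.< ε → ∃[ N ] (∀ n → N ℕ.≤ n → ℚ.∣ seq x n ℚ.- seq y n ∣ ℚ.< ε)

fromℚ : ℚ → ℝ
fromℚ p .seq    _       = p
fromℚ p .cauchy ε 0<ε = 0 , λ _ _ _ _ →
  subst (λ z → ℚ.∣ z ∣ ℚ.< ε) (sym (ℚ.+-inverseʳ p)) 0<ε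

fromℤ : ℤ → ℝ
fromℤ i = fromℚ (i ℚ./ 1)

private
  open ℚ.≤-Reasoning
  open CommutativeSemigroupProperties
    (CommutativeMonoid.commutativeSemigroup ℚ.+-0-commutativeMonoid) using (interchange)

  ½-pos : ∀ {ε} → 0ℚ ℚ.< ε → 0ℚ ℚ.< ½ ℚ.* ε
  ½-pos {ε} 0<ε = subst (ℚ._< ½ ℚ.* ε) (ℚ.*-zeroʳ ½) (ℚ.*-monoʳ-<-pos ½ 0<ε)

  ½+½ : ∀ ε → ½ ℚ.* ε ℚ.+ ½ ℚ.* ε ≡ ε
  ½+½ ε = trans (sym (ℚ.*-distribʳ-+ ε ½ ½)) (ℚ.*-identityˡ ε)

  +-rearrange : ∀ a b c d → (a ℚ.+ b) ℚ.- (c ℚ.+ d) ≡ (a ℚ.- c) ℚ.+ (b ℚ.- d)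
  +-rearrange a b c d = trans (cong (a ℚ.+ b ℚ.+_) (ℚ.neg-distrib-+ c d))
                              (interchange a b (ℚ.- c) (ℚ.- d))

  telescope : ∀ a b c → (a ℚ.- b) ℚ.+ (b ℚ.- c) ≡ a ℚ.- c
  telescope a b c = trans (ℚ.+-assoc a (ℚ.- b) (b ℚ.- c)) (cong (a ℚ.+_)
    (trans (sym (ℚ.+-assoc (ℚ.- b) b (ℚ.- c)))
    (trans (cong (ℚ._- c) (ℚ.+-inverseˡ b)) (ℚ.+-identityˡ (ℚ.- c)))))

  *-rearrange : ∀ a b c d → a ℚ.* b ℚ.- c ℚ.* d ≡ a ℚ.* (b ℚ.- d) ℚ.+ d ℚ.* (a ℚ.- c)
  *-rearrange a b c d = sym (trans (cong₂ ℚ._+_ eq₁ eq₂) (telescope (a ℚ.* b) (a ℚ.* d) (c ℚ.* d)))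
    where
    eq₁ : a ℚ.* (b ℚ.- d) ≡ a ℚ.* b ℚ.- a ℚ.* d
    eq₁ = trans (ℚ.*-distribˡ-+ a b (ℚ.- d)) (cong (a ℚ.* b ℚ.+_) (sym (ℚ.neg-distribʳ-* a d)))
    eq₂ : d ℚ.* (a ℚ.- c) ≡ a ℚ.* d ℚ.- c ℚ.* d
    eq₂ = trans (ℚ.*-comm d (a ℚ.- c)) (trans (ℚ.*-distribʳ-+ d a (ℚ.- c))
            (cong (a ℚ.* d ℚ.+_) (sym (ℚ.neg-distribˡ-* c d))))

  add-back : ∀ a b → a ≡ (a ℚ.- b) ℚ.+ b
  add-back a b = sym (trans (ℚ.+-assoc a (ℚ.- b) b)
                     (trans (cong (a ℚ.+_) (ℚ.+-inverseˡ b)) (ℚ.+-identityʳ a)))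

  eventually-bounded : (x : ℝ) → ∃[ B ] ∃[ N ]
    (ℚ.Positive B × (∀ n → N ℕ.≤ n → ℚ.∣ seq x n ∣ ℚ.< B))
  eventually-bounded x with cauchy x 1ℚ (ℚ.positive⁻¹ 1ℚ)
  ... | N , close = 1ℚ ℚ.+ ℚ.∣ seq x N ∣ , N
    , ℚ.pos+nonNeg⇒pos 1ℚ ℚ.∣ seq x N ∣ {{ℚ.∣-∣-nonNeg (seq x N)}}
    , λ n N≤n → begin-strict
        ℚ.∣ seq x n ∣
          ≡⟨ cong ℚ.∣_∣ (add-back (seq x n) (seq x N)) ⟩
        ℚ.∣ (seq x n ℚ.- seq x N) ℚ.+ seq x N ∣
          ≤⟨ ℚ.∣p+q∣≤∣p∣+∣q∣ (seq x n ℚ.- seq x N) (seq x N) ⟩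
        ℚ.∣ seq x n ℚ.- seq x N ∣ ℚ.+ ℚ.∣ seq x N ∣
          <⟨ ℚ.+-monoˡ-< ℚ.∣ seq x N ∣ (close n N N≤n ℕ.≤-refl) ⟩
        1ℚ ℚ.+ ℚ.∣ seq x N ∣ ∎

  product-bound : ∀ p q {B δ} .{{_ : ℚ.Positive B}} →
    ℚ.∣ p ∣ ℚ.< B → ℚ.∣ q ∣ ℚ.< δ → ℚ.∣ p ℚ.* q ∣ ℚ.< B ℚ.* δ
  product-bound p q {B} {δ} p<B q<δ = begin-strict
    ℚ.∣ p ℚ.* q ∣
      ≡⟨ ℚ.∣p*q∣≡∣p∣*∣q∣ p q ⟩
    ℚ.∣ p ∣ ℚ.* ℚ.∣ q ∣
      ≤⟨ ℚ.*-monoʳ-≤-nonNeg ℚ.∣ q ∣ {{ℚ.∣-∣-nonNeg q}} (ℚ.<⇒≤ p<B) ⟩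
    B ℚ.* ℚ.∣ q ∣
      <⟨ ℚ.*-monoʳ-<-pos B q<δ ⟩
    B ℚ.* δ ∎

infixl 6 _+ᴿ_
infixl 7 _*ᴿ_
infix  8 -ᴿ_

_+ᴿ_ : ℝ → ℝ → ℝ
(x +ᴿ y) .seq n = seq x n ℚ.+ seq y n
(x +ᴿ y) .cauchy ε 0<ε with cauchy x (½ ℚ.* ε) (½-pos 0<ε) | cauchy y (½ ℚ.* ε) (½-pos 0<ε)
... | M , closeˣ | N , closeʸ = M ℕ.⊔ N , λ m n ≤m ≤n → begin-strict
  ℚ.∣ (seq x m ℚ.+ seq y m) ℚ.- (seq x n ℚ.+ seq y n) ∣
    ≡⟨ cong ℚ.∣_∣ (+-rearrange (seq x m) (seq y m) (seq x n) (seq y n)) ⟩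
  ℚ.∣ (seq x m ℚ.- seq x n) ℚ.+ (seq y m ℚ.- seq y n) ∣
    ≤⟨ ℚ.∣p+q∣≤∣p∣+∣q∣ (seq x m ℚ.- seq x n) (seq y m ℚ.- seq y n) ⟩
  ℚ.∣ seq x m ℚ.- seq x n ∣ ℚ.+ ℚ.∣ seq y m ℚ.- seq y n ∣
    <⟨ ℚ.+-mono-< (closeˣ m n (ℕ.m⊔n≤o⇒m≤o M N ≤m) (ℕ.m⊔n≤o⇒m≤o M N ≤n))
                  (closeʸ m n (ℕ.m⊔n≤o⇒n≤o M N ≤m) (ℕ.m⊔n≤o⇒n≤o M N ≤n)) ⟩
  ½ ℚ.* ε ℚ.+ ½ ℚ.* ε
    ≡⟨ ½+½ ε ⟩
  ε ∎

-ᴿ_ : ℝ → ℝ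
(-ᴿ x) .seq n = ℚ.- seq x n
(-ᴿ x) .cauchy ε 0<ε with cauchy x ε 0<ε
... | N , close = N , λ m n N≤m N≤n → begin-strict
  ℚ.∣ (ℚ.- seq x m) ℚ.- (ℚ.- seq x n) ∣
    ≡⟨ cong ℚ.∣_∣ (sym (ℚ.neg-distrib-+ (seq x m) (ℚ.- seq x n))) ⟩
  ℚ.∣ ℚ.- (seq x m ℚ.- seq x n) ∣
    ≡⟨ ℚ.∣-p∣≡∣p∣ (seq x m ℚ.- seq x n) ⟩
  ℚ.∣ seq x m ℚ.- seq x n ∣
    <⟨ close m n N≤m N≤n ⟩
  ε ∎

_*ᴿ_ : ℝ → ℝ → ℝ
(x *ᴿ y) .seq n = seq x n ℚ.* seq y n
(x *ᴿ y) .cauchy ε 0<ε = N , proof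
  where
  B C : ℚ
  B = proj₁ (eventually-bounded x)
  C = proj₁ (eventually-bounded y)

  K L : ℕ
  K = proj₁ (proj₂ (eventually-bounded x))
  L = proj₁ (proj₂ (eventually-bounded y))

  boundˣ : ∀ n → K ℕ.≤ n → ℚ.∣ seq x n ∣ ℚ.< B
  boundˣ = proj₂ (proj₂ (proj₂ (eventually-bounded x)))
  boundʸ : ∀ n → L ℕ.≤ n → ℚ.∣ seq y n ∣ ℚ.< C
  boundʸ = proj₂ (proj₂ (proj₂ (eventually-bounded y)))

  instance
    B>0 : ℚ.Positive B
    B>0 = proj₁ (proj₂ (proj₂ (eventually-bounded x)))
    C>0 : ℚ.Positive C
    C>0 = proj₁ (proj₂ (proj₂ (eventually-bounded y)))
    B+C>0 : ℚ.Positive (B ℚ.+ C)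
    B+C>0 = ℚ.pos+pos⇒pos B C
    B+C≢0 : ℚ.NonZero (B ℚ.+ C)
    B+C≢0 = ℚ.pos⇒nonZero (B ℚ.+ C)
    ε>0 : ℚ.Positive ε
    ε>0 = ℚ.positive 0<ε
    1/[B+C]>0 : ℚ.Positive (ℚ.1/ (B ℚ.+ C))
    1/[B+C]>0 = ℚ.1/pos⇒pos (B ℚ.+ C)
    δ>0 : ℚ.Positive (ℚ.1/ (B ℚ.+ C) ℚ.* ε)
    δ>0 = ℚ.pos*pos⇒pos (ℚ.1/ (B ℚ.+ C)) ε

  δ : ℚ
  δ = ℚ.1/ (B ℚ.+ C) ℚ.* ε

  0<δ : 0ℚ ℚ.< δ
  0<δ = ℚ.positive⁻¹ δ

  M P N : ℕ
  M = proj₁ (cauchy x δ 0<δ)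
  P = proj₁ (cauchy y δ 0<δ)
  N = (K ℕ.⊔ L) ℕ.⊔ (M ℕ.⊔ P)

  K≤ : ∀ {n} → N ℕ.≤ n → K ℕ.≤ n
  K≤ h = ℕ.m⊔n≤o⇒m≤o K L (ℕ.m⊔n≤o⇒m≤o (K ℕ.⊔ L) (M ℕ.⊔ P) h)
  L≤ : ∀ {n} → N ℕ.≤ n → L ℕ.≤ n
  L≤ h = ℕ.m⊔n≤o⇒n≤o K L (ℕ.m⊔n≤o⇒m≤o (K ℕ.⊔ L) (M ℕ.⊔ P) h)
  M≤ : ∀ {n} → N ℕ.≤ n → M ℕ.≤ n
  M≤ h = ℕ.m⊔n≤o⇒m≤o M P (ℕ.m⊔n≤o⇒n≤o (K ℕ.⊔ L) (M ℕ.⊔ P) h)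
  P≤ : ∀ {n} → N ℕ.≤ n → P ℕ.≤ n
  P≤ h = ℕ.m⊔n≤o⇒n≤o M P (ℕ.m⊔n≤o⇒n≤o (K ℕ.⊔ L) (M ℕ.⊔ P) h)

  sum-δ : B ℚ.* δ ℚ.+ C ℚ.* δ ≡ ε
  sum-δ = trans (sym (ℚ.*-distribʳ-+ δ B C))
         (trans (sym (ℚ.*-assoc (B ℚ.+ C) (ℚ.1/ (B ℚ.+ C)) ε))
         (trans (cong (ℚ._* ε) (ℚ.*-inverseʳ (B ℚ.+ C))) (ℚ.*-identityˡ ε)))

  proof : ∀ m n → N ℕ.≤ m → N ℕ.≤ n →
          ℚ.∣ seq x m ℚ.* seq y m ℚ.- seq x n ℚ.* seq y n ∣ ℚ.< ε
  proof m n N≤m N≤n = begin-strict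
    ℚ.∣ xₘ ℚ.* yₘ ℚ.- xₙ ℚ.* yₙ ∣
      ≡⟨ cong ℚ.∣_∣ (*-rearrange xₘ yₘ xₙ yₙ) ⟩
    ℚ.∣ xₘ ℚ.* (yₘ ℚ.- yₙ) ℚ.+ yₙ ℚ.* (xₘ ℚ.- xₙ) ∣
      ≤⟨ ℚ.∣p+q∣≤∣p∣+∣q∣ (xₘ ℚ.* (yₘ ℚ.- yₙ)) (yₙ ℚ.* (xₘ ℚ.- xₙ)) ⟩
    ℚ.∣ xₘ ℚ.* (yₘ ℚ.- yₙ) ∣ ℚ.+ ℚ.∣ yₙ ℚ.* (xₘ ℚ.- xₙ) ∣
      <⟨ ℚ.+-mono-<
           (product-bound xₘ (yₘ ℚ.- yₙ) (boundˣ m (K≤ N≤m))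
             (proj₂ (cauchy y δ 0<δ) m n (P≤ N≤m) (P≤ N≤n)))
           (product-bound yₙ (xₘ ℚ.- xₙ) (boundʸ n (L≤ N≤n))
             (proj₂ (cauchy x δ 0<δ) m n (M≤ N≤m) (M≤ N≤n))) ⟩
    B ℚ.* δ ℚ.+ C ℚ.* δ
      ≡⟨ sum-δ ⟩
    ε ∎
    where
    xₘ = seq x m
    yₘ = seq y m
    xₙ = seq x n
    yₙ = seq y n

ℝ-rawRing : RawRing 0ℓ 0ℓ
ℝ-rawRing = record
  { Carrier = ℝ
  ; _≈_     = _≃_
  ; _+_     = _+ᴿ_
  ; _*_     = _*ᴿ_
  ; -_      = -ᴿ_
  ; 0#      = fromℚ 0ℚ
  ; 1#      = fromℚ 1ℚ
  }

------------------------------------------------------------------------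
-- Polynomials in one variable, as coefficient lists (constant term
-- first; trailing zeros are allowed and ignored by _≈ᴾ_)

module Polynomial {c ℓ} (R : RawRing c ℓ) where
  open RawRing R

  Poly : Set c
  Poly = List Carrier

  coeff : Poly → ℕ → Carrier
  coeff []      _       = 0#
  coeff (a ∷ p) zero    = a
  coeff (a ∷ p) (suc n) = coeff p n

  infix  4 _≈ᴾ_
  infixl 6 _+ᴾ_
  infixl 7 _*ᴾ_
  infix  8 -ᴾ_

  _≈ᴾ_ : Rel Poly ℓ
  p ≈ᴾ q = ∀ n → coeff p n ≈ coeff q n

  _+ᴾ_ : Poly → Poly → Poly
  []      +ᴾ q       = q
  (a ∷ p) +ᴾ []      = a ∷ p
  (a ∷ p) +ᴾ (b ∷ q) = (a + b) ∷ (p +ᴾ q)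

  _*ᴾ_ : Poly → Poly → Poly
  []      *ᴾ q = []
  (a ∷ p) *ᴾ q = map (a *_) q +ᴾ (0# ∷ (p *ᴾ q))

  -ᴾ_ : Poly → Poly
  -ᴾ_ = map (-_)

  const : Carrier → Poly
  const a = a ∷ []

  X : Poly
  X = 0# ∷ 1# ∷ []

  eval : Poly → Carrier → Carrier
  eval p x = foldr (λ a r → a + x * r) 0# p

  Poly-rawRing : RawRing c ℓ
  Poly-rawRing = record
    { Carrier = Poly
    ; _≈_     = _≈ᴾ_
    ; _+_     = _+ᴾ_
    ; _*_     = _*ᴾ_
    ; -_      = -ᴾ_
    ; 0#      = []
    ; 1#      = const 1#
    }

  open RawSemiringDefs (RawRing.rawSemiring Poly-rawRing) public
    using () renaming (_^_ to _^ᴾ_)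

  -- Multiplicity 0 means that x is not a root.
  HasMultiplicity : Poly → Carrier → ℕ → Set (c ⊔ ℓ)
  HasMultiplicity p x k =
    ∃[ q ] (p ≈ᴾ (X +ᴾ -ᴾ const x) ^ᴾ k *ᴾ q × ¬ eval q x ≈ 0#)

------------------------------------------------------------------------
-- Matrices

Matrix : ∀ {a} → Set a → ℕ → Set a
Matrix A n = Fin n → Fin n → A

module MatrixOver {c ℓ} (R : RawRing c ℓ) where
  open RawRing R
  open RawSemiringDefs rawSemiring using (sum; _^_)

  I : ∀ n → Matrix Carrier n
  I n i j with i Fin.≟ j
  ... | yes _ = 1#
  ... | no  _ = 0#

  infixl 6 _⊕_
  infixl 7 _⊗_

  _⊕_ : ∀ {n} → Matrix Carrier n → Matrix Carrier n → Matrix Carrier n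
  (A ⊕ B) i j = A i j + B i j

  -- Kronecker product; the index (i , k) is the position combine i k.
  _⊗_ : ∀ {n m} → Matrix Carrier n → Matrix Carrier m → Matrix Carrier (n ℕ.* m)
  _⊗_ {n} {m} A B x y = A (proj₁ p) (proj₁ q) * B (proj₂ p) (proj₂ q)
    where
    p = remQuot {n} m x
    q = remQuot {n} m y

  det : ∀ {n} → Matrix Carrier n → Carrier
  det {zero}  A = 1#
  det {suc n} A = sum λ j →
    (- 1#) ^ Fin.toℕ j * A Fin.zero j * det (λ k l → A (Fin.suc k) (punchIn j l))

open Polynomial ℝ-rawRing public
  using (HasMultiplicity)

charPoly : ∀ {n} → Matrix ℝ n → Polynomial.Poly ℝ-rawRing
charPoly {n} A = det λ i j → (I n i j *ᴾ X) +ᴾ -ᴾ const (A i j)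
  where
  open Polynomial ℝ-rawRing
  open MatrixOver Poly-rawRing

-- A real symmetric matrix has only real eigenvalues, so its spectrum, as a
-- multiset, is the function sending a real number to its multiplicity as a
-- root of the characteristic polynomial.
EigenvalueMultiplicity : ∀ {n} → Matrix ℝ n → ℝ → ℕ → Set
EigenvalueMultiplicity A x k = HasMultiplicity (charPoly A) x k

------------------------------------------------------------------------
-- Signed graphs

record SignedGraph (n : ℕ) : Set₁ where
  field
    Adj     : Rel (Fin n) 0ℓ
    adj?    : Decidable Adj
    adj-sym : Symmetric Adj
    adj-irr : Irreflexive _≡_ Adj
    σ       : ∀ {u v} → Adj u v → Sign
    -- The sign depends on the edge {u , v} only: neither on its direction
    -- nor (applying this twice) on the proof of adjacency.
    σ-sym   : ∀ {u v} (e : Adj u v) (e′ : Adj v u) → σ e ≡ σ e′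

open SignedGraph public

signToℤ : Sign → ℤ
signToℤ Sign.+ = 1ℤ
signToℤ Sign.- = -1ℤ

signedEntry : ∀ {E : Set} → Dec E → (E → Sign) → ℤ
signedEntry (yes e) sign = signToℤ (sign e)
signedEntry (no  _) sign = 0ℤ

adjacency : ∀ {n} → SignedGraph n → Matrix ℤ n
adjacency Γ u v = signedEntry (adj? Γ u v) (σ Γ)

SymmetricSpectrum : ∀ {n} → SignedGraph n → Set
SymmetricSpectrum Γ = ∀ (x : ℝ) (k : ℕ) →
  EigenvalueMultiplicity A x k ⇔ EigenvalueMultiplicity A (-ᴿ x) k
  where A = λ u v → fromℤ (adjacency Γ u v)

-- The bipartition is (V₁ , ∁ V₁).
record SignedBipartiteGraph (n : ℕ) : Set₁ where
  field
    graph     : SignedGraph n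
    V₁        : Subset n
    bipartite : ∀ {u v} → Adj graph u v →
                (u ∈ V₁ × v ∉ V₁) ⊎ (u ∉ V₁ × v ∈ V₁)

open SignedBipartiteGraph public

Balanced : ∀ {n} → SignedBipartiteGraph n → Set
Balanced Γ = ∣ V₁ Γ ∣ ≡ ∣ ∁ (V₁ Γ) ∣

side : ∀ {n} → SignedBipartiteGraph n → Fin n → Sign
side Γ u with u ∈? V₁ Γ
... | yes _ = Sign.+
... | no  _ = Sign.-

-- The diagonal matrix with entry 1 on V₁ and -1 on its complement.
D : ∀ {n} → SignedBipartiteGraph n → Matrix ℤ n
D Γ u v with u Fin.≟ v
... | yes _ = signToℤ (side Γ u)
... | no  _ = 0ℤ

------------------------------------------------------------------------
-- The two products. A pair of vertices (u , i) is encoded by combine u i.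

private
  pullback : ∀ {n m} {Adj′ : Rel (Fin n × Fin m) 0ℓ} → Decidable Adj′ → Symmetric Adj′ →
             (∀ {p} → ¬ Adj′ p p) → (σ′ : ∀ {p q} → Adj′ p q → Sign) →
             (∀ {p q} (e : Adj′ p q) (e′ : Adj′ q p) → σ′ e ≡ σ′ e′) →
             SignedGraph (n ℕ.* m)
  pullback {n} {m} {Adj′} adj?′ sym′ irr′ σ′ σ-sym′ = record
    { Adj     = Adj′ on remQuot {n} m
    ; adj?    = λ x y → adj?′ (remQuot {n} m x) (remQuot {n} m y)
    ; adj-sym = sym′
    ; adj-irr = λ { refl → irr′ }
    ; σ       = σ′
    ; σ-sym   = σ-sym′
    }

module _ {n m : ℕ} (Γ₁ : SignedBipartiteGraph n) (Γ₂ : SignedGraph m) where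

  private
    G₁ = graph Γ₁

  □-Adj : Rel (Fin n × Fin m) 0ℓ
  □-Adj (u , i) (v , j) = (Adj G₁ u v × i ≡ j) ⊎ (u ≡ v × Adj Γ₂ i j)

  □-sign : ∀ {p q} → □-Adj p q → Sign
  □-sign           (inj₁ (e , _)) = σ G₁ e
  □-sign {u , _}   (inj₂ (_ , f)) = side Γ₁ u Sign.* σ Γ₂ f

  □-adj? : Decidable □-Adj
  □-adj? (u , i) (v , j) =
    (adj? G₁ u v ×-dec i Fin.≟ j) ⊎-dec (u Fin.≟ v ×-dec adj? Γ₂ i j)

  ⋈-Adj : Rel (Fin n × Fin m) 0ℓ
  ⋈-Adj (u , i) (v , j) = (Adj G₁ u v ⊎ u ≡ v) × Adj Γ₂ i j

  ⋈-sign : ∀ {p q} → ⋈-Adj p q → Sign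
  ⋈-sign         (inj₁ e , f) = σ G₁ e Sign.* σ Γ₂ f
  ⋈-sign {u , _} (inj₂ _ , f) = side Γ₁ u Sign.* σ Γ₂ f

  ⋈-adj? : Decidable ⋈-Adj
  ⋈-adj? (u , i) (v , j) = (adj? G₁ u v ⊎-dec u Fin.≟ v) ×-dec adj? Γ₂ i j

  private
    □-sign-sym : ∀ {p q} (e : □-Adj p q) (e′ : □-Adj q p) → □-sign e ≡ □-sign e′
    □-sign-sym (inj₁ (e , _))    (inj₁ (e′ , _))    = σ-sym G₁ e e′
    □-sign-sym (inj₁ (e , _))    (inj₂ (refl , _))  = contradiction e (adj-irr G₁ refl)
    □-sign-sym (inj₂ (refl , _)) (inj₁ (e , _))     = contradiction e (adj-irr G₁ refl)
    □-sign-sym {u , _} (inj₂ (refl , f)) (inj₂ (_ , f′)) = cong (side Γ₁ u Sign.*_) (σ-sym Γ₂ f f′)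

    ⋈-sign-sym : ∀ {p q} (e : ⋈-Adj p q) (e′ : ⋈-Adj q p) → ⋈-sign e ≡ ⋈-sign e′
    ⋈-sign-sym (inj₁ e , f)    (inj₁ e′ , f′)   = cong₂ Sign._*_ (σ-sym G₁ e e′) (σ-sym Γ₂ f f′)
    ⋈-sign-sym (inj₁ e , _)    (inj₂ refl , _)  = contradiction e (adj-irr G₁ refl)
    ⋈-sign-sym (inj₂ refl , _) (inj₁ e , _)     = contradiction e (adj-irr G₁ refl)
    ⋈-sign-sym {u , _} (inj₂ refl , f) (inj₂ _ , f′) = cong (side Γ₁ u Sign.*_) (σ-sym Γ₂ f f′)

  infixl 7 _□̃_ _⋈̃_

  _□̃_ : SignedGraph (n ℕ.* m)
  _□̃_ = pullback {Adj′ = □-Adj}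
    □-adj?
    (λ { (inj₁ (e , p)) → inj₁ (adj-sym G₁ e , sym p)
       ; (inj₂ (p , f)) → inj₂ (sym p , adj-sym Γ₂ f) })
    (λ { (inj₁ (e , _)) → adj-irr G₁ refl e
       ; (inj₂ (_ , f)) → adj-irr Γ₂ refl f })
    (λ {p} {q} → □-sign {p} {q})
    (λ {p} {q} → □-sign-sym {p} {q})

  _⋈̃_ : SignedGraph (n ℕ.* m)
  _⋈̃_ = pullback {Adj′ = ⋈-Adj}
    ⋈-adj?
    (λ { (inj₁ e , f) → inj₁ (adj-sym G₁ e) , adj-sym Γ₂ f
       ; (inj₂ p , f) → inj₂ (sym p) , adj-sym Γ₂ f })
    (λ (_ , f) → adj-irr Γ₂ refl f)
    (λ {p} {q} → ⋈-sign {p} {q})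
    (λ {p} {q} → ⋈-sign-sym {p} {q})

------------------------------------------------------------------------
-- The adjacency matrices of the products. When the vertices of V₁ come
-- first, A(Γ₁) ⊕ D is the block matrix [ I P ; Pᵀ -I ].

open MatrixOver ℤ.+-*-rawRing

private
  signToℤ-* : ∀ s t → signToℤ (s Sign.* t) ≡ signToℤ s ℤ.* signToℤ t
  signToℤ-* Sign.+ Sign.+ = refl
  signToℤ-* Sign.+ Sign.- = refl
  signToℤ-* Sign.- Sign.+ = refl
  signToℤ-* Sign.- Sign.- = refl

module _ {n m : ℕ} (Γ₁ : SignedBipartiteGraph n) (Γ₂ : SignedGraph m) where

  private
    A₁ = adjacency (graph Γ₁)
    A₂ = adjacency Γ₂

    □-entry : ∀ u i v j →
      signedEntry (□-adj? Γ₁ Γ₂ (u , i) (v , j)) (□-sign Γ₁ Γ₂) ≡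
      A₁ u v ℤ.* I m i j ℤ.+ D Γ₁ u v ℤ.* A₂ i j
    □-entry u i v j with adj? (graph Γ₁) u v | i Fin.≟ j | u Fin.≟ v | adj? Γ₂ i j
    ... | yes e | _        | yes refl | _     = contradiction e (adj-irr (graph Γ₁) refl)
    ... | _     | yes refl | _        | yes f = contradiction f (adj-irr Γ₂ refl)
    ... | yes e | yes _    | no _     | no _  = sym (trans (ℤ.+-identityʳ _) (ℤ.*-identityʳ _))
    ... | yes e | no _     | no _     | no _  =
      sym (trans (ℤ.+-identityʳ _) (ℤ.*-zeroʳ (signToℤ (σ (graph Γ₁) e))))
    ... | yes e | no _     | no _     | yes _ =
      sym (trans (ℤ.+-identityʳ _) (ℤ.*-zeroʳ (signToℤ (σ (graph Γ₁) e))))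
    ... | no _  | yes _    | yes _    | no _  =
      sym (trans (ℤ.+-identityˡ _) (ℤ.*-zeroʳ (signToℤ (side Γ₁ u))))
    ... | no _  | no _     | yes _    | no _  =
      sym (trans (ℤ.+-identityˡ _) (ℤ.*-zeroʳ (signToℤ (side Γ₁ u))))
    ... | no _  | no _     | yes _    | yes f =
      trans (signToℤ-* (side Γ₁ u) (σ Γ₂ f)) (sym (ℤ.+-identityˡ _))
    ... | no _  | yes _    | no _     | no _  = refl
    ... | no _  | no _     | no _     | no _  = refl
    ... | no _  | no _     | no _     | yes _ = refl

    ⋈-entry : ∀ u i v j →
      signedEntry (⋈-adj? Γ₁ Γ₂ (u , i) (v , j)) (⋈-sign Γ₁ Γ₂) ≡
      (A₁ u v ℤ.+ D Γ₁ u v) ℤ.* A₂ i j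
    ⋈-entry u i v j with adj? (graph Γ₁) u v | u Fin.≟ v | adj? Γ₂ i j
    ... | yes e | yes refl | _     = contradiction e (adj-irr (graph Γ₁) refl)
    ... | yes e | no _     | yes f =
      trans (signToℤ-* (σ (graph Γ₁) e) (σ Γ₂ f))
            (cong (ℤ._* signToℤ (σ Γ₂ f)) (sym (ℤ.+-identityʳ (signToℤ (σ (graph Γ₁) e)))))
    ... | yes e | no _     | no _  = sym (ℤ.*-zeroʳ (signToℤ (σ (graph Γ₁) e) ℤ.+ 0ℤ))
    ... | no _  | yes _    | yes f =
      trans (signToℤ-* (side Γ₁ u) (σ Γ₂ f))
            (cong (ℤ._* signToℤ (σ Γ₂ f)) (sym (ℤ.+-identityˡ (signToℤ (side Γ₁ u)))))
    ... | no _  | yes _    | no _  = sym (ℤ.*-zeroʳ (0ℤ ℤ.+ signToℤ (side Γ₁ u)))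
    ... | no _  | no _     | yes _ = refl
    ... | no _  | no _     | no _  = refl

  adjacency-□̃ : ∀ x y → adjacency (Γ₁ □̃ Γ₂) x y ≡ ((A₁ ⊗ I m) ⊕ (D Γ₁ ⊗ A₂)) x y
  adjacency-□̃ x y = □-entry _ _ _ _

  adjacency-⋈̃ : ∀ x y → adjacency (Γ₁ ⋈̃ Γ₂) x y ≡ ((A₁ ⊕ D Γ₁) ⊗ A₂) x y
  adjacency-⋈̃ x y = ⋈-entry _ _ _ _

{-# OPTIONS --safe #-}
module Submission where

-- For a symmetric integer matrix A, the spectrum is symmetric if and only if
-- tr A ^ k = 0 for every odd k. Odd traces are easy to compute for both
-- products: A(Γ₁) anticommutes with D, so an odd power of
-- A(Γ₁) ⊗ I + D ⊗ A(Γ₂) has trace tr D · tr A(Γ₂) ^ k, and similarly for the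
-- semi-strong product, while tr D = |V₁| - |∁ V₁|.
--
-- If the odd traces vanish, Newton's identities determine the characteristic
-- polynomial p and give p(-X) = ± p(X).
--
-- Conversely, let the multiplicities be symmetric, and suppose that the
-- functional f ↦ tr f(A) - tr f(-A) on ℚ[X] is non-zero. Let the monic
-- polynomial c generate its annihilator. Then c also annihilates a non-zero
-- positive functional, hence is a multiple of the last polynomial of a
-- sequence of orthogonal polynomials, whose largest root r is found by
-- bisection in ℚ. By Newton's identities the Wronskian of p(X) and p(-X) is
-- p(X) p(-X) u / c for some u; as p(X) and p(-X) have the same multiplicity
-- at r, u vanishes at r. So the minimal polynomial of r over ℚ divides both c
-- and u, and dividing c by it gives a smaller annihilator. All appeals to
-- excluded middle are harmless, because the odd traces are rational numbers
-- and equality of rational numbers is decidable.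

open import Algebra.Bundles using (AbelianGroup; CommutativeRing; Ring)
open import Algebra.Bundles.Raw using (RawRing)
import Algebra.Definitions.RawSemiring as RawSemiringDefs
import Algebra.Properties.AbelianGroup as AbelianGroupProperties
import Algebra.Properties.CommutativeSemigroup as CommutativeSemigroupProperties
import Algebra.Properties.Ring as RingProperties
import Algebra.Properties.Semiring.Mult as SemiringMultiples
import Algebra.Properties.Semiring.Mult.TCOptimised as SemiringMult
import Algebra.Properties.Semiring.Sum as SemiringSum
import Algebra.Solver.Ring as RingSolver
open import Algebra.Solver.Ring.AlmostCommutativeRing
import Algebra.Solver.Ring.NaturalCoefficients.Default as SemiringSolver
open import Data.Bool.Base using (true; false; if_then_else_)
import Data.Bool.Properties as Bool
open import Data.Empty using (⊥; ⊥-elim)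
open import Data.Fin.Base as Fin using (Fin; zero; suc; punchIn)
import Data.Fin.Properties as Fin
open import Data.Fin.Subset using (Subset; _∈_; _∉_; ∣_∣; ∁)
open import Data.Fin.Subset.Properties using (_∈?_)
open import Data.Integer.Base as ℤ using (ℤ)
import Data.Integer.Properties as ℤ
open import Data.List.Base as List using (List; []; _∷_)
open import Data.List.Relation.Unary.All using (All; []; _∷_)
open import Data.Maybe.Base using (Maybe; just; nothing)
open import Data.Nat.Base as ℕ using (ℕ; zero; suc; z≤n; s≤s)
import Data.Nat.Properties as ℕ
open import Data.Product.Base using (_×_; _,_; proj₁; proj₂; ∃-syntax)
open import Data.Rational.Base as ℚ using (ℚ; 0ℚ; 1ℚ; ½)
import Data.Rational.Properties as ℚ
import Data.Rational.Unnormalised.Base as ℚᵘ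
import Data.Rational.Unnormalised.Properties as ℚᵘ
open import Data.Sign.Base as Sign using (Sign)
open import Data.Sum.Base using (_⊎_; inj₁; inj₂; [_,_]′)
open import Data.Unit.Base using (⊤; tt)
open import Data.Vec.Base as Vec using ([]; _∷_)
open import Data.Vec.Functional using (updateAt)
open import Data.Vec.Functional.Properties using (updateAt-updates; updateAt-minimal; updateAt-commutes; updateAt-id-local)
import Data.Vec.Properties as Vec
open import Function.Base using (_∘_; const)
open import Function.Bundles using (_⇔_; mk⇔; module Equivalence)
open import Level using (0ℓ)
open import Relation.Binary.Definitions using (tri<; tri≈; tri>)
open import Relation.Binary.PropositionalEquality as ≡ using (_≡_; _≢_)
import Relation.Binary.Reasoning.Setoid as SetoidReasoning
open import Relation.Nullary.Decidable using (Dec; yes; no; _×-dec_)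
open import Relation.Nullary.Negation using (¬_; contradiction)
open import Defs hiding (HasMultiplicity)

-- Equality of real numbers is undecidable, so the eigenvalues of a matrix A cannot simply be listed
-- with their multiplicities. The argument therefore stays over ℚ with the functional f ↦ tr f(A),
-- and real numbers enter only at the root r. Symmetry of A is used as positivity: tr f(A)² is a sum
-- of squares, which stands in for the reality of the eigenvalues and is what places r in ℝ. The
-- Wronskian comes from logarithmic derivatives. With t k = tr A ^ k, the fraction p′ / p is the
-- series of t k / X ^ (k + 1), so the logarithmic derivatives of p(X) and p(-X) differ by the
-- series of f ↦ tr f(A) - tr f(-A). The polynomial c is the reduced denominator of this difference
-- and u its numerator. Its residue at r is the multiplicity of r minus that of -r; if the two agree
-- there is no pole at r, although r is a root of the reduced denominator.

-- The coefficient (a , b) stands for the integer a − b.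
integerRing : RawRing 0ℓ 0ℓ
integerRing = record
  { Carrier = ℕ × ℕ
  ; _≈_     = _≡_
  ; _+_     = λ (a , b) (c , d) → a ℕ.+ c , b ℕ.+ d
  ; _*_     = λ (a , b) (c , d) → a ℕ.* c ℕ.+ b ℕ.* d , a ℕ.* d ℕ.+ b ℕ.* c
  ; -_      = λ (a , b) → b , a
  ; 0#      = 0 , 0
  ; 1#      = 1 , 0
  }

module IntegerSolver (R : CommutativeRing 0ℓ 0ℓ) where
  open CommutativeRing R
  open SemiringMult semiring using (×1-homo-*; ×-homo-+) renaming (_×_ to _·_)
  open RingProperties ring using (-1*x≈-x; -‿involutive)
  open SetoidReasoning setoid

  private
    nat : ℕ → Carrier
    nat n = n · 1#

    u : Carrier
    u = - 1#

    u*u≈1 : u * u ≈ 1#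
    u*u≈1 = trans (-1*x≈-x u) (-‿involutive 1#)

    open SemiringSolver commutativeSemiring
      using (solve; _:=_; _:+_; _:*_)

    -- The case distinction makes the values at (0 , 0) and (1 , 0)
    -- compute to 0# and 1#.
    val : ℕ × ℕ → Carrier
    val (a , zero)    = nat a
    val (a , b@(suc _)) = nat a + u * nat b

    val≈ : ∀ a b → val (a , b) ≈ nat a + u * nat b
    val≈ a zero    = sym (trans (+-congˡ (zeroʳ u)) (+-identityʳ _))
    val≈ a (suc b) = refl

    val-+ : ∀ x y → val (RawRing._+_ integerRing x y) ≈ val x + val y
    val-+ (a , b) (c , d) = begin
      val (a ℕ.+ c , b ℕ.+ d)                     ≈⟨ val≈ (a ℕ.+ c) (b ℕ.+ d) ⟩
      nat (a ℕ.+ c) + u * nat (b ℕ.+ d)           ≈⟨ +-cong (×-homo-+ 1# a c) (*-congˡ (×-homo-+ 1# b d)) ⟩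
      (nat a + nat c) + u * (nat b + nat d)       ≈⟨ solve 5 (λ a b c d u → (a :+ c) :+ u :* (b :+ d) := (a :+ u :* b) :+ (c :+ u :* d)) refl (nat a) (nat b) (nat c) (nat d) u ⟩
      (nat a + u * nat b) + (nat c + u * nat d)   ≈⟨ +-cong (val≈ a b) (val≈ c d) ⟨
      val (a , b) + val (c , d)                   ∎

    val-* : ∀ x y → val (RawRing._*_ integerRing x y) ≈ val x * val y
    val-* (a , b) (c , d) = begin
      val (a ℕ.* c ℕ.+ b ℕ.* d , a ℕ.* d ℕ.+ b ℕ.* c)
        ≈⟨ val≈ (a ℕ.* c ℕ.+ b ℕ.* d) (a ℕ.* d ℕ.+ b ℕ.* c) ⟩
      nat (a ℕ.* c ℕ.+ b ℕ.* d) + u * nat (a ℕ.* d ℕ.+ b ℕ.* c)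
        ≈⟨ +-cong (dot a c b d) (*-congˡ (dot a d b c)) ⟩
      (nat a * nat c + nat b * nat d) + u * (nat a * nat d + nat b * nat c)
        ≈⟨ +-congʳ (+-congˡ (trans (sym (*-identityˡ _)) (*-congʳ (sym u*u≈1)))) ⟩
      (nat a * nat c + u * u * (nat b * nat d)) + u * (nat a * nat d + nat b * nat c)
        ≈⟨ solve 5 (λ a b c d u → (a :* c :+ u :* u :* (b :* d)) :+ u :* (a :* d :+ b :* c) := (a :+ u :* b) :* (c :+ u :* d)) refl (nat a) (nat b) (nat c) (nat d) u ⟩
      (nat a + u * nat b) * (nat c + u * nat d)
        ≈⟨ *-cong (val≈ a b) (val≈ c d) ⟨
      val (a , b) * val (c , d) ∎
      where
      dot : ∀ a b c d → nat (a ℕ.* b ℕ.+ c ℕ.* d) ≈ nat a * nat b + nat c * nat d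
      dot a b c d = trans (×-homo-+ 1# (a ℕ.* b) (c ℕ.* d)) (+-cong (×1-homo-* a b) (×1-homo-* c d))

    val-neg : ∀ x → val (RawRing.-_ integerRing x) ≈ - val x
    val-neg (a , b) = begin
      val (b , a)                   ≈⟨ val≈ b a ⟩
      nat b + u * nat a             ≈⟨ +-congʳ (trans (sym (*-identityˡ _)) (*-congʳ (sym u*u≈1))) ⟩
      u * u * nat b + u * nat a     ≈⟨ solve 3 (λ a b u → u :* u :* b :+ u :* a := u :* (a :+ u :* b)) refl (nat a) (nat b) u ⟩
      u * (nat a + u * nat b)       ≈⟨ *-congˡ (val≈ a b) ⟨
      u * val (a , b)               ≈⟨ -1*x≈-x _ ⟩
      - val (a , b)                 ∎

    morphism : integerRing -Raw-AlmostCommutative⟶ fromCommutativeRing R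
    morphism = record
      { ⟦_⟧    = val
      ; +-homo = val-+
      ; *-homo = val-*
      ; -‿homo = val-neg
      ; 0-homo = refl
      ; 1-homo = refl
      }

    cancel : ∀ a b c d → a ℕ.+ d ≡ c ℕ.+ b → val (a , b) ≈ val (c , d)
    cancel a b c d eq = begin
      val (a , b)                                   ≈⟨ val≈ a b ⟩
      nat a + u * nat b                             ≈⟨ +-identityʳ _ ⟨
      nat a + u * nat b + 0#                        ≈⟨ +-congˡ (trans (+-congˡ (-1*x≈-x _)) (-‿inverseʳ (nat d))) ⟨
      nat a + u * nat b + (nat d + u * nat d)       ≈⟨ solve 4 (λ a b d u → a :+ u :* b :+ (d :+ u :* d) := (a :+ d) :+ u :* b :+ u :* d) refl (nat a) (nat b) (nat d) u ⟩
      (nat a + nat d) + u * nat b + u * nat d       ≈⟨ +-congʳ (+-congʳ a+d) ⟩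
      (nat c + nat b) + u * nat b + u * nat d       ≈⟨ solve 4 (λ b c d u → (c :+ b) :+ u :* b :+ u :* d := c :+ u :* d :+ (b :+ u :* b)) refl (nat b) (nat c) (nat d) u ⟩
      nat c + u * nat d + (nat b + u * nat b)       ≈⟨ +-congˡ (trans (+-congˡ (-1*x≈-x _)) (-‿inverseʳ (nat b))) ⟩
      nat c + u * nat d + 0#                        ≈⟨ +-identityʳ _ ⟩
      nat c + u * nat d                             ≈⟨ val≈ c d ⟨
      val (c , d)                                   ∎
      where
      a+d : nat a + nat d ≈ nat c + nat b
      a+d = trans (sym (×-homo-+ 1# a d)) (trans (reflexive (≡.cong nat eq)) (×-homo-+ 1# c b))

    -- Pairs are never reduced, so different pairs may denote the same integer. Comparing the sums
    -- crosswise lets the solver recognise coefficients that cancel, whatever the ring.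
    _≟_ : ∀ x y → Maybe (val x ≈ val y)
    (a , b) ≟ (c , d) with a ℕ.+ d ℕ.≟ c ℕ.+ b
    ... | yes eq = just (cancel a b c d eq)
    ... | no  _  = nothing

  private module S = RingSolver integerRing (fromCommutativeRing R) morphism _≟_
  open S public using (solve; _:=_; _:+_; _:*_; _:-_; :-_)

  :0 :1 : ∀ {n} → S.Polynomial n
  :0 = S.con (0 , 0)
  :1 = S.con (1 , 0)

-- Polynomials over a commutative ring form a commutative ring.

module PolynomialRing (R : CommutativeRing 0ℓ 0ℓ) where
  private
    module R = CommutativeRing R
    module RP = RingProperties R.ring
  open R using (Carrier; _≈_; _+_; _*_; -_; 0#; 1#)
  open Polynomial R.rawRing public
    using (Poly; coeff; _≈ᴾ_; _+ᴾ_; _*ᴾ_; -ᴾ_; X; eval)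
    renaming (const to constᴾ)
  open IntegerSolver R

  -- A record, so that unification recovers p and q from p ≋ q.
  infix 4 _≋_
  record _≋_ (p q : Poly) : Set where
    constructor ⟨_⟩
    field at : p ≈ᴾ q

  open _≋_ public

  infixr 7 _∙_
  _∙_ : Carrier → Poly → Poly
  a ∙ p = List.map (a *_) p

  X· : Poly → Poly
  X· p = 0# ∷ p

  coeff-+ : ∀ p q n → coeff (p +ᴾ q) n ≈ coeff p n + coeff q n
  coeff-+ []      q       n       = R.sym (R.+-identityˡ _)
  coeff-+ (a ∷ p) []      n       = R.sym (R.+-identityʳ _)
  coeff-+ (a ∷ p) (b ∷ q) zero    = R.refl
  coeff-+ (a ∷ p) (b ∷ q) (suc n) = coeff-+ p q n

  coeff-∙ : ∀ a p n → coeff (a ∙ p) n ≈ a * coeff p n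
  coeff-∙ a []      n       = R.sym (R.zeroʳ a)
  coeff-∙ a (b ∷ p) zero    = R.refl
  coeff-∙ a (b ∷ p) (suc n) = coeff-∙ a p n

  coeff-neg : ∀ p n → coeff (-ᴾ p) n ≈ - coeff p n
  coeff-neg []      n       = R.sym RP.-0#≈0#
  coeff-neg (b ∷ p) zero    = R.refl
  coeff-neg (b ∷ p) (suc n) = coeff-neg p n

  ≋-refl : ∀ {p} → p ≋ p
  ≋-refl = ⟨ (λ _ → R.refl) ⟩

  ≋-sym : ∀ {p q} → p ≋ q → q ≋ p
  ≋-sym e = ⟨ (λ n → R.sym (at e n)) ⟩

  ≋-trans : ∀ {p q r} → p ≋ q → q ≋ r → p ≋ r
  ≋-trans e f = ⟨ (λ n → R.trans (at e n) (at f n)) ⟩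

  ∷-cong : ∀ {a b p q} → a ≈ b → p ≋ q → a ∷ p ≋ b ∷ q
  ∷-cong a≈b e = ⟨ (λ { zero → a≈b ; (suc n) → at e n }) ⟩

  ∷-tail : ∀ {a b p q} → a ∷ p ≋ b ∷ q → p ≋ q
  ∷-tail e = ⟨ (λ n → at e (suc n)) ⟩

  0∷≋[] : ∀ {a p} → a ≈ 0# → p ≋ [] → a ∷ p ≋ []
  0∷≋[] a≈0 e = ⟨ (λ { zero → a≈0 ; (suc n) → at e n }) ⟩

  ∷≋[]-tail : ∀ {a p} → a ∷ p ≋ [] → p ≋ []
  ∷≋[]-tail e = ⟨ (λ n → at e (suc n)) ⟩

  private
    +ᴾ-cong : ∀ {p q r s} → p ≋ q → r ≋ s → p +ᴾ r ≋ q +ᴾ s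
    +ᴾ-cong {p} {q} {r} {s} e f = ⟨ (λ n → R.trans (coeff-+ p r n)
      (R.trans (R.+-cong (at e n) (at f n)) (R.sym (coeff-+ q s n)))) ⟩

    +ᴾ-assoc : ∀ p q r → (p +ᴾ q) +ᴾ r ≋ p +ᴾ (q +ᴾ r)
    +ᴾ-assoc p q r = ⟨ (λ n → R.trans (coeff-+ (p +ᴾ q) r n)
      (R.trans (R.+-congʳ (coeff-+ p q n)) (R.trans (R.+-assoc _ _ _)
      (R.trans (R.+-congˡ (R.sym (coeff-+ q r n))) (R.sym (coeff-+ p (q +ᴾ r) n)))))) ⟩

    +ᴾ-comm : ∀ p q → p +ᴾ q ≋ q +ᴾ p
    +ᴾ-comm p q = ⟨ (λ n → R.trans (coeff-+ p q n) (R.trans (R.+-comm _ _) (R.sym (coeff-+ q p n)))) ⟩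

    +ᴾ-identityʳ : ∀ p → p +ᴾ [] ≋ p
    +ᴾ-identityʳ p = ≋-trans (+ᴾ-comm p []) ≋-refl

    neg-cong : ∀ {p q} → p ≋ q → -ᴾ p ≋ -ᴾ q
    neg-cong {p} {q} e = ⟨ (λ n → R.trans (coeff-neg p n) (R.trans (R.-‿cong (at e n)) (R.sym (coeff-neg q n)))) ⟩

    inverseʳ : ∀ p → p +ᴾ -ᴾ p ≋ []
    inverseʳ p = ⟨ (λ n → R.trans (coeff-+ p (-ᴾ p) n) (R.trans (R.+-congˡ (coeff-neg p n)) (R.-‿inverseʳ _))) ⟩

  +ᴾ-abelianGroup : AbelianGroup 0ℓ 0ℓ
  +ᴾ-abelianGroup = record
    { Carrier = Poly ; _≈_ = _≋_ ; _∙_ = _+ᴾ_ ; ε = [] ; _⁻¹ = -ᴾ_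
    ; isAbelianGroup = record
      { isGroup = record
        { isMonoid = record
          { isSemigroup = record
            { isMagma = record
              { isEquivalence = record { refl = ≋-refl ; sym = ≋-sym ; trans = ≋-trans }
              ; ∙-cong = +ᴾ-cong }
            ; assoc = +ᴾ-assoc }
          ; identity = (λ p → ≋-refl) , +ᴾ-identityʳ }
        ; inverse = (λ p → ≋-trans (+ᴾ-comm (-ᴾ p) p) (inverseʳ p)) , inverseʳ
        ; ⁻¹-cong = neg-cong }
      ; comm = +ᴾ-comm } }

  open SetoidReasoning (AbelianGroup.setoid +ᴾ-abelianGroup)
  open CommutativeSemigroupProperties (AbelianGroup.commutativeSemigroup +ᴾ-abelianGroup) using (interchange; x∙yz≈y∙xz)

  ∙-cong : ∀ {a b p q} → a ≈ b → p ≋ q → a ∙ p ≋ b ∙ q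
  ∙-cong {a} {b} {p} {q} a≈b e = ⟨ (λ n → R.trans (coeff-∙ a p n)
    (R.trans (R.*-cong a≈b (at e n)) (R.sym (coeff-∙ b q n)))) ⟩

  ∙-distribˡ : ∀ a p q → a ∙ (p +ᴾ q) ≋ a ∙ p +ᴾ a ∙ q
  ∙-distribˡ a p q = ⟨ (λ n → R.trans (coeff-∙ a (p +ᴾ q) n) (R.trans (R.*-congˡ (coeff-+ p q n))
    (R.trans (R.distribˡ a _ _) (R.trans (R.+-cong (R.sym (coeff-∙ a p n)) (R.sym (coeff-∙ a q n)))
    (R.sym (coeff-+ (a ∙ p) (a ∙ q) n)))))) ⟩

  ∙-assoc : ∀ a b p → a ∙ b ∙ p ≋ (a * b) ∙ p
  ∙-assoc a b p = ⟨ (λ n → R.trans (coeff-∙ a (b ∙ p) n) (R.trans (R.*-congˡ (coeff-∙ b p n))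
    (R.trans (R.sym (R.*-assoc a b _)) (R.sym (coeff-∙ (a * b) p n))))) ⟩

  0∙ : ∀ p → 0# ∙ p ≋ []
  0∙ p = ⟨ (λ n → R.trans (coeff-∙ 0# p n) (R.zeroˡ _)) ⟩

  1∙ : ∀ p → 1# ∙ p ≋ p
  1∙ p = ⟨ (λ n → R.trans (coeff-∙ 1# p n) (R.*-identityˡ _)) ⟩

  X·-+ : ∀ p q → X· (p +ᴾ q) ≋ X· p +ᴾ X· q
  X·-+ p q = ∷-cong (R.sym (R.+-identityˡ 0#)) ≋-refl

  private
    *ᴾ-congˡ : ∀ p {q r} → q ≋ r → p *ᴾ q ≋ p *ᴾ r
    *ᴾ-congˡ []      e = ≋-refl
    *ᴾ-congˡ (a ∷ p) e = +ᴾ-cong (∙-cong R.refl e) (∷-cong R.refl (*ᴾ-congˡ p e))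

    *ᴾ-zeroʳ : ∀ p → p *ᴾ [] ≋ []
    *ᴾ-zeroʳ []      = ≋-refl
    *ᴾ-zeroʳ (a ∷ p) = 0∷≋[] R.refl (*ᴾ-zeroʳ p)

  -- Multiplication recurses on its left factor; this is the matching recursion on the right one,
  -- and commutativity follows by comparing the two.
  *ᴾ-∷ʳ : ∀ p b q → p *ᴾ (b ∷ q) ≋ b ∙ p +ᴾ X· (p *ᴾ q)
  *ᴾ-∷ʳ []      b q = ≋-sym (0∷≋[] R.refl ≋-refl)
  *ᴾ-∷ʳ (a ∷ p) b q = ∷-cong (R.+-congʳ (R.*-comm a b)) (begin
    a ∙ q +ᴾ p *ᴾ (b ∷ q)               ≈⟨ +ᴾ-cong (≋-refl {a ∙ q}) (*ᴾ-∷ʳ p b q) ⟩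
    a ∙ q +ᴾ (b ∙ p +ᴾ X· (p *ᴾ q))     ≈⟨ x∙yz≈y∙xz (a ∙ q) (b ∙ p) (X· (p *ᴾ q)) ⟩
    b ∙ p +ᴾ (a ∙ q +ᴾ X· (p *ᴾ q))     ∎)

  private
    *ᴾ-comm : ∀ p q → p *ᴾ q ≋ q *ᴾ p
    *ᴾ-comm []      q = ≋-sym (*ᴾ-zeroʳ q)
    *ᴾ-comm (a ∷ p) q = ≋-trans (+ᴾ-cong (≋-refl {a ∙ q}) (∷-cong R.refl (*ᴾ-comm p q))) (≋-sym (*ᴾ-∷ʳ q a p))

    *ᴾ-cong : ∀ {p q r s} → p ≋ q → r ≋ s → p *ᴾ r ≋ q *ᴾ s
    *ᴾ-cong {p} {q} {r} {s} e f = begin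
      p *ᴾ r   ≈⟨ *ᴾ-congˡ p f ⟩
      p *ᴾ s   ≈⟨ *ᴾ-comm p s ⟩
      s *ᴾ p   ≈⟨ *ᴾ-congˡ s e ⟩
      s *ᴾ q   ≈⟨ *ᴾ-comm s q ⟩
      q *ᴾ s   ∎

    *ᴾ-distribˡ : ∀ p q r → p *ᴾ (q +ᴾ r) ≋ p *ᴾ q +ᴾ p *ᴾ r
    *ᴾ-distribˡ []      q r = ≋-refl
    *ᴾ-distribˡ (a ∷ p) q r = begin
      a ∙ (q +ᴾ r) +ᴾ X· (p *ᴾ (q +ᴾ r))                   ≈⟨ +ᴾ-cong (∙-distribˡ a q r)
                                                               (≋-trans (∷-cong R.refl (*ᴾ-distribˡ p q r)) (X·-+ (p *ᴾ q) (p *ᴾ r))) ⟩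
      (a ∙ q +ᴾ a ∙ r) +ᴾ (X· (p *ᴾ q) +ᴾ X· (p *ᴾ r))     ≈⟨ interchange (a ∙ q) (a ∙ r) (X· (p *ᴾ q)) (X· (p *ᴾ r)) ⟩
      (a ∷ p) *ᴾ q +ᴾ (a ∷ p) *ᴾ r                         ∎

    *ᴾ-distribʳ : ∀ p q r → (q +ᴾ r) *ᴾ p ≋ q *ᴾ p +ᴾ r *ᴾ p
    *ᴾ-distribʳ p q r = ≋-trans (*ᴾ-comm (q +ᴾ r) p) (≋-trans (*ᴾ-distribˡ p q r) (+ᴾ-cong (*ᴾ-comm p q) (*ᴾ-comm p r)))

  X·-* : ∀ p q → X· p *ᴾ q ≋ X· (p *ᴾ q)
  X·-* p q = +ᴾ-cong (0∙ q) ≋-refl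

  ∙-* : ∀ a p q → (a ∙ p) *ᴾ q ≋ a ∙ (p *ᴾ q)
  ∙-* a []      q = ≋-refl
  ∙-* a (b ∷ p) q = begin
    (a * b) ∙ q +ᴾ X· ((a ∙ p) *ᴾ q)    ≈⟨ +ᴾ-cong (≋-sym (∙-assoc a b q)) (∷-cong (R.sym (R.zeroʳ a)) (∙-* a p q)) ⟩
    a ∙ b ∙ q +ᴾ a ∙ X· (p *ᴾ q)        ≈⟨ ∙-distribˡ a (b ∙ q) (X· (p *ᴾ q)) ⟨
    a ∙ (b ∙ q +ᴾ X· (p *ᴾ q))          ∎

  private
    *ᴾ-assoc : ∀ p q r → (p *ᴾ q) *ᴾ r ≋ p *ᴾ (q *ᴾ r)
    *ᴾ-assoc []      q r = ≋-refl
    *ᴾ-assoc (a ∷ p) q r = begin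
      (a ∙ q +ᴾ X· (p *ᴾ q)) *ᴾ r            ≈⟨ *ᴾ-distribʳ r (a ∙ q) (X· (p *ᴾ q)) ⟩
      (a ∙ q) *ᴾ r +ᴾ X· (p *ᴾ q) *ᴾ r       ≈⟨ +ᴾ-cong (∙-* a q r) (X·-* (p *ᴾ q) r) ⟩
      a ∙ (q *ᴾ r) +ᴾ X· ((p *ᴾ q) *ᴾ r)     ≈⟨ +ᴾ-cong (≋-refl {a ∙ (q *ᴾ r)}) (∷-cong R.refl (*ᴾ-assoc p q r)) ⟩
      a ∙ (q *ᴾ r) +ᴾ X· (p *ᴾ (q *ᴾ r))     ∎

  const-* : ∀ a q → constᴾ a *ᴾ q ≋ a ∙ q
  const-* a q = ≋-trans (+ᴾ-cong (≋-refl {a ∙ q}) (0∷≋[] R.refl ≋-refl)) (+ᴾ-identityʳ _)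

  private
    *ᴾ-identityˡ : ∀ q → constᴾ 1# *ᴾ q ≋ q
    *ᴾ-identityˡ q = ≋-trans (const-* 1# q) (1∙ q)

  polynomialRing : CommutativeRing 0ℓ 0ℓ
  polynomialRing = record
    { Carrier = Poly ; _≈_ = _≋_ ; _+_ = _+ᴾ_ ; _*_ = _*ᴾ_ ; -_ = -ᴾ_ ; 0# = [] ; 1# = constᴾ 1#
    ; isCommutativeRing = record
      { isRing = record
        { +-isAbelianGroup = AbelianGroup.isAbelianGroup +ᴾ-abelianGroup
        ; *-cong = *ᴾ-cong
        ; *-assoc = *ᴾ-assoc
        ; *-identity = *ᴾ-identityˡ , λ q → ≋-trans (*ᴾ-comm q (constᴾ 1#)) (*ᴾ-identityˡ q)
        ; distrib = *ᴾ-distribˡ , *ᴾ-distribʳ }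
      ; *-comm = *ᴾ-comm } }

-- Degree bounds, division, evaluation, derivatives and reflection.

module Polynomials (R : CommutativeRing 0ℓ 0ℓ) where
  private
    module R = CommutativeRing R
    module RP = RingProperties R.ring
  open R using (Carrier; _≈_; _+_; _*_; _-_; -_; 0#; 1#)
  open PolynomialRing R public
  private
    module P = CommutativeRing polynomialRing
    module PP = RingProperties P.ring
    module S = IntegerSolver R
    module T = IntegerSolver polynomialRing
  open SetoidReasoning P.setoid
  open CommutativeSemigroupProperties P.+-commutativeSemigroup using (interchange)
  open import Algebra.Properties.Semiring.Mult R.semiring using () renaming (_×_ to _·_) public

  open T using (_:=_; _:+_; _:*_; _:-_; :-_)

  -- Coefficient lists may end in zeros, and over ℝ these cannot be recognised, so there is no
  -- degree function. This strict bound on the degree replaces it; `Below 0` characterises the zero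
  -- polynomial.
  record Below (k : ℕ) (p : Poly) : Set where
    constructor below
    field vanish : ∀ n → k ℕ.≤ n → coeff p n ≈ 0#

  open Below public

  below-length : ∀ p → Below (List.length p) p
  below-length []      = below (λ _ _ → R.refl)
  below-length (a ∷ p) = below (λ { (suc n) (s≤s l) → vanish (below-length p) n l })

  below-cong : ∀ {k p q} → p ≋ q → Below k p → Below k q
  below-cong e b = below (λ n l → R.trans (R.sym (at e n)) (vanish b n l))

  below-weaken : ∀ {k l p} → k ℕ.≤ l → Below k p → Below l p
  below-weaken k≤l b = below (λ n h → vanish b n (ℕ.≤-trans k≤l h))

  below-0⇒≋[] : ∀ {p} → Below 0 p → p ≋ []
  below-0⇒≋[] b = ⟨ (λ n → vanish b n z≤n) ⟩

  below-[] : ∀ {k} → Below k []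
  below-[] = below (λ _ _ → R.refl)

  below-∷ : ∀ {k a p} → Below k p → Below (suc k) (a ∷ p)
  below-∷ b = below (λ { (suc n) (s≤s l) → vanish b n l })

  below-tail : ∀ {k a p} → Below (suc k) (a ∷ p) → Below k p
  below-tail b = below (λ n l → vanish b (suc n) (s≤s l))

  below-+ : ∀ {k p q} → Below k p → Below k q → Below k (p +ᴾ q)
  below-+ {k} {p} {q} b c = below (λ n l → R.trans (coeff-+ p q n)
    (R.trans (R.+-cong (vanish b n l) (vanish c n l)) (R.+-identityˡ 0#)))

  below-∙ : ∀ {k a p} → Below k p → Below k (a ∙ p)
  below-∙ {k} {a} {p} b = below (λ n l → R.trans (coeff-∙ a p n)
    (R.trans (R.*-congˡ (vanish b n l)) (R.zeroʳ a)))

  below-neg : ∀ {k p} → Below k p → Below k (-ᴾ p)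
  below-neg {k} {p} b = below (λ n l → R.trans (coeff-neg p n)
    (R.trans (R.-‿cong (vanish b n l)) RP.-0#≈0#))

  below-step : ∀ {k p} → Below (suc k) p → coeff p k ≈ 0# → Below k p
  below-step {k} {p} b z = below lemma
    where
    lemma : ∀ n → k ℕ.≤ n → coeff p n ≈ 0#
    lemma n l with k ℕ.≟ n
    ... | yes ≡.refl = z
    ... | no  k≢n    = vanish b n (ℕ.≤∧≢⇒< l k≢n)

  below-* : ∀ {m n p q} → Below m p → Below (suc n) q → Below (m ℕ.+ n) (p *ᴾ q)
  below-* {m} {n} {[]} b c = below-[]
  below-* {zero} {n} {a ∷ p} {q} b c = below-cong (P.sym (P.trans (P.*-congʳ {q} (below-0⇒≋[] b)) (P.zeroˡ q))) below-[]
  below-* {suc m} {n} {a ∷ p} {q} b c = below-+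
    (below-∙ (below-weaken (s≤s (ℕ.m≤n+m n m)) c))
    (below-∷ (below-* (below-tail b) c))

  coeff-*-top : ∀ {m n} p q → Below (suc m) p → Below (suc n) q →
                coeff (p *ᴾ q) (m ℕ.+ n) ≈ coeff p m * coeff q n
  coeff-*-top [] q b c = R.sym (R.zeroˡ _)
  coeff-*-top {zero} {n} (a ∷ p) q b c = R.trans (coeff-+ (a ∙ q) (X· (p *ᴾ q)) n)
      (R.trans (R.+-cong (coeff-∙ a q n) (at (0∷≋[] {0#} R.refl p*q≋[]) n)) (R.+-identityʳ _))
    where
    p*q≋[] : p *ᴾ q ≋ []
    p*q≋[] = P.trans (P.*-congʳ {q} (below-0⇒≋[] (below-tail b))) (P.zeroˡ q)
  coeff-*-top {suc m} {n} (a ∷ p) q b c =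
    R.trans (coeff-+ (a ∙ q) (X· (p *ᴾ q)) (suc (m ℕ.+ n)))
    (R.trans (R.+-cong (vanish (below-∙ {a = a} c) (suc (m ℕ.+ n)) (s≤s (ℕ.m≤n+m n m)))
                       (coeff-*-top p q (below-tail b) c)) (R.+-identityˡ _))

  record Monic (d : ℕ) (p : Poly) : Set where
    constructor monic
    field
      monic-below : Below (suc d) p
      monic-top   : coeff p d ≈ 1#

  open Monic public

  record Division (c f : Poly) (d : ℕ) : Set where
    field
      quotient remainder : Poly
      division-≋         : f ≋ c *ᴾ quotient +ᴾ remainder
      remainder-below    : Below d remainder

  -- For a dividend a + X f, the quotient and remainder of f are multiplied by X. The new remainder
  -- then has degree at most d, and subtracting s c, with s its coefficient at X ^ d, removes that
  -- term because c is monic.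
  divide : ∀ {d c} → Monic d c → ∀ f → Division c f d
  divide {d} {c} mc [] = record
    { quotient = [] ; remainder = []
    ; division-≋ = P.sym (P.trans (P.+-identityʳ (c *ᴾ [])) (P.zeroʳ c))
    ; remainder-below = below-[] }
  divide {d} {c} mc (a ∷ f) = record
    { quotient = s ∷ quotient ; remainder = r′
    ; division-≋ = begin
        a ∷ f                                                  ≈⟨ ∷-cong (R.sym (R.+-identityˡ a)) division-≋ ⟩
        X· (c *ᴾ quotient) +ᴾ (a ∷ remainder)                  ≈⟨ T.solve 3 (λ x y z → x :+ y := (z :+ x) :+ (y :- z)) P.refl
                                                                    (X· (c *ᴾ quotient)) (a ∷ remainder) (s ∙ c) ⟩
        (s ∙ c +ᴾ X· (c *ᴾ quotient)) +ᴾ r′                    ≈⟨ P.+-congʳ {r′} (*ᴾ-∷ʳ c s quotient) ⟨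
        c *ᴾ (s ∷ quotient) +ᴾ r′                              ∎
    ; remainder-below = below-step
        (below-+ (below-∷ remainder-below) (below-neg (below-∙ (monic-below mc))))
        (R.trans (coeff-+ (a ∷ remainder) (-ᴾ (s ∙ c)) d)
        (R.trans (R.+-congˡ (R.trans (coeff-neg (s ∙ c) d) (R.-‿cong
          (R.trans (coeff-∙ s c d) (R.trans (R.*-congˡ (monic-top mc)) (R.*-identityʳ s))))))
        (R.-‿inverseʳ s))) }
    where
    open Division (divide mc f)
    s = coeff (a ∷ remainder) d
    r′ = (a ∷ remainder) +ᴾ -ᴾ (s ∙ c)

  -- The length of h is a first bound. As c is monic, the top coefficient of c h is that of h, so
  -- the bound on h can be lowered one step at a time without testing any coefficient for zero.
  monic-*-below : ∀ {d c} → Monic d c → ∀ {k} h → Below (d ℕ.+ k) (c *ᴾ h) → Below k h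
  monic-*-below {d} {c} mc {k} h b = descend (List.length h)
    (below-weaken (ℕ.m≤n+m (List.length h) k) (below-length h))
    where
    descend : ∀ j → Below (k ℕ.+ j) h → Below k h
    descend zero    bh = below-weaken (ℕ.≤-reflexive (ℕ.+-identityʳ k)) bh
    descend (suc j) bh = descend j (below-step bh′ (R.trans (R.sym (R.*-identityˡ _))
      (R.trans (R.*-congʳ (R.sym (monic-top mc)))
      (R.trans (R.sym (coeff-*-top c h (monic-below mc) bh′))
      (vanish b (d ℕ.+ (k ℕ.+ j)) (ℕ.+-monoʳ-≤ d (ℕ.m≤m+n k j)))))))
      where
      bh′ : Below (suc (k ℕ.+ j)) h
      bh′ = below-weaken (ℕ.≤-reflexive (ℕ.+-suc k j)) bh

  monic-cancel : ∀ {d c} → Monic d c → ∀ h → c *ᴾ h ≋ [] → h ≋ []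
  monic-cancel mc h e = below-0⇒≋[] (monic-*-below mc h (below-cong (P.sym e) below-[]))

  eval-cong : ∀ p q x → p ≋ q → eval p x ≈ eval q x
  eval-cong []      []      x e = R.refl
  eval-cong []      (b ∷ q) x e = R.sym (R.trans (R.+-cong (R.sym (at e 0))
    (R.trans (R.*-congˡ (R.sym (eval-cong [] q x (≋-sym (∷≋[]-tail (≋-sym e)))))) (R.zeroʳ x))) (R.+-identityˡ 0#))
  eval-cong (a ∷ p) []      x e = R.trans (R.+-cong (at e 0)
    (R.trans (R.*-congˡ (eval-cong p [] x (∷≋[]-tail e))) (R.zeroʳ x))) (R.+-identityˡ 0#)
  eval-cong (a ∷ p) (b ∷ q) x e = R.+-cong (at e 0) (R.*-congˡ (eval-cong p q x (∷-tail e)))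

  eval-+ : ∀ p q x → eval (p +ᴾ q) x ≈ eval p x + eval q x
  eval-+ []      q       x = R.sym (R.+-identityˡ _)
  eval-+ (a ∷ p) []      x = R.sym (R.+-identityʳ _)
  eval-+ (a ∷ p) (b ∷ q) x = R.trans (R.+-congˡ (R.*-congˡ (eval-+ p q x)))
    (S.solve 5 (λ a b u v x → (a S.:+ b) S.:+ x S.:* (u S.:+ v) S.:= (a S.:+ x S.:* u) S.:+ (b S.:+ x S.:* v))
      R.refl a b (eval p x) (eval q x) x)

  eval-∙ : ∀ a p x → eval (a ∙ p) x ≈ a * eval p x
  eval-∙ a []      x = R.sym (R.zeroʳ a)
  eval-∙ a (b ∷ p) x = R.trans (R.+-congˡ (R.*-congˡ (eval-∙ a p x)))
    (S.solve 4 (λ a b u x → a S.:* b S.:+ x S.:* (a S.:* u) S.:= a S.:* (b S.:+ x S.:* u)) R.refl a b (eval p x) x)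

  eval-neg : ∀ p x → eval (-ᴾ p) x ≈ - eval p x
  eval-neg []      x = R.sym RP.-0#≈0#
  eval-neg (b ∷ p) x = R.trans (R.+-congˡ (R.*-congˡ (eval-neg p x)))
    (S.solve 3 (λ b u x → S.:- b S.:+ x S.:* (S.:- u) S.:= S.:- (b S.:+ x S.:* u)) R.refl b (eval p x) x)

  eval-* : ∀ p q x → eval (p *ᴾ q) x ≈ eval p x * eval q x
  eval-* []      q x = R.sym (R.zeroˡ _)
  eval-* (a ∷ p) q x = R.trans (eval-+ (a ∙ q) (X· (p *ᴾ q)) x)
    (R.trans (R.+-cong (eval-∙ a q x) (R.+-congˡ (R.*-congˡ (eval-* p q x))))
    (S.solve 4 (λ a u v x → a S.:* v S.:+ (S.:0 S.:+ x S.:* (u S.:* v)) S.:= (a S.:+ x S.:* u) S.:* v)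
      R.refl a (eval p x) (eval q x) x))

  deriv : Poly → Poly
  deriv []      = []
  deriv (a ∷ p) = p +ᴾ X· (deriv p)

  coeff-deriv : ∀ p n → coeff (deriv p) n ≈ suc n · coeff p (suc n)
  coeff-deriv []      n       = R.sym (zeros (suc n))
    where
    zeros : ∀ n → n · 0# ≈ 0#
    zeros zero    = R.refl
    zeros (suc n) = R.trans (R.+-identityˡ _) (zeros n)
  coeff-deriv (a ∷ p) zero    = coeff-+ p (X· (deriv p)) 0
  coeff-deriv (a ∷ p) (suc n) = R.trans (coeff-+ p (X· (deriv p)) (suc n)) (R.+-congˡ (coeff-deriv p n))

  deriv-cong : ∀ p q → p ≋ q → deriv p ≋ deriv q
  deriv-cong p q e = ⟨ (λ n → R.trans (coeff-deriv p n) (R.trans (×-congʳ (suc n) (at e (suc n))) (R.sym (coeff-deriv q n)))) ⟩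
    where open import Algebra.Properties.Semiring.Mult R.semiring using (×-congʳ)

  deriv-+ : ∀ p q → deriv (p +ᴾ q) ≋ deriv p +ᴾ deriv q
  deriv-+ []      q       = P.refl
  deriv-+ (a ∷ p) []      = P.sym (P.+-identityʳ _)
  deriv-+ (a ∷ p) (b ∷ q) = begin
    (p +ᴾ q) +ᴾ X· (deriv (p +ᴾ q))                 ≈⟨ P.+-congˡ {p +ᴾ q} (P.trans (∷-cong R.refl (deriv-+ p q)) (X·-+ (deriv p) (deriv q))) ⟩
    (p +ᴾ q) +ᴾ (X· (deriv p) +ᴾ X· (deriv q))      ≈⟨ interchange p q (X· (deriv p)) (X· (deriv q)) ⟩
    deriv (a ∷ p) +ᴾ deriv (b ∷ q)                  ∎

  ∙-X· : ∀ a p → a ∙ X· p ≋ X· (a ∙ p)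
  ∙-X· a p = ∷-cong (R.zeroʳ a) P.refl

  deriv-∙ : ∀ a p → deriv (a ∙ p) ≋ a ∙ deriv p
  deriv-∙ a []      = P.refl
  deriv-∙ a (b ∷ p) = begin
    a ∙ p +ᴾ X· (deriv (a ∙ p))     ≈⟨ P.+-congˡ {a ∙ p} (P.trans (∷-cong R.refl (deriv-∙ a p)) (P.sym (∙-X· a (deriv p)))) ⟩
    a ∙ p +ᴾ a ∙ X· (deriv p)       ≈⟨ ∙-distribˡ a p (X· (deriv p)) ⟨
    a ∙ (p +ᴾ X· (deriv p))         ∎

  deriv-* : ∀ p q → deriv (p *ᴾ q) ≋ deriv p *ᴾ q +ᴾ p *ᴾ deriv q
  deriv-* []      q = P.refl
  deriv-* (a ∷ p) q = begin
    deriv (a ∙ q +ᴾ X· (p *ᴾ q))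
      ≈⟨ P.trans (deriv-+ (a ∙ q) (X· (p *ᴾ q))) (P.+-cong (deriv-∙ a q) (P.+-congˡ {p *ᴾ q}
           (P.trans (∷-cong R.refl (deriv-* p q)) (X·-+ (deriv p *ᴾ q) (p *ᴾ deriv q))))) ⟩
    a ∙ deriv q +ᴾ (p *ᴾ q +ᴾ (X· (deriv p *ᴾ q) +ᴾ X· (p *ᴾ deriv q)))
      ≈⟨ T.solve 4 (λ u v w z → u :+ (v :+ (w :+ z)) := (v :+ w) :+ (u :+ z)) P.refl
           (a ∙ deriv q) (p *ᴾ q) (X· (deriv p *ᴾ q)) (X· (p *ᴾ deriv q)) ⟩
    (p *ᴾ q +ᴾ X· (deriv p *ᴾ q)) +ᴾ (a ∙ deriv q +ᴾ X· (p *ᴾ deriv q))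
      ≈⟨ P.+-congʳ {a ∙ deriv q +ᴾ X· (p *ᴾ deriv q)} (P.trans (P.+-congˡ {p *ᴾ q} (P.sym (X·-* (deriv p) q)))
           (P.sym (P.distribʳ q p (X· (deriv p))))) ⟩
    (p +ᴾ X· (deriv p)) *ᴾ q +ᴾ (a ∷ p) *ᴾ deriv q ∎

  -- The substitution X ↦ - X

  reflect : Poly → Poly
  reflect []      = []
  reflect (a ∷ p) = a ∷ -ᴾ reflect p

  -- This is (-1) ^ n t n. If t lists the moments of a functional, these are the moments of f ↦ t
  -- (f(-X)).
  alternate : (ℕ → Carrier) → ℕ → Carrier
  alternate t zero    = t zero
  alternate t (suc n) = - alternate (t ∘ suc) n

  alternate-cong : ∀ {s t} → (∀ n → s n ≈ t n) → ∀ n → alternate s n ≈ alternate t n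
  alternate-cong e zero    = e zero
  alternate-cong e (suc n) = R.-‿cong (alternate-cong (e ∘ suc) n)

  alternate-linear : ∀ a s t n → alternate (λ k → a * s k + t k) n ≈ a * alternate s n + alternate t n
  alternate-linear a s t zero    = R.refl
  alternate-linear a s t (suc n) = R.trans (R.-‿cong (alternate-linear a (s ∘ suc) (t ∘ suc) n))
    (S.solve 3 (λ a u v → S.:- (a S.:* u S.:+ v) S.:= a S.:* (S.:- u) S.:+ (S.:- v)) R.refl a
      (alternate (s ∘ suc) n) (alternate (t ∘ suc) n))

  alternate-zero : ∀ t → (∀ n → t n ≈ 0#) → ∀ n → alternate t n ≈ 0#
  alternate-zero t z zero    = z zero
  alternate-zero t z (suc n) = R.trans (R.-‿cong (alternate-zero (t ∘ suc) (z ∘ suc) n)) RP.-0#≈0#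

  coeff-reflect : ∀ p n → coeff (reflect p) n ≈ alternate (coeff p) n
  coeff-reflect []      n       = R.sym (alternate-zero (coeff []) (λ _ → R.refl) n)
  coeff-reflect (a ∷ p) zero    = R.refl
  coeff-reflect (a ∷ p) (suc n) = R.trans (coeff-neg (reflect p) n) (R.-‿cong (coeff-reflect p n))

  reflect-cong : ∀ p q → p ≋ q → reflect p ≋ reflect q
  reflect-cong p q e = ⟨ (λ n → R.trans (coeff-reflect p n) (R.trans (alternate-cong (at e) n) (R.sym (coeff-reflect q n)))) ⟩

  reflect-+ : ∀ p q → reflect (p +ᴾ q) ≋ reflect p +ᴾ reflect q
  reflect-+ []      q       = P.refl
  reflect-+ (a ∷ p) []      = P.refl
  reflect-+ (a ∷ p) (b ∷ q) = ∷-cong R.refl (P.trans (P.-‿cong (reflect-+ p q))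
    (T.solve 2 (λ u v → :- (u :+ v) := :- u :+ :- v) P.refl (reflect p) (reflect q)))

  ∙-neg : ∀ a p → a ∙ (-ᴾ p) ≋ -ᴾ (a ∙ p)
  ∙-neg a p = ⟨ (λ n → R.trans (coeff-∙ a (-ᴾ p) n) (R.trans (R.*-congˡ (coeff-neg p n))
    (R.trans (R.sym (RP.-‿distribʳ-* a _)) (R.trans (R.-‿cong (R.sym (coeff-∙ a p n))) (R.sym (coeff-neg (a ∙ p) n)))))) ⟩

  reflect-∙ : ∀ a p → reflect (a ∙ p) ≋ a ∙ reflect p
  reflect-∙ a []      = P.refl
  reflect-∙ a (b ∷ p) = ∷-cong R.refl (P.trans (P.-‿cong (reflect-∙ a p)) (P.sym (∙-neg a (reflect p))))

  reflect-neg : ∀ p → reflect (-ᴾ p) ≋ -ᴾ reflect p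
  reflect-neg []      = P.refl
  reflect-neg (b ∷ p) = ∷-cong R.refl (P.-‿cong (reflect-neg p))

  X·-neg : ∀ p → X· (-ᴾ p) ≋ -ᴾ X· p
  X·-neg p = ∷-cong (R.sym RP.-0#≈0#) P.refl

  reflect-* : ∀ p q → reflect (p *ᴾ q) ≋ reflect p *ᴾ reflect q
  reflect-* []      q = P.refl
  reflect-* (a ∷ p) q = begin
    reflect (a ∙ q +ᴾ X· (p *ᴾ q))                           ≈⟨ reflect-+ (a ∙ q) (X· (p *ᴾ q)) ⟩
    reflect (a ∙ q) +ᴾ X· (-ᴾ reflect (p *ᴾ q))              ≈⟨ P.+-cong (reflect-∙ a q) (∷-cong R.refl
                                                                  (P.trans (P.-‿cong (reflect-* p q)) (PP.-‿distribˡ-* (reflect p) (reflect q)))) ⟩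
    a ∙ reflect q +ᴾ X· ((-ᴾ reflect p) *ᴾ reflect q)        ∎

  reflect-involutive : ∀ p → reflect (reflect p) ≋ p
  reflect-involutive []      = P.refl
  reflect-involutive (a ∷ p) = ∷-cong R.refl (P.trans (P.-‿cong (reflect-neg (reflect p)))
    (P.trans (PP.-‿involutive _) (reflect-involutive p)))

  deriv-neg : ∀ p → deriv (-ᴾ p) ≋ -ᴾ deriv p
  deriv-neg []      = P.refl
  deriv-neg (a ∷ p) = P.trans (P.+-congˡ { -ᴾ p} (P.trans (∷-cong R.refl (deriv-neg p)) (X·-neg (deriv p))))
    (T.solve 2 (λ u v → :- u :+ :- v := :- (u :+ v)) P.refl p (X· (deriv p)))

  deriv-reflect : ∀ p → deriv (reflect p) ≋ -ᴾ reflect (deriv p)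
  deriv-reflect []      = P.refl
  deriv-reflect (a ∷ p) = begin
    -ᴾ reflect p +ᴾ X· (deriv (-ᴾ reflect p))
      ≈⟨ P.+-congˡ { -ᴾ reflect p} (∷-cong R.refl (P.trans (deriv-neg (reflect p)) (P.-‿cong (deriv-reflect p)))) ⟩
    -ᴾ reflect p +ᴾ X· (-ᴾ (-ᴾ reflect (deriv p)))
      ≈⟨ P.+-congˡ { -ᴾ reflect p} (X·-neg (-ᴾ reflect (deriv p))) ⟩
    -ᴾ reflect p +ᴾ -ᴾ reflect (X· (deriv p))
      ≈⟨ T.solve 2 (λ u v → :- u :+ :- v := :- (u :+ v)) P.refl (reflect p) (reflect (X· (deriv p))) ⟩
    -ᴾ (reflect p +ᴾ reflect (X· (deriv p)))
      ≈⟨ P.-‿cong (reflect-+ p (X· (deriv p))) ⟨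
    -ᴾ reflect (p +ᴾ X· (deriv p)) ∎

-- A linear functional on polynomials is given by its sequence t of moments,
-- its values at the powers of X; (p • t) k is its value at X ^ k * p, so
-- that p • t is the functional f ↦ t (f * p).
module Moments (R : CommutativeRing 0ℓ 0ℓ) where
  private
    module R = CommutativeRing R
    module RP = RingProperties R.ring
  open R using (Carrier; _≈_; _+_; _*_; _-_; -_; 0#; 1#)
  open Polynomials R public
  private
    module P = CommutativeRing polynomialRing
    module S = IntegerSolver R
  open SetoidReasoning P.setoid

  infixr 7 _•_
  _•_ : Poly → (ℕ → Carrier) → ℕ → Carrier
  ([] • t)      k = 0#
  ((a ∷ p) • t) k = a * t k + (p • t) (suc k)

  Annihilates : Poly → (ℕ → Carrier) → Set
  Annihilates p t = ∀ k → (p • t) k ≈ 0#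

  •-cong : ∀ p q t k → p ≋ q → (p • t) k ≈ (q • t) k
  •-cong []      []      t k e = R.refl
  •-cong []      (b ∷ q) t k e = R.sym (R.trans (R.+-cong (R.trans (R.*-congʳ (R.sym (at e 0))) (R.zeroˡ _))
    (R.sym (•-cong [] q t (suc k) (≋-sym (∷≋[]-tail (≋-sym e)))))) (R.+-identityˡ 0#))
  •-cong (a ∷ p) []      t k e = R.trans (R.+-cong (R.trans (R.*-congʳ (at e 0)) (R.zeroˡ _))
    (•-cong p [] t (suc k) (∷≋[]-tail e))) (R.+-identityˡ 0#)
  •-cong (a ∷ p) (b ∷ q) t k e = R.+-cong (R.*-congʳ (at e 0)) (•-cong p q t (suc k) (∷-tail e))

  •-congʳ : ∀ p {s t} → (∀ k → s k ≈ t k) → ∀ k → (p • s) k ≈ (p • t) k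
  •-congʳ []      e k = R.refl
  •-congʳ (a ∷ p) e k = R.+-cong (R.*-congˡ (e k)) (•-congʳ p e (suc k))

  •-+ : ∀ p q t k → ((p +ᴾ q) • t) k ≈ (p • t) k + (q • t) k
  •-+ []      q       t k = R.sym (R.+-identityˡ _)
  •-+ (a ∷ p) []      t k = R.sym (R.+-identityʳ _)
  •-+ (a ∷ p) (b ∷ q) t k = R.trans (R.+-congˡ (•-+ p q t (suc k)))
    (S.solve 5 (λ a b x u v → (a S.:+ b) S.:* x S.:+ (u S.:+ v) S.:= (a S.:* x S.:+ u) S.:+ (b S.:* x S.:+ v))
      R.refl a b (t k) ((p • t) (suc k)) ((q • t) (suc k)))

  •-∙ : ∀ a p t k → ((a ∙ p) • t) k ≈ a * (p • t) k
  •-∙ a []      t k = R.sym (R.zeroʳ a)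
  •-∙ a (b ∷ p) t k = R.trans (R.+-congˡ (•-∙ a p t (suc k)))
    (S.solve 4 (λ a b x u → a S.:* b S.:* x S.:+ a S.:* u S.:= a S.:* (b S.:* x S.:+ u))
      R.refl a b (t k) ((p • t) (suc k)))

  •-neg : ∀ p t k → ((-ᴾ p) • t) k ≈ - (p • t) k
  •-neg []      t k = R.sym RP.-0#≈0#
  •-neg (b ∷ p) t k = R.trans (R.+-congˡ (•-neg p t (suc k)))
    (S.solve 3 (λ b x u → (S.:- b) S.:* x S.:+ (S.:- u) S.:= S.:- (b S.:* x S.:+ u))
      R.refl b (t k) ((p • t) (suc k)))

  •-X· : ∀ p t k → (X· p • t) k ≈ (p • t) (suc k)
  •-X· p t k = R.trans (R.+-congʳ (R.zeroˡ _)) (R.+-identityˡ _)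

  •-* : ∀ p q t k → ((p *ᴾ q) • t) k ≈ (p • q • t) k
  •-* []      q t k = R.refl
  •-* (a ∷ p) q t k = R.trans (•-+ (a ∙ q) (X· (p *ᴾ q)) t k)
    (R.+-cong (•-∙ a q t k) (R.trans (•-X· (p *ᴾ q) t k) (•-* p q t (suc k))))

  •-shift : ∀ p t k → (p • (t ∘ suc)) k ≈ (p • t) (suc k)
  •-shift []      t k = R.refl
  •-shift (a ∷ p) t k = R.+-congˡ (•-shift p t (suc k))

  •-zero : ∀ p t → (∀ k → t k ≈ 0#) → Annihilates p t
  •-zero []      t z k = R.refl
  •-zero (a ∷ p) t z k = R.trans (R.+-cong (R.trans (R.*-congˡ (z k)) (R.zeroʳ a)) (•-zero p t z (suc k))) (R.+-identityˡ 0#)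

  •-linear : ∀ p a s t k → (p • (λ j → a * s j + t j)) k ≈ a * (p • s) k + (p • t) k
  •-linear []      a s t k = R.sym (R.trans (R.+-identityʳ _) (R.zeroʳ a))
  •-linear (b ∷ p) a s t k = R.trans (R.+-congˡ (•-linear p a s t (suc k)))
    (S.solve 6 (λ a b x y u v → b S.:* (a S.:* x S.:+ y) S.:+ (a S.:* u S.:+ v) S.:= a S.:* (b S.:* x S.:+ u) S.:+ (b S.:* y S.:+ v))
      R.refl a b (s k) (t k) ((p • s) (suc k)) ((p • t) (suc k)))

  annihilates-cong : ∀ {p q} t → p ≋ q → Annihilates p t → Annihilates q t
  annihilates-cong {p} {q} t e z k = R.trans (•-cong q p t k (P.sym e)) (z k)

  annihilates-* : ∀ p q t → Annihilates q t → Annihilates (p *ᴾ q) t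
  annihilates-* p q t z k = R.trans (•-* p q t k) (•-zero p (q • t) z k)

  •-alternate : ∀ p t k → (reflect p • alternate t) k ≈ alternate (p • t) k
  •-alternate []      t k = R.sym (alternate-zero _ (λ _ → R.refl) k)
  •-alternate (a ∷ p) t k = R.trans (R.+-congˡ (R.trans (•-neg (reflect p) (alternate t) (suc k))
      (R.-‿cong (•-alternate p t (suc k)))))
    (R.trans (R.+-congˡ (RP.-‿involutive _)) (R.sym (alternate-linear a t ((p • t) ∘ suc) k)))

  -- quotientMoment t p = t applied, in the variable Y, to (p(X) - p(Y)) / (X - Y).
  quotientMoment : (ℕ → Carrier) → Poly → Poly
  quotientMoment t []      = []
  quotientMoment t (a ∷ p) = (p • t) 0 ∷ quotientMoment t p

  quotientMoment-+ : ∀ t p q → quotientMoment t (p +ᴾ q) ≋ quotientMoment t p +ᴾ quotientMoment t q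
  quotientMoment-+ t []      q       = P.refl
  quotientMoment-+ t (a ∷ p) []      = P.sym (P.+-identityʳ _)
  quotientMoment-+ t (a ∷ p) (b ∷ q) = ∷-cong (•-+ p q t 0) (quotientMoment-+ t p q)

  quotientMoment-∙ : ∀ t a p → quotientMoment t (a ∙ p) ≋ a ∙ quotientMoment t p
  quotientMoment-∙ t a []      = P.refl
  quotientMoment-∙ t a (b ∷ p) = ∷-cong (•-∙ a p t 0) (quotientMoment-∙ t a p)

  quotientMoment-neg : ∀ t p → quotientMoment t (-ᴾ p) ≋ -ᴾ quotientMoment t p
  quotientMoment-neg t []      = P.refl
  quotientMoment-neg t (b ∷ p) = ∷-cong (•-neg p t 0) (quotientMoment-neg t p)

  quotientMoment-cong : ∀ t p q → p ≋ q → quotientMoment t p ≋ quotientMoment t q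
  quotientMoment-cong t []      []      e = P.refl
  quotientMoment-cong t []      (b ∷ q) e = P.sym (0∷≋[] (•-cong q [] t 0 (∷≋[]-tail (≋-sym e)))
    (P.sym (quotientMoment-cong t [] q (≋-sym (∷≋[]-tail (≋-sym e))))))
  quotientMoment-cong t (a ∷ p) []      e = 0∷≋[] (•-cong p [] t 0 (∷≋[]-tail e)) (quotientMoment-cong t p [] (∷≋[]-tail e))
  quotientMoment-cong t (a ∷ p) (b ∷ q) e = ∷-cong (•-cong p q t 0 (∷-tail e)) (quotientMoment-cong t p q (∷-tail e))

  quotientMoment-congˡ : ∀ {s t} p → (∀ k → s k ≈ t k) → quotientMoment s p ≋ quotientMoment t p
  quotientMoment-congˡ []      e = P.refl
  quotientMoment-congˡ (a ∷ p) e = ∷-cong (•-congʳ p e 0) (quotientMoment-congˡ p e)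

  quotientMoment-zero : ∀ t p → (∀ k → t k ≈ 0#) → quotientMoment t p ≋ []
  quotientMoment-zero t []      z = P.refl
  quotientMoment-zero t (a ∷ p) z = 0∷≋[] (•-zero p t z 0) (quotientMoment-zero t p z)

  quotientMoment-linear : ∀ a s t p → quotientMoment (λ j → a * s j + t j) p ≋ a ∙ quotientMoment s p +ᴾ quotientMoment t p
  quotientMoment-linear a s t []      = P.refl
  quotientMoment-linear a s t (b ∷ p) = ∷-cong (•-linear p a s t 0) (quotientMoment-linear a s t p)

  -- Apply t in Y to p(X) (q(X) - q(Y)) / (X - Y) + q(Y) (p(X) - p(Y)) / (X - Y), the product rule
  -- for difference quotients.
  quotientMoment-* : ∀ t p q → quotientMoment t (p *ᴾ q) ≋ p *ᴾ quotientMoment t q +ᴾ quotientMoment (q • t) p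
  quotientMoment-* t []      q = P.refl
  quotientMoment-* t (a ∷ p) q = begin
    Q (a ∙ q +ᴾ X· (p *ᴾ q))
      ≈⟨ quotientMoment-+ t (a ∙ q) (X· (p *ᴾ q)) ⟩
    Q (a ∙ q) +ᴾ (((p *ᴾ q) • t) 0 ∷ Q (p *ᴾ q))
      ≈⟨ P.+-cong (quotientMoment-∙ t a q) (∷-cong (R.trans (•-* p q t 0) (R.sym (R.+-identityˡ _))) (quotientMoment-* t p q)) ⟩
    a ∙ Q q +ᴾ (X· (p *ᴾ Q q) +ᴾ ((p • q • t) 0 ∷ quotientMoment (q • t) p))
      ≈⟨ P.+-assoc (a ∙ Q q) (X· (p *ᴾ Q q)) _ ⟨
    (a ∷ p) *ᴾ Q q +ᴾ quotientMoment (q • t) (a ∷ p) ∎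
    where Q = quotientMoment t

  quotientMoment-below : ∀ {k} t p → Below (suc k) p → Below k (quotientMoment t p)
  quotientMoment-below         t []      b = below-[]
  quotientMoment-below {zero}  t (a ∷ p) b = below-cong
    (P.sym (0∷≋[] (•-cong p [] t 0 p≋[]) (quotientMoment-cong t p [] p≋[]))) below-[]
    where p≋[] = below-0⇒≋[] (below-tail b)
  quotientMoment-below {suc k} t (a ∷ p) b = below-∷ (quotientMoment-below t p (below-tail b))

  -- Replacing X and Y by - X and - Y changes the sign of the denominator X - Y.
  quotientMoment-reflect : ∀ t p → quotientMoment (alternate t) (reflect p) ≋ -ᴾ reflect (quotientMoment t p)
  quotientMoment-reflect t []      = P.refl
  quotientMoment-reflect t (a ∷ p) = ∷-cong
    (R.trans (•-neg (reflect p) (alternate t) 0) (R.-‿cong (•-alternate p t 0)))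
    (P.trans (quotientMoment-neg (alternate t) (reflect p)) (P.-‿cong (quotientMoment-reflect t p)))

  -- In (X ^ k - Y ^ k) / (X - Y) the power X ^ n is accompanied by Y ^ (k - 1 - n), so exactly the
  -- coefficients of p beyond index n contribute.
  drop-quotientMoment : ∀ t p n → coeff (quotientMoment t p) n ≈ (List.drop (suc n) p • t) 0
  drop-quotientMoment t []      n       = R.refl
  drop-quotientMoment t (a ∷ p) zero    = R.refl
  drop-quotientMoment t (a ∷ p) (suc n) = drop-quotientMoment t p n

  below-• : ∀ p t → Below 1 p → (p • t) 0 ≈ coeff p 0 * t 0
  below-• []      t b = R.sym (R.zeroˡ _)
  below-• (a ∷ p) t b = R.trans (R.+-congˡ (•-cong p [] t 1 (below-0⇒≋[] (below-tail b)))) (R.+-identityʳ _)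

  coeff-drop : ∀ n p k → coeff (List.drop n p) k ≈ coeff p (n ℕ.+ k)
  coeff-drop zero    p       k = R.refl
  coeff-drop (suc n) []      k = R.refl
  coeff-drop (suc n) (a ∷ p) k = coeff-drop n p k

  below-drop : ∀ n {k} p → Below (n ℕ.+ k) p → Below k (List.drop n p)
  below-drop n p b = below (λ j l → R.trans (coeff-drop n p j) (vanish b (n ℕ.+ j) (ℕ.+-monoʳ-≤ n l)))

  -- Both hypotheses are inherited by the shifted sequence M ∘ suc, and they
  -- give M 0 ≈ 0#.
  quotientMoment-faithful : ∀ {d e} → Monic (suc d) e → ∀ M → Annihilates e M →
    quotientMoment M e ≋ [] → ∀ k → M k ≈ 0#
  quotientMoment-faithful {d} {e} me M ann q = go M ann q
    where
    -- Coefficient d of the quotient moment involves only the leading coefficient of e, which is 1,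
    -- and hence equals M 0.
    head-zero : ∀ M → quotientMoment M e ≋ [] → M 0 ≈ 0#
    head-zero M q = R.trans (R.sym (R.*-identityˡ _)) (R.trans (R.*-congʳ (R.sym top))
      (R.trans (R.sym (below-• (List.drop (suc d) e) M (below-drop (suc d) e
        (below-weaken (ℕ.≤-reflexive (ℕ.+-comm 1 (suc d))) (monic-below me)))))
      (R.trans (R.sym (drop-quotientMoment M e d)) (at q d))))
      where
      top : coeff (List.drop (suc d) e) 0 ≈ 1#
      top = R.trans (coeff-drop (suc d) e 0) (R.trans (R.reflexive (≡.cong (coeff e) (ℕ.+-identityʳ (suc d)))) (monic-top me))
    -- As M 0 vanishes, coefficient n of the quotient moment of M ∘ suc is coefficient n - 1 of that
    -- of M. For n = 0 the place of the missing coefficient is taken by (p • M) 0, which is zero by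
    -- annihilation.
    shift : ∀ M p → quotientMoment M p ≋ [] → (p • M) 0 ≈ 0# → M 0 ≈ 0# → quotientMoment (M ∘ suc) p ≋ []
    shift M []      q z m = P.refl
    shift M (a ∷ p) q z m = 0∷≋[] (R.trans (•-shift p M 0) p•M≈0) (shift M p (∷≋[]-tail q) (at q 0) m)
      where
      p•M≈0 : (p • M) 1 ≈ 0#
      p•M≈0 = R.trans (R.sym (R.trans (R.+-congʳ (R.trans (R.*-congˡ m) (R.zeroʳ a))) (R.+-identityˡ _))) z
    go : ∀ M → Annihilates e M → quotientMoment M e ≋ [] → ∀ k → M k ≈ 0#
    go M ann q zero    = head-zero M q
    go M ann q (suc k) = go (M ∘ suc) (λ j → R.trans (•-shift e M j) (ann (suc j)))
      (shift M e q (ann 0) (head-zero M q)) k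

-- Determinants: multilinearity, alternation, cofactors and derivations.

module Determinant (R : CommutativeRing 0ℓ 0ℓ) where
  open CommutativeRing R hiding (zero)
  open MatrixOver rawRing public using (det; I)
  open RawSemiringDefs (RawRing.rawSemiring rawRing) using (_^_)
  open SemiringSum semiring
  open IntegerSolver R
  open SetoidReasoning setoid

  sum-zero : ∀ {n} (f : Fin n → Carrier) → (∀ i → f i ≈ 0#) → sum f ≈ 0#
  sum-zero {n} f z = trans (sum-cong-≋ z) (sum-replicate-zero n)

  sum-cong : ∀ {n} (f g : Fin n → Carrier) → (∀ i → f i ≈ g i) → sum f ≈ sum g
  sum-cong f g e = sum-cong-≋ e

  sum-linear : ∀ {n} a (f g : Fin n → Carrier) → sum (λ i → a * f i + g i) ≈ a * sum f + sum g
  sum-linear a f g = trans (∑-distrib-+ (λ i → a * f i) g) (+-congʳ (sym (*-distribˡ-sum a f)))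

  private
    sgn : ∀ {n} → Fin n → Carrier
    sgn j = (- 1#) ^ Fin.toℕ j

  minor : ∀ {n} → Matrix Carrier (suc n) → Fin (suc n) → Matrix Carrier n
  minor A j k l = A (suc k) (punchIn j l)

  infixl 9 _[_]≔_
  _[_]≔_ : ∀ {n} {X : Set} → (Fin n → X) → Fin n → X → Fin n → X
  A [ k ]≔ v = updateAt A k (const v)

  det-cong : ∀ {n} {A B : Matrix Carrier n} → (∀ i j → A i j ≈ B i j) → det A ≈ det B
  det-cong {zero}  e = refl
  det-cong {suc n} e = sum-cong-≋ (λ j → *-cong (*-congˡ {sgn j} (e zero j)) (det-cong (λ k l → e (suc k) (punchIn j l))))

  private
    update-comp : ∀ {m n l} (A : Fin n → Fin m → Carrier) (f : Fin l → Fin m) k v r i →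
                  (A [ k ]≔ v) r (f i) ≡ ((λ r → A r ∘ f) [ k ]≔ (v ∘ f)) r i
    update-comp A f zero    v zero    i = ≡.refl
    update-comp A f zero    v (suc r) i = ≡.refl
    update-comp A f (suc k) v zero    i = ≡.refl
    update-comp A f (suc k) v (suc r) i = update-comp (A ∘ suc) f k v r i

  minor-update : ∀ {n} (A : Matrix Carrier (suc n)) j k v →
                 det (minor (A [ suc k ]≔ v) j) ≈ det (minor A j [ k ]≔ (v ∘ punchIn j))
  minor-update A j k v = det-cong (λ r l → reflexive (update-comp (A ∘ suc) (punchIn j) k v r l))

  update-cong : ∀ {m n} (A : Fin m → Fin n → Carrier) k {v w} → (∀ l → v l ≈ w l) → ∀ r l → (A [ k ]≔ v) r l ≈ (A [ k ]≔ w) r l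
  update-cong A zero    e zero    l = e l
  update-cong A zero    e (suc r) l = refl
  update-cong A (suc k) e zero    l = refl
  update-cong A (suc k) e (suc r) l = update-cong (A ∘ suc) k e r l

  det-linear : ∀ {n} (A : Matrix Carrier n) k a v w →
               det (A [ k ]≔ λ l → a * v l + w l) ≈ a * det (A [ k ]≔ v) + det (A [ k ]≔ w)
  det-linear A zero a v w = trans
    (sum-cong-≋ (λ j → solve 5 (λ s a v w m → s :* (a :* v :+ w) :* m := a :* (s :* v :* m) :+ s :* w :* m)
      refl (sgn j) a (v j) (w j) (det (minor A j))))
    (sum-linear a (λ j → sgn j * v j * det (minor A j)) (λ j → sgn j * w j * det (minor A j)))
  det-linear {suc n@(suc _)} A (suc k) a v w = trans
    (sum-cong _ (λ j → a * (s j * det (minor (A [ suc k ]≔ v) j)) + s j * det (minor (A [ suc k ]≔ w) j)) (λ j → begin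
      s j * det (minor (A [ suc k ]≔ λ l → a * v l + w l) j)
        ≈⟨ *-congˡ (trans (minor-update A j k _) (det-linear (minor A j) k a (v ∘ punchIn j) (w ∘ punchIn j))) ⟩
      s j * (a * det (minor A j [ k ]≔ (v ∘ punchIn j)) + det (minor A j [ k ]≔ (w ∘ punchIn j)))
        ≈⟨ *-congˡ (+-cong (*-congˡ (minor-update A j k v)) (minor-update A j k w)) ⟨
      s j * (a * det (minor (A [ suc k ]≔ v) j) + det (minor (A [ suc k ]≔ w) j))
        ≈⟨ solve 4 (λ s a x y → s :* (a :* x :+ y) := a :* (s :* x) :+ s :* y) refl (s j) a _ _ ⟩
      a * (s j * det (minor (A [ suc k ]≔ v) j)) + s j * det (minor (A [ suc k ]≔ w) j) ∎))
    (sum-linear a (λ j → s j * det (minor (A [ suc k ]≔ v) j)) (λ j → s j * det (minor (A [ suc k ]≔ w) j)))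
    where
    s : Fin (suc n) → Carrier
    s j = sgn j * A zero j

  private
    lift : ∀ {m n} → (Fin m → Fin n) → Fin (suc m) → Fin (suc n)
    lift f zero    = zero
    lift f (suc i) = suc (f i)

    -- The terms with j = 0 cancel those with k = 0, and the others form the
    -- same sum in one dimension less.
    double-expansion : ∀ n (a : Fin (suc (suc n)) → Carrier) (φ : (Fin n → Fin (suc (suc n))) → Carrier) →
      (∀ {f g} → (∀ i → f i ≡ g i) → φ f ≈ φ g) →
      sum (λ j → sum (λ k → (sgn j * a j) * (sgn k * a (punchIn j k) * φ (punchIn j ∘ punchIn k)))) ≈ 0#
    double-expansion n a φ ext = begin
      sum (g zero) + sum (λ j → g (suc j) zero + rest j)
        ≈⟨ +-congˡ (∑-distrib-+ (λ j → g (suc j) zero) rest) ⟩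
      sum (g zero) + (sum (λ j → g (suc j) zero) + sum rest)
        ≈⟨ +-assoc _ _ _ ⟨
      sum (g zero) + sum (λ j → g (suc j) zero) + sum rest
        ≈⟨ +-cong (trans (sym (∑-distrib-+ (g zero) (λ j → g (suc j) zero))) (sum-zero _ cancel)) (rest≈0 n a φ ext) ⟩
      0# + 0#
        ≈⟨ +-identityˡ 0# ⟩
      0# ∎
      where
      g : Fin (suc (suc n)) → Fin (suc n) → Carrier
      g j k = (sgn j * a j) * (sgn k * a (punchIn j k) * φ (punchIn j ∘ punchIn k))
      rest : Fin (suc n) → Carrier
      rest j = sum (λ k → g (suc j) (suc k))
      cancel : ∀ k → g zero k + g (suc k) zero ≈ 0#
      cancel k = solve 4 (λ s a b p → (:1 :* a) :* (s :* b :* p) :+ (:- :1 :* s :* b) :* (:1 :* a :* p) := :0)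
        refl (sgn k) (a zero) (a (suc k)) (φ (suc ∘ punchIn k))
      rest≈0 : ∀ n (a : Fin (suc (suc n)) → Carrier) (φ : (Fin n → Fin (suc (suc n))) → Carrier) →
        (∀ {f g} → (∀ i → f i ≡ g i) → φ f ≈ φ g) →
        sum (λ (j : Fin (suc n)) → sum (λ k → (sgn (suc j) * a (suc j)) *
          (sgn (suc k) * a (punchIn (suc j) (suc k)) * φ (punchIn (suc j) ∘ punchIn (suc k))))) ≈ 0#
      rest≈0 zero    a φ ext = sum-zero {1} _ (λ _ → refl)
      rest≈0 (suc n) a φ ext = trans
        (sum-cong _ (λ j → sum (λ k → (sgn j * a (suc j)) * (sgn k * a (suc (punchIn j k)) * φ (lift (punchIn j ∘ punchIn k)))))
          (λ j → sum-cong _ _ (λ k → trans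
          (*-congˡ (*-congˡ (ext {punchIn (suc j) ∘ punchIn (suc k)} {lift (punchIn j ∘ punchIn k)} (λ { zero → ≡.refl ; (suc i) → ≡.refl }))))
          (solve 5 (λ s t a b p → (:- :1 :* s :* a) :* (:- :1 :* t :* b :* p) := (s :* a) :* (t :* b :* p))
            refl (sgn j) (sgn k) (a (suc j)) (a (suc (punchIn j k))) (φ (lift (punchIn j ∘ punchIn k)))))))
        (double-expansion n (a ∘ suc) (φ ∘ lift) (λ e → ext (λ { zero → ≡.refl ; (suc i) → ≡.cong suc (e i) })))

  Alternating : ℕ → Set
  Alternating n = ∀ (A : Matrix Carrier n) i j → i ≢ j → (∀ l → A i l ≈ A j l) → det A ≈ 0#

  private
    -- Polarisation: with z = x + y in both rows the determinant vanishes, and so do the diagonal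
    -- terms of its expansion; what remains is the sum of the two orders. The factors 1 only bring z
    -- into the shape of `det-linear`.
    swap : ∀ {n} → Alternating n → ∀ (A : Matrix Carrier n) p q → p ≢ q →
           det A + det (A [ p ]≔ A q [ q ]≔ A p) ≈ 0#
    swap {n} alt A p q p≢q = begin
      det A + E y x
        ≈⟨ +-congʳ (det-cong (λ r l → reflexive (≡.cong (λ f → f l) (≡.sym (id-update r))))) ⟩
      E x y + E y x
        ≈⟨ solve 2 (λ u v → u :+ v := :1 :* (:1 :* :0 :+ v) :+ (:1 :* u :+ :0)) refl (E x y) (E y x) ⟩
      1# * (1# * 0# + E y x) + (1# * E x y + 0#)
        ≈⟨ +-cong (*-congˡ (+-congʳ (*-congˡ (E-diag x)))) (+-congˡ (E-diag y)) ⟨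
      1# * (1# * E x x + E y x) + (1# * E x y + E y y)
        ≈⟨ +-cong (*-congˡ (linearˡ x)) (linearˡ y) ⟨
      1# * E z x + E z y
        ≈⟨ det-linear (A [ p ]≔ z) q 1# x y ⟨
      E z z
        ≈⟨ E-diag z ⟩
      0# ∎
      where
      E : (v w : Fin n → Carrier) → Carrier
      E v w = det (A [ p ]≔ v [ q ]≔ w)
      x = A p
      y = A q
      z : Fin n → Carrier
      z l = 1# * x l + y l
      E-comm : ∀ v w → E v w ≈ det (A [ q ]≔ w [ p ]≔ v)
      E-comm v w = det-cong (λ r l → reflexive (≡.cong (λ f → f l) (updateAt-commutes q p (p≢q ∘ ≡.sym) A r)))
      linearˡ : ∀ w → E z w ≈ 1# * E x w + E y w
      linearˡ w = trans (E-comm z w) (trans (det-linear (A [ q ]≔ w) p 1# x y)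
        (+-cong (*-congˡ (sym (E-comm x w))) (sym (E-comm y w))))
      E-diag : ∀ v → E v v ≈ 0#
      E-diag v = alt _ p q p≢q (λ l → reflexive (≡.cong (λ f → f l)
        (≡.trans (updateAt-minimal p q (A [ p ]≔ v) p≢q)
        (≡.trans (updateAt-updates p A) (≡.sym (updateAt-updates q (A [ p ]≔ v)))))))
      id-update : ∀ r → (A [ p ]≔ x [ q ]≔ y) r ≡ A r
      id-update r = ≡.trans (updateAt-id-local q (A [ p ]≔ x) (≡.sym
        (updateAt-id-local p A ≡.refl q)) r) (updateAt-id-local p A ≡.refl r)

    -- Expansion along the two equal top rows is the sum in `double-expansion`. There `φ f` is the
    -- minor of the remaining rows in the columns selected by `f`, which does not depend on the
    -- order in which two columns are removed.
    adjacent : ∀ {n} (A : Matrix Carrier (suc (suc n))) → (∀ l → A zero l ≈ A (suc zero) l) → det A ≈ 0#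
    adjacent {n} A e = trans
      (sum-cong (λ j → s j * det (minor A j)) (λ j → sum (λ k → s j * (sgn k * A zero (punchIn j k) * m j k)))
        (λ j → trans (*-distribˡ-sum (s j) (λ k → sgn k * A (suc zero) (punchIn j k) * m j k))
          (sum-cong (λ k → s j * (sgn k * A (suc zero) (punchIn j k) * m j k)) _
            (λ k → *-congˡ {s j} (*-congʳ {m j k} (*-congˡ {sgn k} (sym (e (punchIn j k)))))))))
      (double-expansion n (A zero) (λ f → det (λ r l → A (suc (suc r)) (f l)))
        (λ f≗g → det-cong (λ r l → reflexive (≡.cong (A (suc (suc r))) (f≗g l)))))
      where
      s : Fin (suc (suc n)) → Carrier
      s j = sgn j * A zero j
      m : Fin (suc (suc n)) → Fin (suc n) → Carrier
      m j k = det (λ r l → A (suc (suc r)) (punchIn j (punchIn k l)))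

    -- Exchanging rows 1 and j + 1 negates every minor along row 0, by alternation in the smaller
    -- size, and makes the equal rows adjacent.
    zeroth : ∀ {n} → Alternating n → ∀ (A : Matrix Carrier (suc n)) j →
             (∀ l → A zero l ≈ A (suc j) l) → det A ≈ 0#
    zeroth {suc n} alt A zero    e = adjacent A e
    zeroth {suc (suc n)} alt A (suc j) e = begin
      det A
        ≈⟨ sum-cong (λ l → sgn l * A zero l * det (minor A l)) (λ l → - 1# * (sgn l * B zero l * det (minor B l)) + 0#) step ⟩
      sum (λ l → - 1# * (sgn l * B zero l * det (minor B l)) + 0#)
        ≈⟨ sum-linear (- 1#) (λ l → sgn l * B zero l * det (minor B l)) (λ _ → 0#) ⟩
      - 1# * det B + sum {suc (suc (suc n))} (λ _ → 0#)
        ≈⟨ +-cong (*-congˡ (adjacent B λ l → trans (e l) (reflexive (≡.cong (λ f → f l) (≡.sym B1)))))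
                  (sum-zero {suc (suc (suc n))} _ (λ _ → refl)) ⟩
      - 1# * 0# + 0#
        ≈⟨ trans (+-identityʳ _) (zeroʳ _) ⟩
      0# ∎
      where
      p q : Fin (suc (suc (suc n)))
      p = suc zero
      q = suc (suc j)
      B = A [ p ]≔ A q [ q ]≔ A p
      B1 : B p ≡ A q
      B1 = ≡.refl
      step : ∀ l → sgn l * A zero l * det (minor A l) ≈ - 1# * (sgn l * B zero l * det (minor B l)) + 0#
      step l = begin
        sgn l * A zero l * det (minor A l)
          ≈⟨ solve 3 (λ s x y → s :* x := :- :1 :* (s :* y) :+ s :* (x :+ y)) refl (sgn l * A zero l) (det (minor A l)) (det (minor B l)) ⟩
        - 1# * (sgn l * A zero l * det (minor B l)) + sgn l * A zero l * (det (minor A l) + det (minor B l))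
          ≈⟨ +-congˡ (trans (*-congˡ (trans (+-congˡ minors) (swap alt (minor A l) zero (suc j) (λ ())))) (zeroʳ _)) ⟩
        - 1# * (sgn l * A zero l * det (minor B l)) + 0# ∎
        where
        minors : det (minor B l) ≈ det (minor A l [ zero ]≔ minor A l (suc j) [ suc j ]≔ minor A l zero)
        minors = det-cong (λ r i → reflexive (≡.trans
          (update-comp ((A ∘ suc) [ zero ]≔ A q) (punchIn l) (suc j) (A p) r i)
          (update₂ r i)))
          where
          update₂ : ∀ r i → ((λ r → ((A ∘ suc) [ zero ]≔ A q) r ∘ punchIn l) [ suc j ]≔ (A p ∘ punchIn l)) r i ≡
                    (minor A l [ zero ]≔ minor A l (suc j) [ suc j ]≔ minor A l zero) r i
          update₂ zero    i = ≡.refl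
          update₂ (suc r) i = ≡.refl

  alternating : ∀ n → Alternating n
  alternating (suc n) A zero    zero    i≢j e = contradiction ≡.refl i≢j
  alternating (suc n) A zero    (suc j) i≢j e = zeroth (alternating n) A j e
  alternating (suc n) A (suc i) zero    i≢j e = zeroth (alternating n) A i (λ l → sym (e l))
  alternating (suc n) A (suc i) (suc j) i≢j e = sum-zero _ (λ l → trans
    (*-congˡ {sgn l * A zero l} (alternating n (minor A l) i j (i≢j ∘ ≡.cong suc) (λ k → e (punchIn l k)))) (zeroʳ _))

  I-diagonal : ∀ n i → I n i i ≈ 1#
  I-diagonal n i with i Fin.≟ i
  ... | yes _   = refl
  ... | no  i≢i = contradiction ≡.refl i≢i

  I-off-diagonal : ∀ n {i j} → i ≢ j → I n i j ≈ 0#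
  I-off-diagonal n {i} {j} i≢j with i Fin.≟ j
  ... | yes i≡j = contradiction i≡j i≢j
  ... | no  _   = refl

  I-suc : ∀ n i j → I (suc n) (suc i) (suc j) ≈ I n i j
  I-suc n i j with i Fin.≟ j
  ... | yes ≡.refl = refl
  ... | no  _      = refl

  sum-I : ∀ {n} (v : Fin n → Carrier) l → sum (λ j → v j * I n j l) ≈ v l
  sum-I {suc n} v zero = trans (+-cong (*-identityʳ _) (sum-zero {n} _ (λ j → zeroʳ _))) (+-identityʳ _)
  sum-I {suc n} v (suc l) = trans (+-cong (zeroʳ _) (trans (sum-cong-≋ (λ j → *-congˡ (I-suc n j l))) (sum-I (v ∘ suc) l)))
    (+-identityˡ _)

  det-I : ∀ n → det (I n) ≈ 1#
  det-I zero    = refl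
  det-I (suc n) = trans (+-cong
    (trans (*-cong (*-identityˡ _) (trans (det-cong (λ k l → I-suc n k l)) (det-I n))) (*-identityˡ _))
    (sum-zero {n} _ (λ j → trans (*-congʳ (zeroʳ _)) (zeroˡ _)))) (+-identityʳ _)

  -- The transposed adjugate: the cofactor of the entry (k , j) is obtained by
  -- replacing row k by the j-th unit vector.
  cofactor : ∀ {n} → Matrix Carrier n → Matrix Carrier n
  cofactor {n} A k j = det (A [ k ]≔ I n j)

  det-sum : ∀ {m n} (A : Matrix Carrier n) k (a : Fin m → Carrier) (e : Fin m → Fin n → Carrier) →
            det (A [ k ]≔ λ l → sum (λ j → a j * e j l)) ≈ sum (λ j → a j * det (A [ k ]≔ e j))
  det-sum {zero} A k a e = begin
    det (A [ k ]≔ λ _ → 0#)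
      -- Writing the zero row as - 1 · 0 + 0 makes linearity present the determinant x as - x + x.
      ≈⟨ det-cong (update-cong A k (λ l → solve 1 (λ x → :0 := :- :1 :* :0 :+ :0) refl 0#)) ⟩
    det (A [ k ]≔ λ _ → - 1# * 0# + 0#)
      ≈⟨ det-linear A k (- 1#) (λ _ → 0#) (λ _ → 0#) ⟩
    - 1# * det (A [ k ]≔ λ _ → 0#) + det (A [ k ]≔ λ _ → 0#)
      ≈⟨ solve 1 (λ x → :- :1 :* x :+ x := :0) refl (det (A [ k ]≔ λ _ → 0#)) ⟩
    0# ∎
  det-sum {suc m} A k a e = trans (det-linear A k (a zero) (e zero) _) (+-congˡ (det-sum A k (a ∘ suc) (e ∘ suc)))

  expand-row : ∀ {n} (A : Matrix Carrier n) k v → sum (λ j → v j * cofactor A k j) ≈ det (A [ k ]≔ v)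
  expand-row {n} A k v = trans (sym (det-sum A k v (I n))) (det-cong (update-cong A k (sum-I v)))

  -- Expanding row i of A against the cofactors of row k gives the determinant of A with row k
  -- replaced by row i; for i ≠ k this has two equal rows.
  cramer : ∀ {n} (A : Matrix Carrier n) i k → sum (λ j → A i j * cofactor A k j) ≈ I n i k * det A
  cramer {n} A i k = trans (expand-row A k (A i)) rows
    where
    rows : det (A [ k ]≔ A i) ≈ I n i k * det A
    rows with i Fin.≟ k
    ... | yes ≡.refl = trans (det-cong (λ r l → reflexive (≡.cong (λ f → f l) (updateAt-id-local i A ≡.refl r)))) (sym (*-identityˡ _))
    ... | no  i≢k    = trans (alternating n _ i k i≢k (λ l → reflexive (≡.cong (λ f → f l)
      (≡.trans (updateAt-minimal i k A i≢k) (≡.sym (updateAt-updates k A)))))) (sym (zeroˡ _))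

  module Derivation (δ : Carrier → Carrier) (δ-cong : ∀ {x y} → x ≈ y → δ x ≈ δ y)
    (δ-+ : ∀ x y → δ (x + y) ≈ δ x + δ y) (δ-* : ∀ x y → δ (x * y) ≈ δ x * y + x * δ y)
    (δ-0 : δ 0# ≈ 0#) (δ-1 : δ 1# ≈ 0#) (δ-neg1 : δ (- 1#) ≈ 0#) where

    δ-sum : ∀ {n} (f : Fin n → Carrier) → δ (sum f) ≈ sum (δ ∘ f)
    δ-sum {zero}  f = δ-0
    δ-sum {suc n} f = trans (δ-+ _ _) (+-congˡ (δ-sum (f ∘ suc)))

    private
      δ-sgn : ∀ n → δ ((- 1#) ^ n) ≈ 0#
      δ-sgn zero    = δ-1
      δ-sgn (suc n) = trans (δ-* _ _) (trans (+-cong (trans (*-congʳ δ-neg1) (zeroˡ _)) (trans (*-congˡ (δ-sgn n)) (zeroʳ _))) (+-identityˡ _))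

    -- The product rule differentiates one row at a time. With `deriv` and `cofactor` this becomes
    -- Jacobi's formula for the derivative of the characteristic polynomial.
    δ-det : ∀ {n} (A : Matrix Carrier n) → δ (det A) ≈ sum (λ k → det (A [ k ]≔ (δ ∘ A k)))
    δ-det {zero}  A = δ-1
    δ-det {suc n} A = begin
      δ (det A)
        ≈⟨ δ-sum (λ j → s j * A zero j * det (minor A j)) ⟩
      sum (λ j → δ (s j * A zero j * det (minor A j)))
        ≈⟨ sum-cong (λ j → δ (s j * A zero j * det (minor A j))) _ term ⟩
      sum (λ j → s j * δ (A zero j) * det (minor A j) + sum (λ k → s j * A zero j * det (minor (A [ suc k ]≔ (δ ∘ A (suc k))) j)))
        ≈⟨ ∑-distrib-+ (λ j → s j * δ (A zero j) * det (minor A j)) (λ j → sum (λ k → s j * A zero j * det (minor (A [ suc k ]≔ (δ ∘ A (suc k))) j))) ⟩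
      det (A [ zero ]≔ (δ ∘ A zero)) + sum (λ j → sum (λ k → s j * A zero j * det (minor (A [ suc k ]≔ (δ ∘ A (suc k))) j)))
        ≈⟨ +-congˡ (∑-comm (λ j k → s j * A zero j * det (minor (A [ suc k ]≔ (δ ∘ A (suc k))) j))) ⟩
      det (A [ zero ]≔ (δ ∘ A zero)) + sum (λ k → sum (λ j → s j * A zero j * det (minor (A [ suc k ]≔ (δ ∘ A (suc k))) j)))
        ≈⟨ +-congˡ {det (A [ zero ]≔ (δ ∘ A zero))} (sum-cong _ (λ k → det (A [ suc k ]≔ (δ ∘ A (suc k)))) expand) ⟩
      sum (λ k → det (A [ k ]≔ (δ ∘ A k))) ∎
      where
      s : Fin (suc n) → Carrier
      s = sgn
      expand : ∀ k → sum (λ j → s j * A zero j * det (minor (A [ suc k ]≔ (δ ∘ A (suc k))) j)) ≈ det (A [ suc k ]≔ (δ ∘ A (suc k)))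
      expand k = refl
      term : ∀ j → δ (s j * A zero j * det (minor A j)) ≈
             s j * δ (A zero j) * det (minor A j) + sum (λ k → s j * A zero j * det (minor (A [ suc k ]≔ (δ ∘ A (suc k))) j))
      term j = begin
        δ (s j * A zero j * det (minor A j))
          ≈⟨ δ-* _ _ ⟩
        δ (s j * A zero j) * det (minor A j) + s j * A zero j * δ (det (minor A j))
          ≈⟨ +-cong (*-congʳ (trans (δ-* _ _) (trans (+-congʳ (trans (*-congʳ (δ-sgn (Fin.toℕ j))) (zeroˡ _))) (+-identityˡ _))))
                    (*-congˡ (δ-det (minor A j))) ⟩
        s j * δ (A zero j) * det (minor A j) + s j * A zero j * sum (λ k → det (minor A j [ k ]≔ (δ ∘ minor A j k)))
          ≈⟨ +-congˡ (trans (*-distribˡ-sum (s j * A zero j) (λ k → det (minor A j [ k ]≔ (δ ∘ minor A j k))))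
               (sum-cong (λ k → s j * A zero j * det (minor A j [ k ]≔ (δ ∘ minor A j k))) _ (λ k → *-congˡ {s j * A zero j} (sym (minor-update A j k (δ ∘ A (suc k))))))) ⟩
        s j * δ (A zero j) * det (minor A j) + sum (λ k → s j * A zero j * det (minor (A [ suc k ]≔ (δ ∘ A (suc k))) j)) ∎

module _ {c₁ ℓ₁ c₂ ℓ₂ ℓ} (R₁ : RawRing c₁ ℓ₁) (R₂ : RawRing c₂ ℓ₂)
  (_~_ : RawRing.Carrier R₁ → RawRing.Carrier R₂ → Set ℓ) where
  private
    module R₁ = RawRing R₁
    module R₂ = RawRing R₂
    module D₁ = RawSemiringDefs R₁.rawSemiring
    module D₂ = RawSemiringDefs R₂.rawSemiring

  -- Stated for a relation between raw rings, so that the characteristic polynomial over ℝ, built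
  -- from raw operations, can be compared with the one computed over ℚ.
  det-related :
    (R₁.0# ~ R₂.0#) → (R₁.1# ~ R₂.1#) →
    (∀ {a b c d} → a ~ b → c ~ d → (a R₁.+ c) ~ (b R₂.+ d)) →
    (∀ {a b c d} → a ~ b → c ~ d → (a R₁.* c) ~ (b R₂.* d)) →
    (∀ {a b} → a ~ b → (R₁.- a) ~ (R₂.- b)) →
    ∀ {n} {A : Matrix R₁.Carrier n} {B : Matrix R₂.Carrier n} → (∀ i j → A i j ~ B i j) →
    MatrixOver.det R₁ A ~ MatrixOver.det R₂ B
  det-related ~0 ~1 ~+ ~* ~neg = go
    where
    ~sum : ∀ {n} (f : Fin n → R₁.Carrier) (g : Fin n → R₂.Carrier) → (∀ i → f i ~ g i) → D₁.sum f ~ D₂.sum g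
    ~sum {zero}  f g h = ~0
    ~sum {suc n} f g h = ~+ (h zero) (~sum (f ∘ suc) (g ∘ suc) (h ∘ suc))
    ~power : ∀ n → ((R₁.- R₁.1#) D₁.^ n) ~ ((R₂.- R₂.1#) D₂.^ n)
    ~power zero    = ~1
    ~power (suc n) = ~* (~neg ~1) (~power n)
    go : ∀ {n} {A : Matrix R₁.Carrier n} {B : Matrix R₂.Carrier n} → (∀ i j → A i j ~ B i j) →
         MatrixOver.det R₁ A ~ MatrixOver.det R₂ B
    go {zero}  h = ~1
    go {suc n} h = ~sum _ _ (λ j → ~* (~* (~power (Fin.toℕ j)) (h zero j)) (go (λ k l → h (suc k) (punchIn j l))))

-- The Cayley-Hamilton theorem and Newton's identities.

module CharacteristicPolynomial (R : CommutativeRing 0ℓ 0ℓ) where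
  open Moments R
  private
    module R = CommutativeRing R
    module P = CommutativeRing polynomialRing
    module S = IntegerSolver R
    module D = Determinant polynomialRing
    module E = Determinant R
    module Σᴾ = SemiringSum P.semiring
  open R using (Carrier; _≈_; _+_; _*_; _-_; -_; 0#; 1#)
  open SemiringSum R.semiring using (sum; ∑-distrib-+; *-distribˡ-sum)

  coeff-sum : ∀ {n} (f : Fin n → Poly) s → coeff (Σᴾ.sum f) s ≈ sum (λ i → coeff (f i) s)
  coeff-sum {zero}  f s = R.refl
  coeff-sum {suc n} f s = R.trans (coeff-+ (f zero) (Σᴾ.sum (f ∘ suc)) s) (R.+-congˡ (coeff-sum (f ∘ suc) s))

  •-sum : ∀ {n} p (c : Fin n → Carrier) (u : Fin n → ℕ → Carrier) k →
          (p • (λ a → sum (λ j → c j * u j a))) k ≈ sum (λ j → c j * (p • u j) k)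
  •-sum {zero}  p c u k = •-zero p _ (λ _ → R.refl) k
  •-sum {suc n} p c u k = R.trans (•-linear p (c zero) (u zero) _ k) (R.+-congˡ (•-sum p (c ∘ suc) (u ∘ suc) k))

  sum-Iˡ : ∀ {n} i (v : Fin n → Carrier) → sum (λ j → E.I n i j * v j) ≈ v i
  sum-Iˡ {suc n} zero v = R.trans (R.+-cong (R.*-identityˡ _) (E.sum-zero {n} _ (λ j → R.zeroˡ _))) (R.+-identityʳ _)
  sum-Iˡ {suc n} (suc i) v = R.trans (R.+-cong (R.zeroˡ _)
    (R.trans (E.sum-cong (λ j → E.I (suc n) (suc i) (suc j) * v (suc j)) _ (λ j → R.*-congʳ (E.I-suc n i j))) (sum-Iˡ i (v ∘ suc)))) (R.+-identityˡ _)

  module _ {n : ℕ} (A : Matrix Carrier n) where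

    -- The exponent comes last, so that a fixed entry of the powers of A is a moment sequence and
    -- `(q • powerEntry i k) 0` is an entry of q(A).
    powerEntry : Fin n → Fin n → ℕ → Carrier
    powerEntry i k zero    = E.I n i k
    powerEntry i k (suc a) = sum (λ j → A i j * powerEntry j k a)

    powerTrace : ℕ → Carrier
    powerTrace a = sum (λ i → powerEntry i i a)

    charMatrix : Matrix Poly n
    charMatrix i j = (D.I n i j *ᴾ X) +ᴾ -ᴾ constᴾ (A i j)

    charpoly : Poly
    charpoly = D.det charMatrix

    private
      M = charMatrix
      p = charpoly

      -- The adjugate of X - A; `cramer` says that M F is p times the identity.
      F : Matrix Poly n
      F i k = D.cofactor M k i

    •-powerEntry : ∀ q i k b → (q • powerEntry i k) (suc b) ≈ sum (λ j → A i j * (q • powerEntry j k) b)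
    •-powerEntry q i k b = R.trans (R.sym (•-shift q (powerEntry i k) b)) (•-sum q (A i) (λ j → powerEntry j k) b)

    -- Horner's scheme for q(A), read off from its recursion.
    horner : ∀ k q (g : ℕ → Fin n → Carrier) →
             (∀ s i → g s i ≈ sum (λ j → A i j * g (suc s) j) + E.I n i k * coeff q s) →
             ∀ N → (∀ s i → N ℕ.≤ s → g s i ≈ 0#) →
             ∀ i → g 0 i ≈ (q • powerEntry i k) 0
    horner k [] g rec zero    z i = z 0 i z≤n
    horner k [] g rec (suc N) z i = R.trans (rec 0 i) (R.trans
      (R.+-cong (E.sum-zero (λ j → A i j * g 1 j) (λ j → R.trans
        (R.*-congˡ (horner k [] (g ∘ suc) (rec ∘ suc) N (λ s i l → z (suc s) i (s≤s l)) j)) (R.zeroʳ _))) (R.zeroʳ _))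
      (R.+-identityˡ 0#))
    horner k (a ∷ q) g rec N z i = R.trans (rec 0 i) (R.trans (R.+-comm _ _) (R.+-cong (R.*-comm _ _)
      (R.trans (E.sum-cong _ (λ j → A i j * (q • powerEntry j k) 0) (λ j → R.*-congˡ
        (horner k q (g ∘ suc) (rec ∘ suc) N (λ s i l → z (suc s) i (ℕ.m≤n⇒m≤1+n l)) j)))
      (R.sym (•-powerEntry q i k 0)))))

    horner-drop : ∀ k q (g : ℕ → Fin n → Carrier) →
             (∀ s i → g s i ≈ sum (λ j → A i j * g (suc s) j) + E.I n i k * coeff q s) →
             ∀ N → (∀ s i → N ℕ.≤ s → g s i ≈ 0#) →
             ∀ s i → g s i ≈ (List.drop s q • powerEntry i k) 0
    horner-drop k q       g rec N z zero    = horner k q g rec N z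
    horner-drop k []      g rec N z (suc s) i = R.trans (horner-drop k [] (g ∘ suc) (rec ∘ suc) N (λ s i l → z (suc s) i (ℕ.m≤n⇒m≤1+n l)) s i)
      (R.reflexive (≡.cong (λ q → (q • powerEntry i k) 0) (drop-[] s)))
      where
      drop-[] : ∀ s → List.drop s [] ≡ [] {A = Carrier}
      drop-[] zero    = ≡.refl
      drop-[] (suc s) = ≡.refl
    horner-drop k (a ∷ q) g rec N z (suc s) = horner-drop k q (g ∘ suc) (rec ∘ suc) N (λ s i l → z (suc s) i (ℕ.m≤n⇒m≤1+n l)) s

    private
      coeff-I : ∀ i k q s → coeff (D.I n i k *ᴾ q) s ≈ E.I n i k * coeff q s
      coeff-I i k q s with i Fin.≟ k
      ... | yes _ = R.trans (at (const-* 1# q) s) (coeff-∙ 1# q s)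
      ... | no  _ = R.sym (R.zeroˡ _)

      X*≋X· : ∀ q → X *ᴾ q ≋ X· q
      X*≋X· q = P.trans (X·-* (constᴾ 1#) q) (∷-cong R.refl (P.*-identityˡ q))

      coeff-M* : ∀ i j q s → coeff (M i j *ᴾ q) s ≈ E.I n i j * coeff (X· q) s + - 1# * (A i j * coeff q s)
      coeff-M* i j q s = R.trans (at (P.trans (P.distribʳ q (D.I n i j *ᴾ X) (-ᴾ constᴾ (A i j)))
          (P.+-cong (P.trans (P.*-assoc (D.I n i j) X q) (P.*-congˡ {D.I n i j} (X*≋X· q)))
                    (const-* (- A i j) q))) s)
        (R.trans (coeff-+ (D.I n i j *ᴾ X· q) ((- A i j) ∙ q) s)
        (R.+-cong (coeff-I i j (X· q) s) (R.trans (coeff-∙ (- A i j) q s)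
          (S.solve 2 (λ a x → S.:- a S.:* x S.:= S.:- S.:1 S.:* (a S.:* x)) R.refl (A i j) (coeff q s)))))

      -- This is the coefficient of X ^ s in (X - A) F = p. It has the form required by `horner`,
      -- because the coefficient of X F at s + 1 is that of F at s.
      recursion : ∀ k s i → coeff (X· (F i k)) s ≈ sum (λ j → A i j * coeff (F j k) s) + E.I n i k * coeff p s
      recursion k s i = R.trans
        (S.solve 2 (λ x y → x S.:= y S.:+ (x S.:+ S.:- S.:1 S.:* y)) R.refl (coeff (X· (F i k)) s) AF)
        (R.+-congˡ (R.trans (R.sym expand) (R.trans (at (D.cramer M i k) s) (coeff-I i k p s))))
        where
        AF = sum (λ j → A i j * coeff (F j k) s)
        expand : coeff (Σᴾ.sum (λ j → M i j *ᴾ F j k)) s ≈ coeff (X· (F i k)) s + - 1# * AF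
        expand = R.trans (coeff-sum (λ j → M i j *ᴾ F j k) s)
          (R.trans (E.sum-cong _ (λ j → E.I n i j * coeff (X· (F j k)) s + - 1# * (A i j * coeff (F j k) s)) (λ j → coeff-M* i j (F j k) s))
          (R.trans (∑-distrib-+ (λ j → E.I n i j * coeff (X· (F j k)) s) (λ j → - 1# * (A i j * coeff (F j k) s)))
          (R.+-cong (sum-Iˡ i (λ j → coeff (X· (F j k)) s)) (R.sym (*-distribˡ-sum (- 1#) (λ j → A i j * coeff (F j k) s))))))

    private
      bound : ∀ {m} (f : Fin m → Poly) → ∃[ N ] (∀ i → Below N (f i))
      bound {zero}  f = 0 , λ ()
      bound {suc m} f with bound (f ∘ suc)
      ... | N , b = List.length (f zero) ℕ.⊔ N , λ
        { zero    → below-weaken (ℕ.m≤m⊔n (List.length (f zero)) N) (below-length (f zero))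
        ; (suc i) → below-weaken (ℕ.m≤n⊔m (List.length (f zero)) N) (b i) }

      X·F : ∀ k s i → coeff (X· (F i k)) s ≈ (List.drop s p • powerEntry i k) 0
      X·F k = horner-drop k p (λ s i → coeff (X· (F i k)) s) (recursion k)
        (suc (proj₁ b)) (λ { (suc s) i (s≤s l) → vanish (proj₂ b i) s l })
        where b = bound (λ i → F i k)

    -- The constant coefficient of X F is zero, and by `X·F` it is an entry of p(A).
    cayley-hamilton : ∀ i k b → (p • powerEntry i k) b ≈ 0#
    cayley-hamilton i k zero    = R.sym (X·F k 0 i)
    cayley-hamilton i k (suc b) = R.trans (•-powerEntry p i k b)
      (E.sum-zero (λ j → A i j * (p • powerEntry j k) b) (λ j → R.trans (R.*-congˡ (cayley-hamilton j k b)) (R.zeroʳ _)))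

    •-powerTrace : ∀ q b → (q • powerTrace) b ≈ sum (λ i → (q • powerEntry i i) b)
    •-powerTrace q b = R.trans (•-congʳ q (λ a → E.sum-cong (λ i → powerEntry i i a) (λ i → 1# * powerEntry i i a) (λ i → R.sym (R.*-identityˡ _))) b)
      (R.trans (•-sum q (λ _ → 1#) (λ i → powerEntry i i) b) (E.sum-cong (λ i → 1# * (q • powerEntry i i) b) _ (λ i → R.*-identityˡ _)))

    charpoly-annihilates : Annihilates charpoly powerTrace
    charpoly-annihilates b = R.trans (•-powerTrace p b) (E.sum-zero (λ i → (p • powerEntry i i) b) (λ i → cayley-hamilton i i b))

    private
      deriv-const : ∀ a → deriv (constᴾ a) ≋ []
      deriv-const a = 0∷≋[] R.refl P.refl

      deriv-I : ∀ i j → deriv (D.I n i j) ≋ []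
      deriv-I i j with i Fin.≟ j
      ... | yes _ = deriv-const 1#
      ... | no  _ = P.refl

      deriv-X : deriv X ≋ constᴾ 1#
      deriv-X = ∷-cong (R.+-identityʳ 1#) (0∷≋[] R.refl P.refl)

      deriv-M : ∀ i j → deriv (M i j) ≋ D.I n i j
      deriv-M i j = P.trans (deriv-+ (D.I n i j *ᴾ X) (-ᴾ constᴾ (A i j)))
        (P.trans (P.+-cong (P.trans (deriv-* (D.I n i j) X)
            (P.trans (P.+-cong (P.trans (P.*-congʳ {X} (deriv-I i j)) (P.zeroˡ X)) (P.*-congˡ {D.I n i j} deriv-X))
            (P.trans (P.+-identityˡ _) (P.*-identityʳ _)))) (deriv-const (- A i j))) (P.+-identityʳ _))

      deriv-p : deriv p ≋ Σᴾ.sum (λ k → F k k)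
      deriv-p = P.trans (δ-det M) (D.sum-cong (λ k → D.det (M D.[ k ]≔ (deriv ∘ M k))) (λ k → F k k)
        (λ k → D.det-cong (D.update-cong M k (deriv-M k))))
        where open D.Derivation deriv (λ {x} {y} → deriv-cong x y) deriv-+ deriv-* P.refl (deriv-const 1#) (deriv-const (- 1#))

    -- The derivative of p is the trace of the adjugate. By `X·F`, coefficient s of the adjugate is
    -- the matrix obtained from A and the coefficients of p beyond index s; its trace is coefficient
    -- s of the quotient moment. Coefficientwise these are Newton's identities.
    newton : deriv charpoly ≋ quotientMoment powerTrace charpoly
    newton = P.trans deriv-p ⟨ (λ s → R.trans (coeff-sum (λ k → F k k) s)
      (R.trans (E.sum-cong (λ k → coeff (F k k) s) (λ k → (List.drop (suc s) p • powerEntry k k) 0) (λ k → X·F k (suc s) k))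
      (R.trans (R.sym (•-powerTrace (List.drop (suc s) p) 0)) (R.sym (drop-quotientMoment powerTrace p s))))) ⟩

  private
    -- The value c may be zero: every entry of X - A is recorded with degree 1, including the
    -- constant ones, so the coefficient of X ^ n in the determinant is the determinant of the
    -- identity matrix.
    record Top (d : ℕ) (q : Poly) (c : Carrier) : Set where
      constructor top
      field
        top-below : Below (suc d) q
        top-coeff : coeff q d ≈ c
    open Top

    top-* : ∀ {d e a b} p q → Top d p a → Top e q b → Top (d ℕ.+ e) (p *ᴾ q) (a * b)
    top-* p q (top bp tp) (top bq tq) = top (below-* bp bq) (R.trans (coeff-*-top p q bp bq) (R.*-cong tp tq))

    top-sum : ∀ {n d} (f : Fin n → Poly) (c : Fin n → Carrier) → (∀ i → Top d (f i) (c i)) → Top d (Σᴾ.sum f) (sum c)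
    top-sum {zero}  f c t = top below-[] R.refl
    top-sum {suc n} f c t = top (below-+ (top-below (t zero)) (top-below ts))
      (R.trans (coeff-+ (f zero) _ _) (R.+-cong (top-coeff (t zero)) (top-coeff ts)))
      where ts = top-sum (f ∘ suc) (c ∘ suc) (t ∘ suc)

    module Dᴾ = RawSemiringDefs (RawRing.rawSemiring P.rawRing)
    module Dᴿ = RawSemiringDefs (RawRing.rawSemiring R.rawRing)

    top-sgn : ∀ n → Top 0 ((-ᴾ constᴾ 1#) Dᴾ.^ n) ((- 1#) Dᴿ.^ n)
    top-sgn zero    = top (below-∷ below-[]) R.refl
    top-sgn (suc n) = top-* (-ᴾ constᴾ 1#) ((-ᴾ constᴾ 1#) Dᴾ.^ n) (top (below-∷ below-[]) R.refl) (top-sgn n)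

    top-det : ∀ {n} (M : Matrix Poly n) (C : Matrix Carrier n) → (∀ i j → Top 1 (M i j) (C i j)) → Top n (D.det M) (E.det C)
    top-det {zero}  M C t = top (below-∷ below-[]) R.refl
    top-det {suc n} M C t = top-sum _ _ (λ j → top-* _ _ (top-* _ _ (top-sgn (Fin.toℕ j)) (t zero j))
      (top-det (λ k l → M (suc k) (punchIn j l)) (λ k l → C (suc k) (punchIn j l)) (λ k l → t (suc k) (punchIn j l))))

  charpoly-monic : ∀ {n} (A : Matrix Carrier n) → Monic n (charpoly A)
  charpoly-monic {n} A = monic (top-below t) (R.trans (top-coeff t) (E.det-I n))
    where
    t = top-det (charMatrix A) (E.I n) entry
      where
      entry : ∀ i j → Top 1 (charMatrix A i j) (E.I n i j)
      entry i j with i Fin.≟ j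
      ... | yes _ = top (below (λ { (suc (suc s)) l → R.refl ; (suc zero) (s≤s ()) }))
                        (R.*-identityʳ 1#)
      ... | no  _ = top (below (λ { (suc (suc s)) l → R.refl ; (suc zero) (s≤s ()) })) R.refl

-- Order and inverses in ℚ.

ℚ-ring : CommutativeRing 0ℓ 0ℓ
ℚ-ring = ℚ.+-*-commutativeRing

module ℚS = IntegerSolver ℚ-ring

ℚ-*-pos : ∀ {p q} → 0ℚ ℚ.< p → 0ℚ ℚ.< q → 0ℚ ℚ.< p ℚ.* q
ℚ-*-pos {p} {q} 0<p 0<q = ≡.subst (ℚ._< p ℚ.* q) (ℚ.*-zeroʳ p) (ℚ.*-monoʳ-<-pos p {{ℚ.positive 0<p}} 0<q)

ℚ-*-nonneg : ∀ {p q} → 0ℚ ℚ.≤ p → 0ℚ ℚ.≤ q → 0ℚ ℚ.≤ p ℚ.* q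
ℚ-*-nonneg {p} {q} 0≤p 0≤q = ≡.subst (ℚ._≤ p ℚ.* q) (ℚ.*-zeroʳ p) (ℚ.*-monoˡ-≤-nonNeg p {{ℚ.nonNegative 0≤p}} 0≤q)

ℚ-+-nonneg : ∀ {p q} → 0ℚ ℚ.≤ p → 0ℚ ℚ.≤ q → 0ℚ ℚ.≤ p ℚ.+ q
ℚ-+-nonneg 0≤p 0≤q = ℚ.+-mono-≤ 0≤p 0≤q

ℚ-square-nonneg : ∀ p → 0ℚ ℚ.≤ p ℚ.* p
ℚ-square-nonneg p with ℚ.≤-total 0ℚ p
... | inj₁ 0≤p = ℚ-*-nonneg 0≤p 0≤p
... | inj₂ p≤0 = ≡.subst (0ℚ ℚ.≤_) (ℚS.solve 1 (λ p → (ℚS.:- p) ℚS.:* (ℚS.:- p) ℚS.:= p ℚS.:* p) ≡.refl p)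
  (ℚ-*-nonneg (ℚ.neg-antimono-≤ p≤0) (ℚ.neg-antimono-≤ p≤0))

ℚ-inverse : ∀ p → p ≢ 0ℚ → ∃[ q ] p ℚ.* q ≡ 1ℚ
ℚ-inverse p p≢0 = (ℚ.1/ p) {{ℚ.≢-nonZero p≢0}} , ℚ.*-inverseʳ p {{ℚ.≢-nonZero p≢0}}

ℚ-pos-inverse : ∀ {p} → 0ℚ ℚ.< p → ∃[ q ] (0ℚ ℚ.< q × p ℚ.* q ≡ 1ℚ)
ℚ-pos-inverse {p} 0<p = (ℚ.1/ p) {{nz}} , ℚ.positive⁻¹ _ {{ℚ.1/pos⇒pos p {{ℚ.positive 0<p}}}} , ℚ.*-inverseʳ p {{nz}}
  where nz = ℚ.pos⇒nonZero p {{ℚ.positive 0<p}}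

ℚ-domain : ∀ {p q} → p ≢ 0ℚ → p ℚ.* q ≡ 0ℚ → q ≡ 0ℚ
ℚ-domain {p} {q} p≢0 pq≡0 with ℚ-inverse p p≢0
... | r , pr≡1 = ≡.trans (≡.sym (ℚ.*-identityˡ q)) (≡.trans (≡.cong (ℚ._* q) (≡.sym pr≡1))
  (≡.trans (ℚS.solve 3 (λ p q r → p ℚS.:* r ℚS.:* q ℚS.:= r ℚS.:* (p ℚS.:* q)) ≡.refl p q r)
  (≡.trans (≡.cong (r ℚ.*_) pq≡0) (ℚ.*-zeroʳ r))))

-- The real numbers

Null : (ℕ → ℚ) → Set
Null s = ∀ ε → 0ℚ ℚ.< ε → ∃[ N ] (∀ n → N ℕ.≤ n → ℚ.∣ s n ∣ ℚ.< ε)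

Null-cong : ∀ {s t} → (∀ n → s n ≡ t n) → Null s → Null t
Null-cong e h ε 0<ε with h ε 0<ε
... | N , b = N , λ n l → ≡.subst (λ z → ℚ.∣ z ∣ ℚ.< ε) (e n) (b n l)

Null-0 : Null (λ _ → 0ℚ)
Null-0 ε 0<ε = 0 , λ _ _ → 0<ε

½-pos : ∀ {ε} → 0ℚ ℚ.< ε → 0ℚ ℚ.< ½ ℚ.* ε
½-pos 0<ε = ℚ-*-pos (ℚ.positive⁻¹ ½) 0<ε

½+½ : ∀ ε → ½ ℚ.* ε ℚ.+ ½ ℚ.* ε ≡ ε
½+½ ε = ≡.trans (≡.sym (ℚ.*-distribʳ-+ ε ½ ½)) (ℚ.*-identityˡ ε)

Null-+ : ∀ {s t} → Null s → Null t → Null (λ n → s n ℚ.+ t n)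
Null-+ {s} {t} hs ht ε 0<ε with hs (½ ℚ.* ε) (½-pos 0<ε) | ht (½ ℚ.* ε) (½-pos 0<ε)
... | M , a | N , b = M ℕ.⊔ N , λ n l → ℚ.≤-<-trans (ℚ.∣p+q∣≤∣p∣+∣q∣ (s n) (t n))
  (≡.subst (ℚ.∣ s n ∣ ℚ.+ ℚ.∣ t n ∣ ℚ.<_) (½+½ ε) (ℚ.+-mono-< (a n (ℕ.m⊔n≤o⇒m≤o M N l)) (b n (ℕ.m⊔n≤o⇒n≤o M N l))))

Null-neg : ∀ {s} → Null s → Null (λ n → ℚ.- s n)
Null-neg {s} h ε 0<ε with h ε 0<ε
... | N , b = N , λ n l → ≡.subst (ℚ._< ε) (≡.sym (ℚ.∣-p∣≡∣p∣ (s n))) (b n l)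

eventually-bounded : ∀ x → ∃[ B ] (0ℚ ℚ.< B × ∃[ K ] (∀ n → K ℕ.≤ n → ℚ.∣ seq x n ∣ ℚ.≤ B))
eventually-bounded x with cauchy x 1ℚ (ℚ.positive⁻¹ 1ℚ)
... | K , close = B , ℚ.+-mono-<-≤ (ℚ.positive⁻¹ 1ℚ) (ℚ.0≤∣p∣ (seq x K)) , K , λ n l → begin
    ℚ.∣ seq x n ∣                                     ≡⟨ ≡.cong ℚ.∣_∣ (ℚS.solve 2 (λ a b → a ℚS.:= (a ℚS.:- b) ℚS.:+ b) ≡.refl (seq x n) (seq x K)) ⟩
    ℚ.∣ (seq x n ℚ.- seq x K) ℚ.+ seq x K ∣           ≤⟨ ℚ.∣p+q∣≤∣p∣+∣q∣ (seq x n ℚ.- seq x K) (seq x K) ⟩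
    ℚ.∣ seq x n ℚ.- seq x K ∣ ℚ.+ ℚ.∣ seq x K ∣       ≤⟨ ℚ.+-monoˡ-≤ ℚ.∣ seq x K ∣ (ℚ.<⇒≤ (close n K l ℕ.≤-refl)) ⟩
    B                                                 ∎
  where
  open ℚ.≤-Reasoning
  B = 1ℚ ℚ.+ ℚ.∣ seq x K ∣

Null-bounded-* : ∀ {x s : ℕ → ℚ} B C K → 0ℚ ℚ.< B → 0ℚ ℚ.< C → B ℚ.* C ≡ 1ℚ →
                 (∀ n → K ℕ.≤ n → ℚ.∣ x n ∣ ℚ.≤ B) → Null s → Null (λ n → x n ℚ.* s n)
Null-bounded-* {x} {s} B C K 0<B 0<C BC≡1 bounded h ε 0<ε =
  K ℕ.⊔ proj₁ small , λ n l → begin-strict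
    ℚ.∣ x n ℚ.* s n ∣           ≡⟨ ℚ.∣p*q∣≡∣p∣*∣q∣ (x n) (s n) ⟩
    ℚ.∣ x n ∣ ℚ.* ℚ.∣ s n ∣     ≤⟨ ℚ.*-monoʳ-≤-nonNeg ℚ.∣ s n ∣ {{ℚ.∣-∣-nonNeg (s n)}} (bounded n (ℕ.m⊔n≤o⇒m≤o K (proj₁ small) l)) ⟩
    B ℚ.* ℚ.∣ s n ∣             <⟨ ℚ.*-monoʳ-<-pos B {{ℚ.positive 0<B}} (proj₂ small n (ℕ.m⊔n≤o⇒n≤o K (proj₁ small) l)) ⟩
    B ℚ.* (C ℚ.* ε)             ≡⟨ ℚ.*-assoc B C ε ⟨
    B ℚ.* C ℚ.* ε               ≡⟨ ≡.cong (ℚ._* ε) BC≡1 ⟩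
    1ℚ ℚ.* ε                    ≡⟨ ℚ.*-identityˡ ε ⟩
    ε                           ∎
  where
  open ℚ.≤-Reasoning
  small = h (C ℚ.* ε) (ℚ-*-pos 0<C 0<ε)

Null-* : ∀ (x : ℝ) {s} → Null s → Null (λ n → seq x n ℚ.* s n)
Null-* x h =
  let B , 0<B , K , bounded = eventually-bounded x
      C , 0<C , BC≡1 = ℚ-pos-inverse 0<B
  in Null-bounded-* B C K 0<B 0<C BC≡1 bounded h

≗⇒≃ : ∀ x y → (∀ n → seq x n ≡ seq y n) → x ≃ y
≗⇒≃ x y e = Null-cong (λ n → ≡.sym (≡.trans (≡.cong (ℚ._- seq y n) (e n)) (ℚ.+-inverseʳ (seq y n)))) Null-0

≃-sym : ∀ x y → x ≃ y → y ≃ x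
≃-sym x y e = Null-cong (λ n → ℚS.solve 2 (λ a b → ℚS.:- (a ℚS.:- b) ℚS.:= b ℚS.:- a) ≡.refl (seq x n) (seq y n)) (Null-neg e)

≃-trans : ∀ x y z → x ≃ y → y ≃ z → x ≃ z
≃-trans x y z e f = Null-cong (λ n → ℚS.solve 3 (λ a b c → (a ℚS.:- b) ℚS.:+ (b ℚS.:- c) ℚS.:= a ℚS.:- c) ≡.refl (seq x n) (seq y n) (seq z n)) (Null-+ e f)

ℝ-ring : CommutativeRing 0ℓ 0ℓ
ℝ-ring = record
  { Carrier = ℝ ; _≈_ = _≃_ ; _+_ = _+ᴿ_ ; _*_ = _*ᴿ_ ; -_ = -ᴿ_ ; 0# = fromℚ 0ℚ ; 1# = fromℚ 1ℚ
  ; isCommutativeRing = record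
    { isRing = record
      { +-isAbelianGroup = record
        { isGroup = record
          { isMonoid = record
            { isSemigroup = record
              { isMagma = record
                { isEquivalence = record
                  { refl  = λ {x} → ≗⇒≃ x x (λ _ → ≡.refl)
                  ; sym   = λ {x} {y} → ≃-sym x y
                  ; trans = λ {x} {y} {z} → ≃-trans x y z }
                ; ∙-cong = λ {x} {y} {u} {v} e f → Null-cong (λ n → ℚS.solve 4
                    (λ x y u v → (x ℚS.:- y) ℚS.:+ (u ℚS.:- v) ℚS.:= (x ℚS.:+ u) ℚS.:- (y ℚS.:+ v))
                    ≡.refl (seq x n) (seq y n) (seq u n) (seq v n)) (Null-+ e f) }
              ; assoc = λ x y z → ≗⇒≃ ((x +ᴿ y) +ᴿ z) (x +ᴿ (y +ᴿ z)) (λ n → ℚ.+-assoc (seq x n) (seq y n) (seq z n)) }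
            ; identity = (λ x → ≗⇒≃ (fromℚ 0ℚ +ᴿ x) x (λ n → ℚ.+-identityˡ (seq x n)))
                       , (λ x → ≗⇒≃ (x +ᴿ fromℚ 0ℚ) x (λ n → ℚ.+-identityʳ (seq x n))) }
          ; inverse = (λ x → ≗⇒≃ ((-ᴿ x) +ᴿ x) (fromℚ 0ℚ) (λ n → ℚ.+-inverseˡ (seq x n)))
                    , (λ x → ≗⇒≃ (x +ᴿ (-ᴿ x)) (fromℚ 0ℚ) (λ n → ℚ.+-inverseʳ (seq x n)))
          ; ⁻¹-cong = λ {x} {y} e → Null-cong (λ n → ℚS.solve 2 (λ x y → ℚS.:- (x ℚS.:- y) ℚS.:= (ℚS.:- x) ℚS.:- (ℚS.:- y))
              ≡.refl (seq x n) (seq y n)) (Null-neg e) }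
        ; comm = λ x y → ≗⇒≃ (x +ᴿ y) (y +ᴿ x) (λ n → ℚ.+-comm (seq x n) (seq y n)) }
      ; *-cong = λ {x} {y} {u} {v} e f → Null-cong (λ n → ℚS.solve 4
          (λ x y u v → x ℚS.:* (u ℚS.:- v) ℚS.:+ v ℚS.:* (x ℚS.:- y) ℚS.:= x ℚS.:* u ℚS.:- y ℚS.:* v)
          ≡.refl (seq x n) (seq y n) (seq u n) (seq v n)) (Null-+ (Null-* x f) (Null-* v e))
      ; *-assoc = λ x y z → ≗⇒≃ ((x *ᴿ y) *ᴿ z) (x *ᴿ (y *ᴿ z)) (λ n → ℚ.*-assoc (seq x n) (seq y n) (seq z n))
      ; *-identity = (λ x → ≗⇒≃ (fromℚ 1ℚ *ᴿ x) x (λ n → ℚ.*-identityˡ (seq x n)))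
                   , (λ x → ≗⇒≃ (x *ᴿ fromℚ 1ℚ) x (λ n → ℚ.*-identityʳ (seq x n)))
      ; distrib = (λ x y z → ≗⇒≃ (x *ᴿ (y +ᴿ z)) (x *ᴿ y +ᴿ x *ᴿ z) (λ n → ℚ.*-distribˡ-+ (seq x n) (seq y n) (seq z n)))
                , (λ x y z → ≗⇒≃ ((y +ᴿ z) *ᴿ x) (y *ᴿ x +ᴿ z *ᴿ x) (λ n → ℚ.*-distribʳ-+ (seq x n) (seq y n) (seq z n))) }
    ; *-comm = λ x y → ≗⇒≃ (x *ᴿ y) (y *ᴿ x) (λ n → ℚ.*-comm (seq x n) (seq y n)) } }

module ℝR = CommutativeRing ℝ-ring

-- The positive form of being non-zero: it carries a lower bound, whereas the negation of x ≃ 0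
-- yields such a bound only under double negation.
Apart : (ℕ → ℚ) → Set
Apart s = ∃[ ε ] (0ℚ ℚ.< ε × ∃[ N ] (∀ n → N ℕ.≤ n → ε ℚ.≤ ℚ.∣ s n ∣))

≃0⇒Null : ∀ x → x ≃ fromℚ 0ℚ → Null (seq x)
≃0⇒Null x = Null-cong (λ n → ℚ.+-identityʳ (seq x n))

Null⇒≃0 : ∀ x → Null (seq x) → x ≃ fromℚ 0ℚ
Null⇒≃0 x = Null-cong (λ n → ≡.sym (ℚ.+-identityʳ (seq x n)))

-- From index N on the terms differ from term N by less than ε / 4. Comparing that one rational
-- number with ε / 2 settles the alternative: either all later terms are at least ε / 4 or all are
-- below ε in absolute value.
apart-or-small : ∀ x ε → 0ℚ ℚ.< ε → Apart (seq x) ⊎ ∃[ N ] (∀ n → N ℕ.≤ n → ℚ.∣ seq x n ∣ ℚ.< ε)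
apart-or-small x ε 0<ε with cauchy x (½ ℚ.* (½ ℚ.* ε)) (½-pos (½-pos 0<ε))
... | N , close with ℚ.∣ seq x N ∣ ℚ.<? ½ ℚ.* ε
... | yes small = inj₂ (N , λ n l → ≡.subst (ℚ.∣ seq x n ∣ ℚ.<_) (½+½ ε) (ℚ.≤-<-trans
    (≡.subst (ℚ._≤ ℚ.∣ seq x N ∣ ℚ.+ ℚ.∣ seq x n ℚ.- seq x N ∣)
      (≡.cong ℚ.∣_∣ (ℚS.solve 2 (λ a b → b ℚS.:+ (a ℚS.:- b) ℚS.:= a) ≡.refl (seq x n) (seq x N)))
      (ℚ.∣p+q∣≤∣p∣+∣q∣ (seq x N) (seq x n ℚ.- seq x N)))
    (ℚ.+-mono-< small (ℚ.<-trans (close n N l ℕ.≤-refl) half<))))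
  where
  half< : ½ ℚ.* (½ ℚ.* ε) ℚ.< ½ ℚ.* ε
  half< = ≡.subst₂ ℚ._<_ (ℚ.+-identityʳ _) (½+½ (½ ℚ.* ε)) (ℚ.+-monoʳ-< (½ ℚ.* (½ ℚ.* ε)) (½-pos (½-pos 0<ε)))
... | no large = inj₁ (½ ℚ.* (½ ℚ.* ε) , ½-pos (½-pos 0<ε) , N , λ n l → ℚ.≮⇒≥ (λ xₙ<η →
    large (≡.subst (ℚ.∣ seq x N ∣ ℚ.<_) (½+½ (½ ℚ.* ε)) (ℚ.≤-<-trans
      (≡.subst (ℚ._≤ ℚ.∣ seq x n ∣ ℚ.+ ℚ.∣ seq x N ℚ.- seq x n ∣)
        (≡.cong ℚ.∣_∣ (ℚS.solve 2 (λ a b → b ℚS.:+ (a ℚS.:- b) ℚS.:= a) ≡.refl (seq x N) (seq x n)))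
        (ℚ.∣p+q∣≤∣p∣+∣q∣ (seq x n) (seq x N ℚ.- seq x n)))
      (ℚ.+-mono-< xₙ<η (close N n ℕ.≤-refl l))))))

apart⇒≄0 : ∀ x → Apart (seq x) → ¬ x ≃ fromℚ 0ℚ
apart⇒≄0 x (ε , 0<ε , N , b) e with ≃0⇒Null x e ε 0<ε
... | M , c = ℚ.<-irrefl ≡.refl (ℚ.<-≤-trans (c (M ℕ.⊔ N) (ℕ.m≤m⊔n M N)) (b (M ℕ.⊔ N) (ℕ.m≤n⊔m M N)))

-- For each ε, `apart-or-small` leaves only the small case. This permits classical reasoning
-- whenever the goal is an equation x ≃ 0.
≃0-stable : ∀ x → ¬ ¬ x ≃ fromℚ 0ℚ → x ≃ fromℚ 0ℚ
≃0-stable x ¬¬e = Null⇒≃0 x lemma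
  where
  lemma : Null (seq x)
  lemma ε 0<ε with apart-or-small x ε 0<ε
  ... | inj₁ x#0   = contradiction (apart⇒≄0 x x#0) ¬¬e
  ... | inj₂ small = small

≄0⇒¬¬apart : ∀ x → ¬ x ≃ fromℚ 0ℚ → ¬ ¬ Apart (seq x)
≄0⇒¬¬apart x x≄0 ¬a = x≄0 (Null⇒≃0 x lemma)
  where
  lemma : Null (seq x)
  lemma ε 0<ε with apart-or-small x ε 0<ε
  ... | inj₁ x#0   = contradiction x#0 ¬a
  ... | inj₂ small = small

apart-cancel : ∀ x y → Apart (seq x) → x *ᴿ y ≃ fromℚ 0ℚ → y ≃ fromℚ 0ℚ
apart-cancel x y (δ , 0<δ , N , b) e = Null⇒≃0 y lemma
  where
  open ℚ.≤-Reasoning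
  lemma : Null (seq y)
  lemma ε 0<ε with ≃0⇒Null (x *ᴿ y) e (δ ℚ.* ε) (ℚ-*-pos 0<δ 0<ε)
  ... | M , c = M ℕ.⊔ N , λ n l → ℚ.≰⇒> (λ ε≤y → ℚ.<-irrefl ≡.refl (begin-strict
    δ ℚ.* ε                              ≤⟨ ℚ.*-monoˡ-≤-nonNeg δ {{ℚ.nonNegative (ℚ.<⇒≤ 0<δ)}} ε≤y ⟩
    δ ℚ.* ℚ.∣ seq y n ∣                  ≤⟨ ℚ.*-monoʳ-≤-nonNeg ℚ.∣ seq y n ∣ {{ℚ.∣-∣-nonNeg (seq y n)}} (b n (ℕ.m⊔n≤o⇒n≤o M N l)) ⟩
    ℚ.∣ seq x n ∣ ℚ.* ℚ.∣ seq y n ∣      ≡⟨ ℚ.∣p*q∣≡∣p∣*∣q∣ (seq x n) (seq y n) ⟨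
    ℚ.∣ seq x n ℚ.* seq y n ∣            <⟨ c n (ℕ.m⊔n≤o⇒m≤o M N l) ⟩
    δ ℚ.* ε                              ∎))

ℝ-domain : ∀ x y → ¬ x ≃ fromℚ 0ℚ → x *ᴿ y ≃ fromℚ 0ℚ → y ≃ fromℚ 0ℚ
ℝ-domain x y x≄0 e = ≃0-stable y (λ y≄0 → ≄0⇒¬¬apart x x≄0 (λ x#0 → y≄0 (apart-cancel x y x#0 e)))

1≄0 : ¬ fromℚ 1ℚ ≃ fromℚ 0ℚ
1≄0 = apart⇒≄0 (fromℚ 1ℚ) (1ℚ , ℚ.positive⁻¹ 1ℚ , 0 , λ _ _ → ℚ.≤-refl)

-- Multiplicities of roots over a domain.

module Multiplicity (K : CommutativeRing 0ℓ 0ℓ)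
  (domain : ∀ x y → ¬ CommutativeRing._≈_ K x (CommutativeRing.0# K) →
    CommutativeRing._≈_ K (CommutativeRing._*_ K x y) (CommutativeRing.0# K) →
    CommutativeRing._≈_ K y (CommutativeRing.0# K)) where
  open Moments K
  open Polynomial (CommutativeRing.rawRing K) using (_^ᴾ_; HasMultiplicity)
  private
    module K = CommutativeRing K
    module KP = RingProperties K.ring
    module P = CommutativeRing polynomialRing
    module PP = RingProperties P.ring
    module S = IntegerSolver K
    module T = IntegerSolver polynomialRing
  open K using (Carrier; _≈_; _+_; _*_; _-_; -_; 0#; 1#)
  open SetoidReasoning P.setoid

  linear : Carrier → Poly
  linear x = X +ᴾ -ᴾ constᴾ x

  linear-monic : ∀ x → Monic 1 (linear x)
  linear-monic x = monic (below (λ { (suc (suc s)) l → K.refl ; (suc zero) (s≤s ()) })) K.refl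

  eval-linear : ∀ x y → eval (linear x) y ≈ y - x
  eval-linear x y = S.solve 2 (λ x y → (S.:0 S.:- x) S.:+ y S.:* (S.:1 S.:+ y S.:* S.:0) S.:= y S.:- x) K.refl x y

  eval-linear-self : ∀ x → eval (linear x) x ≈ 0#
  eval-linear-self x = K.trans (eval-linear x x) (K.-‿inverseʳ x)

  linear-cong : ∀ {x y} → x ≈ y → linear x ≋ linear y
  linear-cong e = ∷-cong (K.+-congˡ (K.-‿cong e)) P.refl

  power-cong : ∀ {L L′} → L ≋ L′ → ∀ k → L ^ᴾ k ≋ L′ ^ᴾ k
  power-cong e zero    = P.refl
  power-cong {L} {L′} e (suc k) = P.*-cong e (power-cong e k)

  power-cancel : ∀ x k h → linear x ^ᴾ k *ᴾ h ≋ [] → h ≋ []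
  power-cancel x zero    h e = P.trans (P.sym (P.*-identityˡ h)) e
  power-cancel x (suc k) h e = power-cancel x k h (monic-cancel (linear-monic x) (linear x ^ᴾ k *ᴾ h)
    (P.trans (P.sym (P.*-assoc (linear x) (linear x ^ᴾ k) h)) e))

  eval-below-1 : ∀ r x → Below 1 r → eval r x ≈ 0# → r ≋ []
  eval-below-1 []      x b e = P.refl
  eval-below-1 (a ∷ r) x b e = 0∷≋[] (K.trans (K.sym (K.trans (K.+-congˡ
      (K.trans (K.*-congˡ (eval-cong r [] x r≋[])) (K.zeroʳ x))) (K.+-identityʳ a))) e) r≋[]
    where r≋[] = below-0⇒≋[] (below-tail b)

  factor-root : ∀ f x → eval f x ≈ 0# → ∃[ g ] f ≋ linear x *ᴾ g
  factor-root f x e = quotient , P.trans division-≋ (P.trans (P.+-congˡ {linear x *ᴾ quotient} r≋[]) (P.+-identityʳ _))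
    where
    open Division (divide (linear-monic x) f)
    r≋[] : remainder ≋ []
    r≋[] = eval-below-1 remainder x remainder-below (K.trans (K.sym (K.trans
      (K.trans (eval-cong f _ x division-≋) (eval-+ (linear x *ᴾ quotient) remainder x))
      (K.trans (K.+-congʳ (K.trans (eval-* (linear x) quotient x) (K.trans (K.*-congʳ (eval-linear-self x)) (K.zeroˡ _))))
        (K.+-identityˡ _)))) e)

  multiplicity-cong : ∀ {p p′ x x′ k} → p ≋ p′ → x ≈ x′ → HasMultiplicity p x k → HasMultiplicity p′ x′ k
  multiplicity-cong {p} {p′} {x} {x′} {k} e e′ (q , m , n) = q , at (P.trans (P.sym e) (P.trans (⟨_⟩ {p} {linear x ^ᴾ k *ᴾ q} m)
    (P.*-congʳ {q} (power-cong (linear-cong e′) k)))) , λ z → n (K.trans (eval-congʳ q e′) z)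
    where
    eval-congʳ : ∀ q → x ≈ x′ → eval q x ≈ eval q x′
    eval-congʳ []      e = K.refl
    eval-congʳ (a ∷ q) e = K.+-congˡ (K.*-cong e (eval-congʳ q e))

  multiplicity-neg : ∀ {p x k} → HasMultiplicity p x k → HasMultiplicity (-ᴾ p) x k
  multiplicity-neg {p} {x} {k} (q , m , n) = -ᴾ q
    , at (P.trans (P.-‿cong (⟨_⟩ {p} {linear x ^ᴾ k *ᴾ q} m)) (PP.-‿distribʳ-* (linear x ^ᴾ k) q))
    , λ z → n (K.trans (K.sym (KP.-‿involutive _)) (K.trans (K.-‿cong (K.trans (K.sym (eval-neg q x)) z)) KP.-0#≈0#))

  private
    reflect-linear : ∀ x → reflect (linear x) ≋ -ᴾ linear (- x)
    reflect-linear x = ∷-cong (S.solve 1 (λ x → S.:0 S.:- x S.:= S.:- (S.:0 S.:- (S.:- x))) K.refl x) P.refl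

    -- Reflection turns X - x into - (X + x); the k signs that arise are absorbed into the cofactor.
    reflect-power : ∀ x k q → ¬ eval q x ≈ 0# →
      ∃[ q′ ] (reflect (linear x ^ᴾ k *ᴾ q) ≋ linear (- x) ^ᴾ k *ᴾ q′ × ¬ eval q′ (- x) ≈ 0#)
    reflect-power x zero    q n = reflect q
      , P.trans (reflect-cong (constᴾ 1# *ᴾ q) q (P.*-identityˡ q)) (P.sym (P.*-identityˡ _))
      , λ z → n (K.trans (K.sym (eval-reflect-neg q)) z)
      where
      eval-reflect-neg : ∀ q → eval (reflect q) (- x) ≈ eval q x
      eval-reflect-neg []      = K.refl
      eval-reflect-neg (a ∷ q) = K.+-congˡ (K.trans (K.*-congˡ (K.trans (eval-neg (reflect q) (- x)) (K.-‿cong (eval-reflect-neg q))))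
        (S.solve 2 (λ x u → (S.:- x) S.:* (S.:- u) S.:= x S.:* u) K.refl x (eval q x)))
    reflect-power x (suc k) q n =
      let q′ , e , n′ = reflect-power x k q n
          L = linear x; L⁻ = linear (- x)
      in -ᴾ q′
      , (begin
          reflect (L *ᴾ L ^ᴾ k *ᴾ q)                     ≈⟨ reflect-cong (L *ᴾ L ^ᴾ k *ᴾ q) (L *ᴾ (L ^ᴾ k *ᴾ q)) (P.*-assoc L (L ^ᴾ k) q) ⟩
          reflect (L *ᴾ (L ^ᴾ k *ᴾ q))                   ≈⟨ reflect-* L (L ^ᴾ k *ᴾ q) ⟩
          reflect L *ᴾ reflect (L ^ᴾ k *ᴾ q)             ≈⟨ P.*-cong (reflect-linear x) e ⟩
          (-ᴾ L⁻) *ᴾ (L⁻ ^ᴾ k *ᴾ q′)                     ≈⟨ T.solve 3 (λ l m q → (T.:- l) T.:* (m T.:* q) T.:= l T.:* m T.:* (T.:- q)) P.refl L⁻ (L⁻ ^ᴾ k) q′ ⟩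
          L⁻ *ᴾ L⁻ ^ᴾ k *ᴾ (-ᴾ q′)                       ∎)
      , λ z → n′ (K.trans (K.sym (KP.-‿involutive _)) (K.trans (K.-‿cong (K.trans (K.sym (eval-neg q′ (- x))) z)) KP.-0#≈0#))

  multiplicity-reflect : ∀ {p x k} → HasMultiplicity p x k → HasMultiplicity (reflect p) (- x) k
  multiplicity-reflect {p} {x} {k} (q , m , n) =
    let q′ , e , n′ = reflect-power x k q n
    in q′ , at (P.trans (reflect-cong p (linear x ^ᴾ k *ᴾ q) ⟨ m ⟩) e) , n′

  -- Whether x is a root cannot be decided over ℝ, hence the double negation. Each division by X - x
  -- lowers the degree bound N, so the division process stops.
  multiplicity-exists : ∀ N f x → Below N f → ¬ f ≋ [] → ¬ ¬ (∃[ k ] HasMultiplicity f x k)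
  multiplicity-exists zero    f x b f≢0 none = f≢0 (below-0⇒≋[] b)
  multiplicity-exists (suc N) f x b f≢0 none = not-root root
    where
    not-root : ¬ ¬ eval f x ≈ 0#
    not-root n = none (0 , f , at (P.sym (P.*-identityˡ f)) , n)
    root : ¬ eval f x ≈ 0#
    root e = deflate (factor-root f x e)
      where
      deflate : ¬ (∃[ g ] f ≋ linear x *ᴾ g)
      deflate (g , f≋) = multiplicity-exists N g x (monic-*-below (linear-monic x) g (below-cong f≋ b))
        (λ g≋[] → f≢0 (P.trans f≋ (P.trans (P.*-congˡ {linear x} g≋[]) (P.zeroʳ (linear x)))))
        (λ g-multiplicity → none (add-root g-multiplicity))
        where
        add-root : ∃[ k ] HasMultiplicity g x k → ∃[ k ] HasMultiplicity f x k
        add-root (k , q , m , n) = suc k , q , at (P.trans f≋ (P.trans (P.*-congˡ {linear x} (⟨_⟩ {g} {linear x ^ᴾ k *ᴾ q} m))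
          (P.sym (P.*-assoc (linear x) (linear x ^ᴾ k) q)))) , n

  -- The Wronskian of p and p′ is divisible by (X - x) ^ 2k, and both sides can
  -- be divided by that power.
  wronskian-root : ∀ {p p′ c u x k} →
    c *ᴾ (p′ *ᴾ deriv p +ᴾ -ᴾ (p *ᴾ deriv p′)) ≋ p *ᴾ p′ *ᴾ u →
    HasMultiplicity p x k → HasMultiplicity p′ x k → eval c x ≈ 0# → eval u x ≈ 0#
  wronskian-root {p} {p′} {c} {u} {x} {k} e (q , m , n) (q′ , m′ , n′) cx≈0 =
    domain (eval q′ x) (eval u x) n′ (domain (eval q x) _ n (K.trans (K.sym eval-qq′u) (K.trans (K.sym (eval-cong (c *ᴾ W) (q *ᴾ q′ *ᴾ u) x cW≋)) eval-cW)))
    where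
    L = linear x ^ᴾ k
    p≋ : p ≋ L *ᴾ q
    p≋ = ⟨ m ⟩
    p′≋ : p′ ≋ L *ᴾ q′
    p′≋ = ⟨ m′ ⟩
    W = q′ *ᴾ deriv q +ᴾ -ᴾ (q *ᴾ deriv q′)
    deriv-p : ∀ {p q} → p ≋ L *ᴾ q → deriv p ≋ deriv L *ᴾ q +ᴾ L *ᴾ deriv q
    deriv-p {p} {q} e = P.trans (deriv-cong p (L *ᴾ q) e) (deriv-* L q)
    Z = L *ᴾ deriv L *ᴾ (q′ *ᴾ q)
    expand : ∀ a b r → (L *ᴾ a) *ᴾ (deriv L *ᴾ b +ᴾ L *ᴾ r) ≋ L *ᴾ deriv L *ᴾ (a *ᴾ b) +ᴾ L *ᴾ (L *ᴾ (a *ᴾ r))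
    expand a b r = T.solve 5 (λ l l′ a b r → (l T.:* a) T.:* (l′ T.:* b T.:+ l T.:* r) T.:= l T.:* l′ T.:* (a T.:* b) T.:+ l T.:* (l T.:* (a T.:* r)))
      P.refl L (deriv L) a b r
    wronskian : p′ *ᴾ deriv p +ᴾ -ᴾ (p *ᴾ deriv p′) ≋ L *ᴾ (L *ᴾ W)
    wronskian = begin
      p′ *ᴾ deriv p +ᴾ -ᴾ (p *ᴾ deriv p′)
        ≈⟨ P.+-cong (P.*-cong p′≋ (deriv-p p≋)) (P.-‿cong (P.*-cong p≋ (deriv-p p′≋))) ⟩
      (L *ᴾ q′) *ᴾ (deriv L *ᴾ q +ᴾ L *ᴾ deriv q) +ᴾ -ᴾ ((L *ᴾ q) *ᴾ (deriv L *ᴾ q′ +ᴾ L *ᴾ deriv q′))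
        ≈⟨ P.+-cong (expand q′ q (deriv q)) (P.-‿cong (P.trans (expand q q′ (deriv q′)) (P.+-congʳ {L *ᴾ (L *ᴾ (q *ᴾ deriv q′))}
             (P.*-congˡ {L *ᴾ deriv L} (P.*-comm q q′))))) ⟩
      (Z +ᴾ L *ᴾ (L *ᴾ (q′ *ᴾ deriv q))) +ᴾ -ᴾ (Z +ᴾ L *ᴾ (L *ᴾ (q *ᴾ deriv q′)))
        ≈⟨ T.solve 4 (λ z l v w → (z T.:+ l T.:* (l T.:* v)) T.:+ T.:- (z T.:+ l T.:* (l T.:* w)) T.:= l T.:* (l T.:* (v T.:+ T.:- w)))
             P.refl Z L (q′ *ᴾ deriv q) (q *ᴾ deriv q′) ⟩
      L *ᴾ (L *ᴾ W) ∎
    d = c *ᴾ W +ᴾ -ᴾ (q *ᴾ q′ *ᴾ u)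
    difference : L *ᴾ (L *ᴾ d) ≋ []
    difference = begin
      L *ᴾ (L *ᴾ (c *ᴾ W +ᴾ -ᴾ (q *ᴾ q′ *ᴾ u)))
        ≈⟨ T.solve 4 (λ l c w v → l T.:* (l T.:* (c T.:* w T.:+ T.:- v)) T.:= c T.:* (l T.:* (l T.:* w)) T.:+ T.:- (l T.:* (l T.:* v)))
             P.refl L c W (q *ᴾ q′ *ᴾ u) ⟩
      c *ᴾ (L *ᴾ (L *ᴾ W)) +ᴾ -ᴾ (L *ᴾ (L *ᴾ (q *ᴾ q′ *ᴾ u)))
        ≈⟨ P.+-congˡ {c *ᴾ (L *ᴾ (L *ᴾ W))} (P.-‿cong (T.solve 4 (λ l q q′ u → l T.:* (l T.:* (q T.:* q′ T.:* u)) T.:= (l T.:* q) T.:* (l T.:* q′) T.:* u)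
             P.refl L q q′ u)) ⟩
      c *ᴾ (L *ᴾ (L *ᴾ W)) +ᴾ -ᴾ ((L *ᴾ q) *ᴾ (L *ᴾ q′) *ᴾ u)
        ≈⟨ P.+-cong (P.*-congˡ {c} wronskian) (P.-‿cong (P.*-congʳ {u} (P.*-cong p≋ p′≋))) ⟨
      c *ᴾ (p′ *ᴾ deriv p +ᴾ -ᴾ (p *ᴾ deriv p′)) +ᴾ -ᴾ (p *ᴾ p′ *ᴾ u)
        ≈⟨ P.+-congʳ { -ᴾ (p *ᴾ p′ *ᴾ u)} e ⟩
      p *ᴾ p′ *ᴾ u +ᴾ -ᴾ (p *ᴾ p′ *ᴾ u)
        ≈⟨ P.-‿inverseʳ (p *ᴾ p′ *ᴾ u) ⟩
      [] ∎
    cW≋ : c *ᴾ W ≋ q *ᴾ q′ *ᴾ u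
    cW≋ = P.trans (T.solve 2 (λ a b → a T.:= (a T.:+ T.:- b) T.:+ b) P.refl (c *ᴾ W) (q *ᴾ q′ *ᴾ u))
      (P.trans (P.+-congʳ {q *ᴾ q′ *ᴾ u} (power-cancel x k d (power-cancel x k (L *ᴾ d) difference))) (P.+-identityˡ (q *ᴾ q′ *ᴾ u)))
    eval-cW : eval (c *ᴾ W) x ≈ 0#
    eval-cW = K.trans (eval-* c W x) (K.trans (K.*-congʳ cx≈0) (K.zeroˡ _))
    eval-qq′u : eval (q *ᴾ q′ *ᴾ u) x ≈ eval q x * (eval q′ x * eval u x)
    eval-qq′u = K.trans (eval-* (q *ᴾ q′) u x) (K.trans (K.*-congʳ (eval-* q q′ x)) (K.*-assoc _ _ _))

-- Integers in ℚ and the Archimedean property.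

module ℚ× = SemiringMultiples (CommutativeRing.semiring ℚ-ring)
open ℚ× using () renaming (_×_ to _·ℚ_)

cast : ℤ → ℚ
cast i = i ℚ./ 1

toℚᵘ-cast : ∀ i → ℚ.toℚᵘ (cast i) ℚᵘ.≃ ℚᵘ.mkℚᵘ i 0
toℚᵘ-cast i = ℚ.toℚᵘ-fromℚᵘ (ℚᵘ.mkℚᵘ i 0)

cast-+ : ∀ i j → cast (i ℤ.+ j) ≡ cast i ℚ.+ cast j
cast-+ i j = ℚ.toℚᵘ-injective (ℚᵘ.≃-trans (toℚᵘ-cast (i ℤ.+ j)) (ℚᵘ.≃-sym (ℚᵘ.≃-trans (ℚ.toℚᵘ-homo-+ (cast i) (cast j))
  (ℚᵘ.≃-trans (ℚᵘ.+-cong (toℚᵘ-cast i) (toℚᵘ-cast j)) (ℚᵘ.*≡* (≡.cong (ℤ._* ℤ.1ℤ) (≡.cong₂ ℤ._+_ (ℤ.*-identityʳ i) (ℤ.*-identityʳ j))))))))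

cast-* : ∀ i j → cast (i ℤ.* j) ≡ cast i ℚ.* cast j
cast-* i j = ℚ.toℚᵘ-injective (ℚᵘ.≃-trans (toℚᵘ-cast (i ℤ.* j)) (ℚᵘ.≃-sym (ℚᵘ.≃-trans (ℚ.toℚᵘ-homo-* (cast i) (cast j))
  (ℚᵘ.≃-trans (ℚᵘ.*-cong (toℚᵘ-cast i) (toℚᵘ-cast j)) (ℚᵘ.*≡* ≡.refl)))))

cast-mono-< : ∀ {i j} → i ℤ.< j → cast i ℚ.< cast j
cast-mono-< {i} {j} i<j = ℚ.toℚᵘ-cancel-< (ℚᵘ.<-respˡ-≃ (ℚᵘ.≃-sym (toℚᵘ-cast i)) (ℚᵘ.<-respʳ-≃ (ℚᵘ.≃-sym (toℚᵘ-cast j))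
  (ℚᵘ.*<* (≡.subst₂ ℤ._<_ (≡.sym (ℤ.*-identityʳ i)) (≡.sym (ℤ.*-identityʳ j)) i<j))))

cast-nat : ∀ n → n ·ℚ 1ℚ ≡ cast (ℤ.+ n)
cast-nat zero    = ≡.refl
cast-nat (suc n) = ≡.trans (≡.cong (1ℚ ℚ.+_) (cast-nat n)) (≡.sym (cast-+ (ℤ.+ 1) (ℤ.+ n)))

archimedean-1 : ∀ q → ∃[ n ] q ℚ.< n ·ℚ 1ℚ
archimedean-1 q@record{} = suc ℤ.∣ ℚ.↥ q ∣ , ≡.subst (q ℚ.<_) (≡.sym (cast-nat (suc ℤ.∣ ℚ.↥ q ∣)))
  (ℚ.toℚᵘ-cancel-< (ℚᵘ.<-respʳ-≃ (ℚᵘ.≃-sym (toℚᵘ-cast (ℤ.+ suc ℤ.∣ ℚ.↥ q ∣))) (ℚᵘ.*<* bound)))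
  where
  i≤∣i∣ : ∀ i → i ℤ.≤ ℤ.+ ℤ.∣ i ∣
  i≤∣i∣ (ℤ.+ n)    = ℤ.≤-refl
  i≤∣i∣ ℤ.-[1+ n ] = ℤ.-≤+
  d = ℚ.denominatorℕ q
  bound : ℚ.↥ q ℤ.* ℤ.1ℤ ℤ.< ℤ.+ suc ℤ.∣ ℚ.↥ q ∣ ℤ.* ℚ.↧ q
  bound = ℤ.≤-<-trans (ℤ.≤-trans (ℤ.≤-reflexive (ℤ.*-identityʳ (ℚ.↥ q))) (i≤∣i∣ (ℚ.↥ q)))
    (≡.subst (ℤ.+ ℤ.∣ ℚ.↥ q ∣ ℤ.<_) (ℤ.pos-* (suc ℤ.∣ ℚ.↥ q ∣) d)
      (ℤ.+<+ (ℕ.<-≤-trans (ℕ.n<1+n _) (ℕ.m≤m*n (suc ℤ.∣ ℚ.↥ q ∣) d))))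

·ℚ-pos : ∀ n {p} → 0ℚ ℚ.≤ p → 0ℚ ℚ.≤ n ·ℚ p
·ℚ-pos zero    h = ℚ.≤-refl
·ℚ-pos (suc n) h = ℚ-+-nonneg h (·ℚ-pos n h)

·ℚ-mono : ∀ n {p q} → p ℚ.≤ q → n ·ℚ p ℚ.≤ n ·ℚ q
·ℚ-mono zero    h = ℚ.≤-refl
·ℚ-mono (suc n) h = ℚ.+-mono-≤ h (·ℚ-mono n h)

archimedean : ∀ q {ε} → 0ℚ ℚ.< ε → ∃[ n ] q ℚ.< suc n ·ℚ ε
archimedean q {ε} 0<ε =
  let C , 0<C , εC≡1 = ℚ-pos-inverse 0<ε
      n , qC<n       = archimedean-1 (q ℚ.* C)
      qCε<nε         = ℚ.*-monoˡ-<-pos ε {{ℚ.positive 0<ε}} qC<n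
      q<nε           = ≡.subst₂ ℚ._<_
        (≡.trans (ℚS.solve 3 (λ q c e → q ℚS.:* c ℚS.:* e ℚS.:= q ℚS.:* (e ℚS.:* c)) ≡.refl q C ε)
          (≡.trans (≡.cong (q ℚ.*_) εC≡1) (ℚ.*-identityʳ q)))
        (≡.trans (ℚ×.×-assoc-* n 1ℚ ε) (≡.cong (n ·ℚ_) (ℚ.*-identityˡ ε))) qCε<nε
  in n , ℚ.<-≤-trans q<nε (≡.subst (ℚ._≤ suc n ·ℚ ε) (ℚ.+-identityˡ (n ·ℚ ε)) (ℚ.+-monoˡ-≤ (n ·ℚ ε) (ℚ.<⇒≤ 0<ε)))

∣-∣≤ : ∀ {p q} → p ℚ.≤ q → ℚ.- p ℚ.≤ q → ℚ.∣ p ∣ ℚ.≤ q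
∣-∣≤ {p} {q} a b with ℚ.∣p∣≡p∨∣p∣≡-p p
... | inj₁ e = ≡.subst (ℚ._≤ q) (≡.sym e) a
... | inj₂ e = ≡.subst (ℚ._≤ q) (≡.sym e) b

≤-difference : ∀ {p q} → p ℚ.≤ q → 0ℚ ℚ.≤ q ℚ.- p
≤-difference {p} {q} h = ≡.subst (ℚ._≤ q ℚ.- p) (ℚ.+-inverseʳ p) (ℚ.+-monoˡ-≤ (ℚ.- p) h)

interval-distance : ∀ {l h a b} → l ℚ.≤ a → a ℚ.≤ h → l ℚ.≤ b → b ℚ.≤ h → ℚ.∣ a ℚ.- b ∣ ℚ.≤ h ℚ.- l
interval-distance {l} {h} {a} {b} la ah lb bh = ∣-∣≤ (ℚ.+-mono-≤ ah (ℚ.neg-antimono-≤ lb))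
  (≡.subst (ℚ._≤ h ℚ.- l) (ℚS.solve 2 (λ a b → b ℚS.:- a ℚS.:= ℚS.:- (a ℚS.:- b)) ≡.refl a b)
    (ℚ.+-mono-≤ bh (ℚ.neg-antimono-≤ la)))

-- Bisection of a decidable predicate on ℚ.

module Bisection (P : ℚ → Set) (P? : ∀ x → Dec (P x)) (l₀ h₀ : ℚ) (l₀≤h₀ : l₀ ℚ.≤ h₀)
  (¬Pl₀ : ¬ P l₀) (Ph₀ : P h₀) where

  record Bracket : Set where
    constructor bracket
    field
      lo hi : ℚ
      lo≤hi : lo ℚ.≤ hi
      ¬P-lo : ¬ P lo
      P-hi  : P hi

  open Bracket

  width : Bracket → ℚ
  width b = hi b ℚ.- lo b

  middle : Bracket → ℚ
  middle b = ½ ℚ.* (lo b ℚ.+ hi b)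

  lo≤middle : ∀ b → lo b ℚ.≤ middle b
  lo≤middle b = ≡.subst₂ ℚ._≤_ (≡.trans (ℚ.*-distribˡ-+ ½ (lo b) (lo b)) (½+½ (lo b))) ≡.refl
    (ℚ.*-monoˡ-≤-nonNeg ½ (ℚ.+-monoʳ-≤ (lo b) (lo≤hi b)))

  middle≤hi : ∀ b → middle b ℚ.≤ hi b
  middle≤hi b = ≡.subst₂ ℚ._≤_ ≡.refl (≡.trans (ℚ.*-distribˡ-+ ½ (hi b) (hi b)) (½+½ (hi b)))
    (ℚ.*-monoˡ-≤-nonNeg ½ (ℚ.+-monoˡ-≤ (hi b) (lo≤hi b)))

  halve : (b : Bracket) → Dec (P (middle b)) → Bracket
  halve b (yes p) = bracket (lo b) (middle b) (lo≤middle b) (¬P-lo b) p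
  halve b (no ¬p) = bracket (middle b) (hi b) (middle≤hi b) ¬p (P-hi b)

  halve-width : ∀ b d → width (halve b d) ≡ ½ ℚ.* width b
  halve-width b (yes _) = ≡.trans (≡.cong (λ z → ½ ℚ.* (lo b ℚ.+ hi b) ℚ.- z) (≡.sym (½+½ (lo b))))
    (ℚS.solve 3 (λ c l h → c ℚS.:* (l ℚS.:+ h) ℚS.:- (c ℚS.:* l ℚS.:+ c ℚS.:* l) ℚS.:= c ℚS.:* (h ℚS.:- l)) ≡.refl ½ (lo b) (hi b))
  halve-width b (no _)  = ≡.trans (≡.cong (ℚ._- ½ ℚ.* (lo b ℚ.+ hi b)) (≡.sym (½+½ (hi b))))
    (ℚS.solve 3 (λ c l h → (c ℚS.:* h ℚS.:+ c ℚS.:* h) ℚS.:- c ℚS.:* (l ℚS.:+ h) ℚS.:= c ℚS.:* (h ℚS.:- l)) ≡.refl ½ (lo b) (hi b))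

  halve-lo : ∀ b d → lo b ℚ.≤ lo (halve b d)
  halve-lo b (yes _) = ℚ.≤-refl
  halve-lo b (no _)  = lo≤middle b

  halve-hi : ∀ b d → hi (halve b d) ℚ.≤ hi b
  halve-hi b (yes _) = middle≤hi b
  halve-hi b (no _)  = ℚ.≤-refl

  at-step : ℕ → Bracket
  at-step zero    = bracket l₀ h₀ l₀≤h₀ ¬Pl₀ Ph₀
  at-step (suc n) = halve (at-step n) (P? (middle (at-step n)))

  -- The width is halved at every step, but the weaker factor 1 / (n + 1) already suits
  -- `archimedean`. The induction uses n + 2 ≤ 2 (n + 1).
  width-bound : ∀ n → suc n ·ℚ width (at-step n) ℚ.≤ width (at-step 0)
  width-bound zero    = ℚ.≤-reflexive (ℚ.+-identityʳ _)
  width-bound (suc n) = ℚ.≤-trans (≡.subst (λ w → suc (suc n) ·ℚ w ℚ.≤ suc n ·ℚ width b) (≡.sym (halve-width b (P? (middle b)))) step) (width-bound n)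
    where
    b = at-step n
    w = ½ ℚ.* width b
    0≤w : 0ℚ ℚ.≤ w
    0≤w = ℚ-*-nonneg (ℚ.<⇒≤ (ℚ.positive⁻¹ ½)) (≤-difference (lo≤hi b))
    step : suc (suc n) ·ℚ w ℚ.≤ suc n ·ℚ width b
    step = ≡.subst (w ℚ.+ suc n ·ℚ w ℚ.≤_) (≡.trans (≡.sym (·ℚ-+ (suc n) w w)) (≡.cong (suc n ·ℚ_) (½+½ (width b))))
      (ℚ.+-monoˡ-≤ (suc n ·ℚ w) (≡.subst (ℚ._≤ w ℚ.+ n ·ℚ w) (ℚ.+-identityʳ w) (ℚ.+-monoʳ-≤ w (·ℚ-pos n 0≤w))))
      where
      ·ℚ-+ : ∀ n a b → n ·ℚ (a ℚ.+ b) ≡ n ·ℚ a ℚ.+ n ·ℚ b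
      ·ℚ-+ zero    a b = ≡.refl
      ·ℚ-+ (suc n) a b = ≡.trans (≡.cong (a ℚ.+ b ℚ.+_) (·ℚ-+ n a b))
        (ℚS.solve 4 (λ a b c d → a ℚS.:+ b ℚS.:+ (c ℚS.:+ d) ℚS.:= (a ℚS.:+ c) ℚS.:+ (b ℚS.:+ d)) ≡.refl a b (n ·ℚ a) (n ·ℚ b))

  small-width : ∀ ε → 0ℚ ℚ.< ε → ∃[ n ] width (at-step n) ℚ.< ε
  small-width ε 0<ε =
    let n , W<nε = archimedean (width (at-step 0)) 0<ε
    in n , ℚ.≰⇒> (λ ε≤w → ℚ.<-irrefl ≡.refl (ℚ.<-≤-trans W<nε (ℚ.≤-trans (·ℚ-mono (suc n) ε≤w) (width-bound n))))

  lo-mono : ∀ n k → lo (at-step n) ℚ.≤ lo (at-step (k ℕ.+ n))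
  lo-mono n zero    = ℚ.≤-refl
  lo-mono n (suc k) = ℚ.≤-trans (lo-mono n k) (halve-lo (at-step (k ℕ.+ n)) (P? (middle (at-step (k ℕ.+ n)))))

  hi-mono : ∀ n k → hi (at-step (k ℕ.+ n)) ℚ.≤ hi (at-step n)
  hi-mono n zero    = ℚ.≤-refl
  hi-mono n (suc k) = ℚ.≤-trans (halve-hi (at-step (k ℕ.+ n)) (P? (middle (at-step (k ℕ.+ n))))) (hi-mono n k)

  lo-increasing : ∀ {n m} → n ℕ.≤ m → lo (at-step n) ℚ.≤ lo (at-step m)
  lo-increasing {n} {m} l = ≡.subst (λ m → lo (at-step n) ℚ.≤ lo (at-step m)) (ℕ.m∸n+n≡m l) (lo-mono n (m ℕ.∸ n))

  hi-decreasing : ∀ {n m} → n ℕ.≤ m → hi (at-step m) ℚ.≤ hi (at-step n)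
  hi-decreasing {n} {m} l = ≡.subst (λ m → hi (at-step m) ℚ.≤ hi (at-step n)) (ℕ.m∸n+n≡m l) (hi-mono n (m ℕ.∸ n))

  -- Two representatives of one real number: every term of the first satisfies P and no term of the
  -- second does. This contrast is what later forces a value at that point to vanish.
  upper lower : ℝ
  upper = record
    { seq = λ n → hi (at-step n)
    ; cauchy = λ ε 0<ε → let N , w<ε = small-width ε 0<ε in N , λ m n N≤m N≤n → ℚ.≤-<-trans
        (interval-distance (ℚ.≤-trans (lo-increasing N≤m) (lo≤hi (at-step m))) (hi-decreasing N≤m)
                           (ℚ.≤-trans (lo-increasing N≤n) (lo≤hi (at-step n))) (hi-decreasing N≤n)) w<ε }
  lower = record
    { seq = λ n → lo (at-step n)
    ; cauchy = λ ε 0<ε → let N , w<ε = small-width ε 0<ε in N , λ m n N≤m N≤n → ℚ.≤-<-trans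
        (interval-distance (lo-increasing N≤m) (ℚ.≤-trans (lo≤hi (at-step m)) (hi-decreasing N≤m))
                           (lo-increasing N≤n) (ℚ.≤-trans (lo≤hi (at-step n)) (hi-decreasing N≤n))) w<ε }

  upper≃lower : upper ≃ lower
  upper≃lower ε 0<ε = let N , w<ε = small-width ε 0<ε in N , λ n N≤n → ℚ.≤-<-trans
    (interval-distance (ℚ.≤-trans (lo-increasing N≤n) (lo≤hi (at-step n))) (hi-decreasing N≤n)
                       (lo-increasing N≤n) (ℚ.≤-trans (lo≤hi (at-step n)) (hi-decreasing N≤n))) w<ε

  P-upper : ∀ n → P (seq upper n)
  P-upper n = P-hi (at-step n)

  ¬P-lower : ∀ n → ¬ P (seq lower n)
  ¬P-lower n = ¬P-lo (at-step n)

-- Zeros of polynomials given by a three-term recurrence.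

-- A list of pairs (α , β) describes the recurrence w = (x - α) v - β u of a
-- family of orthogonal polynomials, u, v and w being consecutive values.
Coefficients : Set
Coefficients = List (ℚ × ℚ)

-- Opaque, as conversion would otherwise unfold rational arithmetic.
opaque
  step : ℚ → ℚ → ℚ → ℚ → ℚ → ℚ
  step x α β u v = (x ℚ.- α) ℚ.* v ℚ.- β ℚ.* u

  step-≡ : ∀ x α β u v → step x α β u v ≡ (x ℚ.- α) ℚ.* v ℚ.- β ℚ.* u
  step-≡ x α β u v = ≡.refl

-- Started at 0 and 1 with positive β, the condition holds exactly when x lies above all zeros of
-- the last polynomial, because zeros of consecutive polynomials interlace. It thus marks the
-- largest zero by a decidable property of rational numbers.
AllPositive : ℚ → ℚ → ℚ → Coefficients → Set
AllPositive x u v []             = ⊤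
AllPositive x u v ((α , β) ∷ cs) =
  0ℚ ℚ.< step x α β u v × AllPositive x v (step x α β u v) cs

allPositive? : ∀ x u v cs → Dec (AllPositive x u v cs)
allPositive? x u v []             = yes tt
allPositive? x u v ((α , β) ∷ cs) = 0ℚ ℚ.<? step x α β u v ×-dec allPositive? x v _ cs

PositiveRecurrence : Coefficients → Set
PositiveRecurrence = All (λ c → 0ℚ ℚ.< proj₂ c)

nextExpression : ℝ → ℚ → ℚ → ℝ → ℝ → ℝ
nextExpression r α β U V = (r +ᴿ -ᴿ fromℚ α) *ᴿ V +ᴿ -ᴿ (fromℚ β *ᴿ U)

-- The same number as `nextExpression`, but with terms that are literally values of `step`, so that
-- `AllPositive` speaks about them.
next : ℝ → ℚ → ℚ → ℝ → ℝ → ℝ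
next r α β U V .seq n = step (seq r n) α β (seq U n) (seq V n)
next r α β U V .cauchy ε 0<ε =
  let N , h = cauchy (nextExpression r α β U V) ε 0<ε
  in N , λ m n l k → ≡.subst₂ (λ a b → ℚ.∣ a ℚ.- b ∣ ℚ.< ε)
    (≡.sym (step-≡ (seq r m) α β (seq U m) (seq V m))) (≡.sym (step-≡ (seq r n) α β (seq U n) (seq V n))) (h m n l k)

next≃ : ∀ r α β U V → next r α β U V ≃ nextExpression r α β U V
next≃ r α β U V = ≗⇒≃ (next r α β U V) (nextExpression r α β U V) (λ n → step-≡ (seq r n) α β (seq U n) (seq V n))

lastValue : ℝ → ℝ → ℝ → Coefficients → ℝ
lastValue r U V []             = V
lastValue r U V ((α , β) ∷ cs) = lastValue r V (next r α β U V) cs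

-- Beyond this point the successive values do not decrease.
allPositive-eventually : ∀ cs → PositiveRecurrence cs →
  ∃[ M ] (∀ x → M ℚ.≤ x → ∀ u v → 0ℚ ℚ.< v → u ℚ.≤ v → AllPositive x u v cs)
allPositive-eventually [] [] = 0ℚ , λ _ _ _ _ _ _ → tt
allPositive-eventually ((α , β) ∷ cs) (0<β ∷ pos) =
  let M′ , h = allPositive-eventually cs pos
      -- If x - α ≥ 1 + β and u ≤ v, the next value is at least (1 + β) v - β v = v.
      M      = 1ℚ ℚ.+ β ℚ.+ α
  in M ℚ.⊔ M′ , λ x M≤x u v 0<v u≤v →
    let v≤w = bound x u v (ℚ.≤-trans (ℚ.p≤p⊔q M M′) M≤x) 0<v u≤v
        0<w = ℚ.<-≤-trans 0<v v≤w
    in 0<w , h x (ℚ.≤-trans (ℚ.p≤q⊔p M M′) M≤x) v _ 0<w v≤w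
  where
  bound : ∀ x u v → 1ℚ ℚ.+ β ℚ.+ α ℚ.≤ x → 0ℚ ℚ.< v → u ℚ.≤ v → v ℚ.≤ step x α β u v
  bound x u v M≤x 0<v u≤v = ≡.subst₂ ℚ._≤_
    (≡.trans (ℚS.solve 3 (λ o b v → (o ℚS.:+ b) ℚS.:* v ℚS.:- b ℚS.:* v ℚS.:= o ℚS.:* v) ≡.refl 1ℚ β v) (ℚ.*-identityˡ v))
    (≡.sym (step-≡ x α β u v))
    (ℚ.+-mono-≤
      (ℚ.*-monoʳ-≤-nonNeg v {{ℚ.nonNegative (ℚ.<⇒≤ 0<v)}}
        (≡.subst (ℚ._≤ x ℚ.- α) (ℚS.solve 3 (λ o b a → o ℚS.:+ b ℚS.:+ a ℚS.:- a ℚS.:= o ℚS.:+ b) ≡.refl 1ℚ β α)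
          (ℚ.+-monoˡ-≤ (ℚ.- α) M≤x)))
      (ℚ.neg-antimono-≤ (ℚ.*-monoˡ-≤-nonNeg β {{ℚ.nonNegative (ℚ.<⇒≤ 0<β)}} u≤v)))

next-cong : ∀ {r r′ U U′ V V′} α β → r ≃ r′ → U ≃ U′ → V ≃ V′ → next r α β U V ≃ next r′ α β U′ V′
next-cong {r} {r′} {U} {U′} {V} {V′} α β er eU eV =
  ≃-trans (next r α β U V) (nextExpression r α β U V) (next r′ α β U′ V′) (next≃ r α β U V)
  (≃-trans (nextExpression r α β U V) (nextExpression r′ α β U′ V′) (next r′ α β U′ V′)
    (ℝR.+-cong {(r +ᴿ -ᴿ fromℚ α) *ᴿ V} {(r′ +ᴿ -ᴿ fromℚ α) *ᴿ V′} { -ᴿ (fromℚ β *ᴿ U)} { -ᴿ (fromℚ β *ᴿ U′)}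
      (ℝR.*-cong {r +ᴿ -ᴿ fromℚ α} {r′ +ᴿ -ᴿ fromℚ α} {V} {V′} (ℝR.+-congʳ { -ᴿ fromℚ α} {r} {r′} er) eV)
      (ℝR.-‿cong {fromℚ β *ᴿ U} {fromℚ β *ᴿ U′} (ℝR.*-congˡ {fromℚ β} {U} {U′} eU)))
    (≃-sym (next r′ α β U′ V′) (nextExpression r′ α β U′ V′) (next≃ r′ α β U′ V′)))

private
  apart-positive : ∀ {s : ℕ → ℚ} → (∀ n → 0ℚ ℚ.< s n) → Apart s → ∃[ ε ] (0ℚ ℚ.< ε × ∃[ N ] (∀ n → N ℕ.≤ n → ε ℚ.≤ s n))
  apart-positive {s} pos (ε , 0<ε , N , h) = ε , 0<ε , N , λ n l → ≡.subst (ε ℚ.≤_) (ℚ.0≤p⇒∣p∣≡p (ℚ.<⇒≤ (pos n))) (h n l)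

  p≤∣p∣ : ∀ p → p ℚ.≤ ℚ.∣ p ∣
  p≤∣p∣ p with ℚ.≤-total 0ℚ p
  ... | inj₁ 0≤p = ℚ.≤-reflexive (≡.sym (ℚ.0≤p⇒∣p∣≡p 0≤p))
  ... | inj₂ p≤0 = ℚ.≤-trans p≤0 (ℚ.0≤∣p∣ p)

  positive-transfer : ∀ W W′ → W ≃ W′ → (∀ n → 0ℚ ℚ.< seq W n) → Apart (seq W) → ∃[ N ] (∀ n → N ℕ.≤ n → 0ℚ ℚ.< seq W′ n)
  positive-transfer W W′ e pos a =
    let ε , 0<ε , N , h = apart-positive {seq W} pos a
        M , c           = e ε 0<ε
    in N ℕ.⊔ M , λ n l → positive n (ℚ.<-≤-trans (ℚ.≤-<-trans (p≤∣p∣ _) (c n (ℕ.m⊔n≤o⇒n≤o N M l))) (h n (ℕ.m⊔n≤o⇒m≤o N M l)))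
    where
    positive : ∀ n → seq W n ℚ.- seq W′ n ℚ.< seq W n → 0ℚ ℚ.< seq W′ n
    positive n w-w′<w = ≡.subst₂ ℚ._<_
      (ℚS.solve 2 (λ w w′ → (w ℚS.:- w′) ℚS.:+ (w′ ℚS.:- w) ℚS.:= ℚS.:0) ≡.refl (seq W n) (seq W′ n))
      (ℚS.solve 2 (λ w w′ → w ℚS.:+ (w′ ℚS.:- w) ℚS.:= w′) ≡.refl (seq W n) (seq W′ n))
      (ℚ.+-monoˡ-< (seq W′ n ℚ.- seq W n) w-w′<w)

  -- At a zero W of the recurrence the next value is - β V.
  next-nonzero : ∀ r α β V W → 0ℚ ℚ.< β → (∀ n → 0ℚ ℚ.< seq V n) → Apart (seq V) →
                 (∀ n → 0ℚ ℚ.< seq (next r α β V W) n) → ¬ W ≃ fromℚ 0ℚ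
  next-nonzero r α β V W 0<β posV apartV posY W≃0 =
    let δ , 0<δ , N , h = apart-positive {seq V} posV apartV
        M , c           = Null-* (r +ᴿ -ᴿ fromℚ α) (≃0⇒Null W W≃0) (β ℚ.* δ) (ℚ-*-pos 0<β 0<δ)
        n               = N ℕ.⊔ M
        small           = ℚ.≤-<-trans (p≤∣p∣ _) (c n (ℕ.m≤n⊔m N M))
        large           = ℚ.*-monoˡ-≤-nonNeg β {{ℚ.nonNegative (ℚ.<⇒≤ 0<β)}} (h n (ℕ.m≤m⊔n N M))
        negative        = ≡.subst₂ ℚ._<_ ≡.refl (ℚ.+-inverseʳ (β ℚ.* seq V n))
          (ℚ.+-monoˡ-< (ℚ.- (β ℚ.* seq V n)) (ℚ.<-≤-trans small large))
    in ℚ.<-asym (≡.subst (0ℚ ℚ.<_) (step-≡ (seq r n) α β (seq V n) (seq W n)) (posY n)) negative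

-- Suppose that the last value is non-zero. The intermediate values are non-zero as well, by
-- `next-nonzero`, since each is followed by a positive value. All of them are positive along r and
-- bounded away from 0, so they are eventually positive along the equal number r′, where
-- `AllPositive` fails.
lastValue-zero : ∀ r r′ → r ≃ r′ → ∀ c cs → PositiveRecurrence (c ∷ cs) → ∀ U U′ V V′ → U ≃ U′ → V ≃ V′ →
  (∀ n → 0ℚ ℚ.< seq V n) → Apart (seq V) →
  (∀ n → AllPositive (seq r n) (seq U n) (seq V n) (c ∷ cs)) →
  ∃[ N ] (∀ n → N ℕ.≤ n → ¬ AllPositive (seq r′ n) (seq U′ n) (seq V′ n) (c ∷ cs)) →
  lastValue r U V (c ∷ cs) ≃ fromℚ 0ℚ
lastValue-zero r r′ er (α , β) [] (0<β ∷ []) U U′ V V′ eU eV posV apartV pos (N , neg) =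
  ≃0-stable W λ W≄0 → ≄0⇒¬¬apart W W≄0 λ apartW →
    let M , posW′ = positive-transfer W W′ (next-cong {r} {r′} {U} {U′} {V} {V′} α β er eU eV) (λ n → proj₁ (pos n)) apartW
    in neg (N ℕ.⊔ M) (ℕ.m≤m⊔n N M) (posW′ (N ℕ.⊔ M) (ℕ.m≤n⊔m N M) , tt)
  where
  W  = next r α β U V
  W′ = next r′ α β U′ V′
lastValue-zero r r′ er (α , β) ((α₁ , β₁) ∷ cs) (0<β ∷ 0<β₁ ∷ poss) U U′ V V′ eU eV posV apartV pos (N , neg) =
  ≃0-stable (lastValue r U V ((α , β) ∷ (α₁ , β₁) ∷ cs)) λ last≄0 →
    ≄0⇒¬¬apart W (next-nonzero r α₁ β₁ V W 0<β₁ posV apartV (λ n → proj₁ (proj₂ (pos n)))) λ apartW →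
    let M , posW′ = positive-transfer W W′ W≃W′ (λ n → proj₁ (pos n)) apartW
    in last≄0 (lastValue-zero r r′ er (α₁ , β₁) cs (0<β₁ ∷ poss) V V′ (next r α β U V) (next r′ α β U′ V′) eV W≃W′ (λ n → proj₁ (pos n)) apartW
         (λ n → proj₂ (pos n))
         (N ℕ.⊔ M , λ n l p → neg n (ℕ.m⊔n≤o⇒m≤o N M l) (posW′ n (ℕ.m⊔n≤o⇒n≤o N M l) , p)))
  where
  W  = next r α β U V
  W′ = next r′ α β U′ V′
  W≃W′ : W ≃ W′
  W≃W′ = next-cong {r} {r′} {U} {U′} {V} {V′} α β er eU eV

recurrence-root : ∀ c cs → PositiveRecurrence (c ∷ cs) → ∃[ r ] lastValue r (fromℚ 0ℚ) (fromℚ 1ℚ) (c ∷ cs) ≃ fromℚ 0ℚ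
recurrence-root c@(α , β) cs pos =
  B.upper , lastValue-zero B.upper B.lower B.upper≃lower c cs pos (fromℚ 0ℚ) (fromℚ 0ℚ) (fromℚ 1ℚ) (fromℚ 1ℚ)
    (≗⇒≃ (fromℚ 0ℚ) (fromℚ 0ℚ) (λ _ → ≡.refl)) (≗⇒≃ (fromℚ 1ℚ) (fromℚ 1ℚ) (λ _ → ≡.refl)) (λ _ → 0<1)
    (1ℚ , 0<1 , 0 , λ _ _ → ℚ.≤-refl) B.P-upper (0 , λ n _ → B.¬P-lower n)
  where
  0<1 : 0ℚ ℚ.< 1ℚ
  0<1 = ℚ.positive⁻¹ 1ℚ
  M = proj₁ (allPositive-eventually (c ∷ cs) pos)
  P : ℚ → Set
  P x = AllPositive x 0ℚ 1ℚ (c ∷ cs)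
  -- At x = α the first value (x - α) · 1 - β · 0 is zero, which supplies the lower end of the
  -- bisection.
  ¬Pα : ¬ P α
  ¬Pα (0<w , _) = ℚ.<-irrefl (≡.sym (≡.trans (step-≡ α α β 0ℚ 1ℚ) (ℚS.solve 2 (λ a b → (a ℚS.:- a) ℚS.:* ℚS.:1 ℚS.:- b ℚS.:* ℚS.:0 ℚS.:= ℚS.:0) ≡.refl α β))) 0<w
  P? : ∀ x → Dec (P x)
  P? x = allPositive? x 0ℚ 1ℚ (c ∷ cs)
  P-upper-end : P (M ℚ.⊔ α)
  P-upper-end = proj₂ (allPositive-eventually (c ∷ cs) pos) (M ℚ.⊔ α) (ℚ.p≤p⊔q M α) 0ℚ 1ℚ 0<1 (ℚ.<⇒≤ 0<1)
  module B = Bisection P P? α (M ℚ.⊔ α) (ℚ.p≤q⊔p M α) ¬Pα P-upper-end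

-- Orthogonal polynomials of a functional.

module Orthogonality (R : CommutativeRing 0ℓ 0ℓ) where
  open Moments R
  private
    module R = CommutativeRing R
    module P = CommutativeRing polynomialRing
    module S = IntegerSolver R
    module T = IntegerSolver polynomialRing
  open R using (Carrier; _≈_; _+_; _*_; _-_; -_; 0#; 1#)
  open SetoidReasoning R.setoid

  pair : (ℕ → Carrier) → Poly → Poly → Carrier
  pair t f g = ((f *ᴾ g) • t) 0

  pair-comm : ∀ t f g → pair t f g ≈ pair t g f
  pair-comm t f g = •-cong (f *ᴾ g) (g *ᴾ f) t 0 (P.*-comm f g)

  pair-congˡ : ∀ t {f f′} g → f ≋ f′ → pair t f g ≈ pair t f′ g
  pair-congˡ t {f} {f′} g e = •-cong (f *ᴾ g) (f′ *ᴾ g) t 0 (P.*-congʳ {g} e)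

  pair-+ˡ : ∀ t f f′ g → pair t (f +ᴾ f′) g ≈ pair t f g + pair t f′ g
  pair-+ˡ t f f′ g = R.trans (•-cong ((f +ᴾ f′) *ᴾ g) (f *ᴾ g +ᴾ f′ *ᴾ g) t 0 (P.distribʳ g f f′)) (•-+ (f *ᴾ g) (f′ *ᴾ g) t 0)

  pair-∙ˡ : ∀ t a f g → pair t (a ∙ f) g ≈ a * pair t f g
  pair-∙ˡ t a f g = R.trans (•-cong ((a ∙ f) *ᴾ g) (a ∙ (f *ᴾ g)) t 0 (∙-* a f g)) (•-∙ a (f *ᴾ g) t 0)

  pair-+ʳ : ∀ t f g g′ → pair t f (g +ᴾ g′) ≈ pair t f g + pair t f g′
  pair-+ʳ t f g g′ = R.trans (pair-comm t f (g +ᴾ g′)) (R.trans (pair-+ˡ t g g′ f) (R.+-cong (pair-comm t g f) (pair-comm t g′ f)))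

  pair-∙ʳ : ∀ t a f g → pair t f (a ∙ g) ≈ a * pair t f g
  pair-∙ʳ t a f g = R.trans (pair-comm t f (a ∙ g)) (R.trans (pair-∙ˡ t a g f) (R.*-congˡ (pair-comm t g f)))

  pair-X : ∀ t f g → pair t (X· f) g ≈ pair t f (X· g)
  pair-X t f g = •-cong (X· f *ᴾ g) (f *ᴾ X· g) t 0 (P.trans (X·-* f g)
    (P.trans (∷-cong R.refl (P.*-comm f g)) (P.trans (P.sym (X·-* g f)) (P.*-comm (X· g) f))))

  pair-annihilated : ∀ t f g → Annihilates f t → pair t f g ≈ 0#
  pair-annihilated t f g z = R.trans (pair-comm t f g) (annihilates-* g f t z 0)

  X^ : ℕ → Poly
  X^ zero    = constᴾ 1#
  X^ (suc k) = X· (X^ k)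

  •-X^ : ∀ k t j → (X^ k • t) j ≈ t (k ℕ.+ j)
  •-X^ zero    t j = R.trans (R.+-identityʳ _) (R.*-identityˡ _)
  •-X^ (suc k) t j = R.trans (•-X· (X^ k) t j) (R.trans (•-X^ k t (suc j)) (R.reflexive (≡.cong t (ℕ.+-suc k j))))

  orthogonal⇒annihilates : ∀ t f → (∀ g → pair t f g ≈ 0#) → Annihilates f t
  orthogonal⇒annihilates t f h k = R.trans (R.sym (R.trans (•-* (X^ k) f t 0)
      (R.trans (•-X^ k (f • t) 0) (R.reflexive (≡.cong (f • t) (ℕ.+-identityʳ k))))))
    (R.trans (pair-comm t (X^ k) f) (h (X^ k)))

  split : ∀ {k f c} → Monic k c → Below (suc k) f → ∃[ g ] (Below k g × f ≋ coeff f k ∙ c +ᴾ g)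
  split {k} {f} {c} mc bf = g
    , below-step (below-+ bf (below-neg (below-∙ (monic-below mc))))
        (R.trans (coeff-+ f (-ᴾ (coeff f k ∙ c)) k) (R.trans (R.+-congˡ (R.trans (coeff-neg (coeff f k ∙ c) k)
          (R.-‿cong (R.trans (coeff-∙ (coeff f k) c k) (R.trans (R.*-congˡ (monic-top mc)) (R.*-identityʳ _)))))) (R.-‿inverseʳ _)))
    , T.solve 2 (λ f c → f T.:= c T.:+ (f T.:- c)) P.refl f (coeff f k ∙ c)
    where g = f +ᴾ -ᴾ (coeff f k ∙ c)

  -- ratio is what makes the three-term recurrence with coefficient β preserve
  -- orthogonality.
  record Stage (t : ℕ → Carrier) (k : ℕ) (prev cur : Poly) (β : Carrier) : Set where
    field
      cur-monic  : Monic k cur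
      prev-below : Below k prev
      orthogonal : ∀ f → Below k f → pair t f cur ≈ 0#
      ratio      : ∀ f → Below k f → pair t (X· f) cur ≈ β * pair t f prev
      definite   : ∀ f → Below k f → Annihilates f t → f ≋ []

  initial-stage : ∀ t β → Stage t 0 [] (constᴾ 1#) β
  initial-stage t β = record
    { cur-monic  = monic (below-∷ below-[]) R.refl
    ; prev-below = below-[]
    ; orthogonal = λ f b → R.trans (pair-congˡ t (constᴾ 1#) (below-0⇒≋[] b)) R.refl
    ; ratio      = λ f b → R.trans (pair-congˡ t (constᴾ 1#) (0∷≋[] R.refl (below-0⇒≋[] b)))
        (R.sym (R.trans (R.*-congˡ (pair-congˡ t [] (below-0⇒≋[] b))) (R.zeroʳ β)))
    ; definite   = λ f b _ → below-0⇒≋[] b }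

  three-term : Carrier → Carrier → Poly → Poly → Poly
  three-term α β prev cur = X· cur +ᴾ (- α ∙ cur +ᴾ - β ∙ prev)

  -- One Gram-Schmidt step. The value of α makes the new polynomial orthogonal to `cur`;
  -- orthogonality to lower degrees comes from the β term through `ratio`. The inverse `i` of the
  -- norm of `cur` is passed as an argument since R is only a commutative ring.
  next-stage : ∀ {t k prev cur β} i → Stage t k prev cur β → pair t cur cur * i ≈ 1# →
    let α = pair t (X· cur) cur * i
        new = three-term α β prev cur
    in Stage t (suc k) cur new (pair t new new * i)
  next-stage {t} {k} {prev} {cur} {β} i stage n*i≈1 = record
    { cur-monic  = monic (below-+ (below-∷ (monic-below cur-monic)) (below-weaken (ℕ.n≤1+n (suc k)) rest-below))
        (R.trans (coeff-+ (X· cur) rest (suc k)) (R.trans (R.+-cong (monic-top cur-monic) (vanish rest-below (suc k) ℕ.≤-refl)) (R.+-identityʳ 1#)))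
    ; prev-below = monic-below cur-monic
    ; orthogonal = new-orthogonal
    ; ratio      = new-ratio
    ; definite   = new-definite }
    where
    open Stage stage
    n = pair t cur cur
    α = pair t (X· cur) cur * i
    rest = - α ∙ cur +ᴾ - β ∙ prev
    new = X· cur +ᴾ rest
    rest-below : Below (suc k) rest
    rest-below = below-+ (below-∙ (monic-below cur-monic)) (below-∙ (below-weaken (ℕ.n≤1+n k) prev-below))
    expand : ∀ f → pair t f new ≈ pair t (X· f) cur + (- α * pair t f cur + - β * pair t f prev)
    expand f = R.trans (pair-+ʳ t f (X· cur) rest) (R.+-cong (R.sym (pair-X t f cur))
      (R.trans (pair-+ʳ t f (- α ∙ cur) (- β ∙ prev)) (R.+-cong (pair-∙ʳ t (- α) f cur) (pair-∙ʳ t (- β) f prev))))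
    cur⊥new : pair t cur new ≈ 0#
    cur⊥new = begin
      pair t cur new
        ≈⟨ expand cur ⟩
      m + (- (m * i) * n + - β * pair t cur prev)
        ≈⟨ R.+-congˡ (R.+-congˡ (R.*-congˡ (R.trans (pair-comm t cur prev) (orthogonal prev prev-below)))) ⟩
      m + (- (m * i) * n + - β * 0#)
        ≈⟨ S.solve 4 (λ m i n b → m S.:+ ((S.:- (m S.:* i)) S.:* n S.:+ (S.:- b) S.:* S.:0) S.:= m S.:* (S.:1 S.:- n S.:* i)) R.refl m i n β ⟩
      m * (1# - n * i)
        ≈⟨ R.*-congˡ (R.+-congˡ (R.-‿cong n*i≈1)) ⟩
      m * (1# - 1#)
        ≈⟨ S.solve 1 (λ m → m S.:* (S.:1 S.:- S.:1) S.:= S.:0) R.refl m ⟩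
      0# ∎
      where m = pair t (X· cur) cur
    lower⊥new : ∀ g → Below k g → pair t g new ≈ 0#
    lower⊥new g b = begin
      pair t g new
        ≈⟨ expand g ⟩
      pair t (X· g) cur + (- α * pair t g cur + - β * pair t g prev)
        ≈⟨ R.+-cong (ratio g b) (R.+-congʳ (R.*-congˡ (orthogonal g b))) ⟩
      β * pair t g prev + (- α * 0# + - β * pair t g prev)
        ≈⟨ S.solve 3 (λ a b x → b S.:* x S.:+ ((S.:- a) S.:* S.:0 S.:+ (S.:- b) S.:* x) S.:= S.:0) R.refl α β (pair t g prev) ⟩
      0# ∎
    decompose : ∀ f h → Below (suc k) f → ∃[ g ] (Below k g × pair t f h ≈ coeff f k * pair t cur h + pair t g h)
    decompose f h b =
      let g , bg , e = split cur-monic b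
      in g , bg , R.trans (pair-congˡ t h e) (R.trans (pair-+ˡ t (coeff f k ∙ cur) g h) (R.+-congʳ (pair-∙ˡ t (coeff f k) cur h)))
    new-orthogonal : ∀ f → Below (suc k) f → pair t f new ≈ 0#
    new-orthogonal f b =
      let g , bg , e = decompose f new b
      in R.trans e (R.trans (R.+-cong (R.trans (R.*-congˡ cur⊥new) (R.zeroʳ _)) (lower⊥new g bg)) (R.+-identityˡ 0#))
    pair-f-cur : ∀ f → Below (suc k) f → pair t f cur ≈ coeff f k * n
    pair-f-cur f b =
      let g , bg , e = decompose f cur b
      in R.trans e (R.trans (R.+-congˡ (orthogonal g bg)) (R.+-identityʳ _))
    X·cur : X· cur ≋ new +ᴾ -ᴾ rest
    X·cur = T.solve 2 (λ x r → x T.:= (x T.:+ r) T.:- r) P.refl (X· cur) rest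
    pair-X·cur : pair t (X· cur) new ≈ pair t new new
    pair-X·cur = R.trans (pair-congˡ t new X·cur) (R.trans (pair-+ˡ t new (-ᴾ rest) new)
      (R.trans (R.+-congˡ (new-orthogonal (-ᴾ rest) (below-neg rest-below))) (R.+-identityʳ _)))
    new-ratio : ∀ f → Below (suc k) f → pair t (X· f) new ≈ pair t new new * i * pair t f cur
    new-ratio f b =
      let g , bg , e = split cur-monic b
          a = coeff f k
      in begin
        pair t (X· f) new
          ≈⟨ pair-congˡ t new (P.trans (∷-cong R.refl e) (P.trans (X·-+ (a ∙ cur) g) (P.+-congʳ {X· g} (P.sym (∙-X· a cur))))) ⟩
        pair t (a ∙ X· cur +ᴾ X· g) new
          ≈⟨ R.trans (pair-+ˡ t (a ∙ X· cur) (X· g) new) (R.+-cong (R.trans (pair-∙ˡ t a (X· cur) new) (R.*-congˡ pair-X·cur))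
               (new-orthogonal (X· g) (below-∷ bg))) ⟩
        a * pair t new new + 0#
          ≈⟨ S.solve 2 (λ a q → a S.:* q S.:+ S.:0 S.:= q S.:* a S.:* S.:1) R.refl a (pair t new new) ⟩
        pair t new new * a * 1#
          ≈⟨ R.*-congˡ n*i≈1 ⟨
        pair t new new * a * (n * i)
          ≈⟨ S.solve 4 (λ q a n i → q S.:* a S.:* (n S.:* i) S.:= q S.:* i S.:* (a S.:* n)) R.refl (pair t new new) a n i ⟩
        pair t new new * i * (a * n)
          ≈⟨ R.*-congˡ (pair-f-cur f b) ⟨
        pair t new new * i * pair t f cur ∎
    new-definite : ∀ f → Below (suc k) f → Annihilates f t → f ≋ []
    new-definite f b z = definite f (below-step b top≈0) z
      where
      top≈0 : coeff f k ≈ 0#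
      top≈0 = begin
        coeff f k              ≈⟨ R.*-identityʳ _ ⟨
        coeff f k * 1#         ≈⟨ R.*-congˡ n*i≈1 ⟨
        coeff f k * (n * i)    ≈⟨ R.*-assoc _ n i ⟨
        coeff f k * n * i      ≈⟨ R.*-congʳ (R.trans (R.sym (pair-f-cur f b)) (pair-annihilated t f cur z)) ⟩
        0# * i                 ≈⟨ R.zeroˡ i ⟩
        0#                     ∎

  -- Two monic polynomials of degree k differ by one of lower degree, which is orthogonal to `cur`;
  -- and c is orthogonal to everything. Hence the orthogonal sequence has a vanishing norm at the
  -- degree of c at the latest.
  stage-isotropic : ∀ {t k prev cur β c} → Stage t k prev cur β → Monic k c → Annihilates c t → pair t cur cur ≈ 0#
  stage-isotropic {t} {k} {prev} {cur} {β} {c} stage mc z =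
    let g , bg , e = split mc (monic-below cur-monic)
    in R.trans (pair-congˡ t cur e) (R.trans (pair-+ˡ t (coeff cur k ∙ c) g cur)
      (R.trans (R.+-cong (R.trans (pair-∙ˡ t (coeff cur k) c cur) (R.trans (R.*-congˡ (pair-annihilated t c cur z)) (R.zeroʳ _)))
        (orthogonal g bg)) (R.+-identityˡ 0#)))
    where open Stage stage

-- Polynomials under a ring homomorphism.

module PolynomialMap (R S : CommutativeRing 0ℓ 0ℓ) (φ : CommutativeRing.Carrier R → CommutativeRing.Carrier S)
  (φ-cong : ∀ x y → CommutativeRing._≈_ R x y → CommutativeRing._≈_ S (φ x) (φ y))
  (φ-+ : ∀ x y → CommutativeRing._≈_ S (φ (CommutativeRing._+_ R x y)) (CommutativeRing._+_ S (φ x) (φ y)))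
  (φ-* : ∀ x y → CommutativeRing._≈_ S (φ (CommutativeRing._*_ R x y)) (CommutativeRing._*_ S (φ x) (φ y)))
  (φ-neg : ∀ x → CommutativeRing._≈_ S (φ (CommutativeRing.-_ R x)) (CommutativeRing.-_ S (φ x)))
  (φ-0 : CommutativeRing._≈_ S (φ (CommutativeRing.0# R)) (CommutativeRing.0# S)) where
  private
    module R = CommutativeRing R
    module S = CommutativeRing S
    module Rᴾ = Polynomials R
    module Sᴾ = Polynomials S
    module PS = CommutativeRing Sᴾ.polynomialRing
  open Sᴾ using (_≋_; ⟨_⟩; at; coeff; coeff-+; coeff-∙; coeff-neg; ∷-cong; 0∷≋[])

  mapᴾ : Rᴾ.Poly → Sᴾ.Poly
  mapᴾ = List.map φ

  coeff-map : ∀ p n → coeff (mapᴾ p) n S.≈ φ (Rᴾ.coeff p n)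
  coeff-map []      n       = S.sym φ-0
  coeff-map (a ∷ p) zero    = S.refl
  coeff-map (a ∷ p) (suc n) = coeff-map p n

  map-cong : ∀ p q → p Rᴾ.≋ q → mapᴾ p ≋ mapᴾ q
  map-cong p q e = ⟨ (λ n → S.trans (coeff-map p n) (S.trans (φ-cong _ _ (Rᴾ.at e n)) (S.sym (coeff-map q n)))) ⟩

  map-+ : ∀ p q → mapᴾ (p Rᴾ.+ᴾ q) ≋ mapᴾ p Sᴾ.+ᴾ mapᴾ q
  map-+ p q = ⟨ (λ n → S.trans (coeff-map (p Rᴾ.+ᴾ q) n) (S.trans (φ-cong _ _ (Rᴾ.coeff-+ p q n)) (S.trans (φ-+ _ _)
    (S.trans (S.+-cong (S.sym (coeff-map p n)) (S.sym (coeff-map q n))) (S.sym (coeff-+ (mapᴾ p) (mapᴾ q) n)))))) ⟩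

  map-∙ : ∀ a p → mapᴾ (a Rᴾ.∙ p) ≋ φ a Sᴾ.∙ mapᴾ p
  map-∙ a p = ⟨ (λ n → S.trans (coeff-map (a Rᴾ.∙ p) n) (S.trans (φ-cong _ _ (Rᴾ.coeff-∙ a p n)) (S.trans (φ-* _ _)
    (S.trans (S.*-congˡ (S.sym (coeff-map p n))) (S.sym (coeff-∙ (φ a) (mapᴾ p) n)))))) ⟩

  map-neg : ∀ p → mapᴾ (Rᴾ.-ᴾ p) ≋ Sᴾ.-ᴾ mapᴾ p
  map-neg p = ⟨ (λ n → S.trans (coeff-map (Rᴾ.-ᴾ p) n) (S.trans (φ-cong _ _ (Rᴾ.coeff-neg p n)) (S.trans (φ-neg _)
    (S.trans (S.-‿cong (S.sym (coeff-map p n))) (S.sym (coeff-neg (mapᴾ p) n)))))) ⟩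

  map-* : ∀ p q → mapᴾ (p Rᴾ.*ᴾ q) ≋ mapᴾ p Sᴾ.*ᴾ mapᴾ q
  map-* []      q = PS.refl
  map-* (a ∷ p) q = PS.trans (map-+ (a Rᴾ.∙ q) (Rᴾ.X· (p Rᴾ.*ᴾ q))) (PS.+-cong (map-∙ a q) (∷-cong φ-0 (map-* p q)))

  map-deriv : ∀ p → mapᴾ (Rᴾ.deriv p) ≋ Sᴾ.deriv (mapᴾ p)
  map-deriv []      = PS.refl
  map-deriv (a ∷ p) = PS.trans (map-+ p (Rᴾ.X· (Rᴾ.deriv p))) (PS.+-congˡ {mapᴾ p} (∷-cong φ-0 (map-deriv p)))

  map-reflect : ∀ p → mapᴾ (Rᴾ.reflect p) ≋ Sᴾ.reflect (mapᴾ p)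
  map-reflect []      = PS.refl
  map-reflect (a ∷ p) = ∷-cong S.refl (PS.trans (map-neg (Rᴾ.reflect p)) (PS.-‿cong (map-reflect p)))

-- Even and odd parts of a functional.

module Reflection (R : CommutativeRing 0ℓ 0ℓ) where
  open Moments R
  open Orthogonality R
  private
    module R = CommutativeRing R
    module RP = RingProperties R.ring
    module P = CommutativeRing polynomialRing
    module T = IntegerSolver polynomialRing
  open R using (Carrier; _≈_; _+_; _*_; _-_; -_; 0#; 1#)
  open SetoidReasoning P.setoid

  pair-alternate : ∀ t f → pair (alternate t) f f ≈ pair t (reflect f) (reflect f)
  pair-alternate t f = R.trans (•-cong (f *ᴾ f) (reflect (reflect f *ᴾ reflect f)) (alternate t) 0
      (P.sym (P.trans (reflect-* (reflect f) (reflect f)) (P.*-cong (reflect-involutive f) (reflect-involutive f)))))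
    (•-alternate (reflect f *ᴾ reflect f) t 0)

  annihilates-reflect : ∀ p t → Annihilates p t → Annihilates (reflect p) (alternate t)
  annihilates-reflect p t z k = R.trans (•-alternate p t k) (alternate-zero (p • t) z k)

  pair-scaled : ∀ t h f g → pair ((h *ᴾ h) • t) f g ≈ pair t (h *ᴾ f) (h *ᴾ g)
  pair-scaled t h f g = R.trans (R.sym (•-* (f *ᴾ g) (h *ᴾ h) t 0))
    (•-cong ((f *ᴾ g) *ᴾ (h *ᴾ h)) ((h *ᴾ f) *ᴾ (h *ᴾ g)) t 0
      (T.solve 3 (λ f g h → (f T.:* g) T.:* (h T.:* h) T.:= (h T.:* f) T.:* (h T.:* g)) P.refl f g h))

  -- Twice the moments of odd, respectively even, index, and zero at the others. If t lists the
  -- traces of the powers of A, then `odd t` represents f ↦ tr f(A) - tr f(-A). The shape a s + t is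
  -- that of `•-linear`.
  odd even : (ℕ → Carrier) → ℕ → Carrier
  odd  t k = - 1# * alternate t k + t k
  even t k = 1# * alternate t k + t k

  annihilates-combination : ∀ a q s t → Annihilates q s → Annihilates q t → Annihilates q (λ k → a * s k + t k)
  annihilates-combination a q s t zs zt k = R.trans (•-linear q a s t k)
    (R.trans (R.+-cong (R.trans (R.*-congˡ (zs k)) (R.zeroʳ a)) (zt k)) (R.+-identityˡ 0#))

  module _ p t (p•t≈0 : Annihilates p t) where
    private
      p⁻ = reflect p
      Q = quotientMoment

    product-annihilates : Annihilates (p *ᴾ p⁻) t
    product-annihilates = annihilates-cong t (P.*-comm p⁻ p) (annihilates-* p⁻ p t p•t≈0)

    product-annihilates-alternate : Annihilates (p *ᴾ p⁻) (alternate t)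
    product-annihilates-alternate = annihilates-* p p⁻ (alternate t) (annihilates-reflect p t p•t≈0)

    newton-reflect : deriv p ≋ Q t p → deriv p⁻ ≋ Q (alternate t) p⁻
    newton-reflect newton = P.sym (P.trans (quotientMoment-reflect t p) (P.trans (P.-‿cong (reflect-cong (Q t p) (deriv p) (P.sym newton))) (P.sym (deriv-reflect p))))

    -- Both sides are the quotient moment of p p⁻ c, expanded in the two
    -- possible ways.
    wronskian-identity : deriv p ≋ Q t p → ∀ {c} → Annihilates c (odd t) →
      c *ᴾ (p⁻ *ᴾ deriv p +ᴾ -ᴾ (p *ᴾ deriv p⁻)) ≋ p *ᴾ p⁻ *ᴾ Q (odd t) c
    wronskian-identity newton {c} z = begin
      c *ᴾ (p⁻ *ᴾ deriv p +ᴾ -ᴾ (p *ᴾ deriv p⁻))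
        ≈⟨ P.*-congˡ {c} moment ⟨
      c *ᴾ Q (odd t) (p *ᴾ p⁻)
        ≈⟨ P.+-identityʳ _ ⟨
      c *ᴾ Q (odd t) (p *ᴾ p⁻) +ᴾ []
        ≈⟨ P.+-congˡ {c *ᴾ Q (odd t) (p *ᴾ p⁻)} (quotientMoment-zero ((p *ᴾ p⁻) • odd t) c
             (annihilates-combination (- 1#) (p *ᴾ p⁻) (alternate t) t product-annihilates-alternate product-annihilates)) ⟨
      c *ᴾ Q (odd t) (p *ᴾ p⁻) +ᴾ Q ((p *ᴾ p⁻) • odd t) c
        ≈⟨ quotientMoment-* (odd t) c (p *ᴾ p⁻) ⟨
      Q (odd t) (c *ᴾ (p *ᴾ p⁻))
        ≈⟨ quotientMoment-cong (odd t) (c *ᴾ (p *ᴾ p⁻)) (p *ᴾ p⁻ *ᴾ c) (P.*-comm c (p *ᴾ p⁻)) ⟩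
      Q (odd t) (p *ᴾ p⁻ *ᴾ c)
        ≈⟨ quotientMoment-* (odd t) (p *ᴾ p⁻) c ⟩
      p *ᴾ p⁻ *ᴾ Q (odd t) c +ᴾ Q (c • odd t) (p *ᴾ p⁻)
        ≈⟨ P.+-congˡ {p *ᴾ p⁻ *ᴾ Q (odd t) c} (quotientMoment-zero (c • odd t) (p *ᴾ p⁻) z) ⟩
      p *ᴾ p⁻ *ᴾ Q (odd t) c +ᴾ []
        ≈⟨ P.+-identityʳ _ ⟩
      p *ᴾ p⁻ *ᴾ Q (odd t) c ∎
      where
      Q-t : Q t (p *ᴾ p⁻) ≋ p⁻ *ᴾ deriv p
      Q-t = begin
        Q t (p *ᴾ p⁻)                      ≈⟨ quotientMoment-cong t (p *ᴾ p⁻) (p⁻ *ᴾ p) (P.*-comm p p⁻) ⟩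
        Q t (p⁻ *ᴾ p)                      ≈⟨ quotientMoment-* t p⁻ p ⟩
        p⁻ *ᴾ Q t p +ᴾ Q (p • t) p⁻        ≈⟨ P.+-cong (P.*-congˡ {p⁻} (P.sym newton)) (quotientMoment-zero (p • t) p⁻ p•t≈0) ⟩
        p⁻ *ᴾ deriv p +ᴾ []                ≈⟨ P.+-identityʳ _ ⟩
        p⁻ *ᴾ deriv p                      ∎
      Q-alternate : Q (alternate t) (p *ᴾ p⁻) ≋ p *ᴾ deriv p⁻
      Q-alternate = begin
        Q (alternate t) (p *ᴾ p⁻)                            ≈⟨ quotientMoment-* (alternate t) p p⁻ ⟩
        p *ᴾ Q (alternate t) p⁻ +ᴾ Q (p⁻ • alternate t) p    ≈⟨ P.+-cong (P.*-congˡ {p} (P.sym (newton-reflect newton)))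
                                                                 (quotientMoment-zero (p⁻ • alternate t) p (annihilates-reflect p t p•t≈0)) ⟩
        p *ᴾ deriv p⁻ +ᴾ []                                  ≈⟨ P.+-identityʳ _ ⟩
        p *ᴾ deriv p⁻                                        ∎
      moment : Q (odd t) (p *ᴾ p⁻) ≋ p⁻ *ᴾ deriv p +ᴾ -ᴾ (p *ᴾ deriv p⁻)
      moment = begin
        Q (odd t) (p *ᴾ p⁻)
          ≈⟨ quotientMoment-linear (- 1#) (alternate t) t (p *ᴾ p⁻) ⟩
        - 1# ∙ Q (alternate t) (p *ᴾ p⁻) +ᴾ Q t (p *ᴾ p⁻)
          ≈⟨ P.+-cong (∙-cong R.refl Q-alternate) Q-t ⟩
        - 1# ∙ (p *ᴾ deriv p⁻) +ᴾ p⁻ *ᴾ deriv p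
          ≈⟨ P.+-congʳ {p⁻ *ᴾ deriv p} ⟨ (λ n → R.trans (coeff-∙ (- 1#) (p *ᴾ deriv p⁻) n)
               (R.trans (RP.-1*x≈-x _) (R.sym (coeff-neg (p *ᴾ deriv p⁻) n)))) ⟩ ⟩
        -ᴾ (p *ᴾ deriv p⁻) +ᴾ p⁻ *ᴾ deriv p
          ≈⟨ P.+-comm (-ᴾ (p *ᴾ deriv p⁻)) (p⁻ *ᴾ deriv p) ⟩
        p⁻ *ᴾ deriv p +ᴾ -ᴾ (p *ᴾ deriv p⁻) ∎

  -- By the product rule, the quotient moment of e for c′ • t is u - e Q(t, c′), a multiple of e.
  -- Its degree is smaller than that of e, so it is zero, and `quotientMoment-faithful` gives the
  -- vanishing of c′ • t itself.
  common-divisor : ∀ {d e c c′ u′} t → Monic (suc d) e → Annihilates c t → c ≋ e *ᴾ c′ →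
                   quotientMoment t c ≋ e *ᴾ u′ → Annihilates c′ t
  common-divisor {d} {e} {c} {c′} {u′} t me z c≋ u≋ = quotientMoment-faithful me (c′ • t)
    (λ k → R.trans (R.sym (•-* e c′ t k)) (R.trans (•-cong (e *ᴾ c′) c t k (P.sym c≋)) (z k))) Q≋[]
    where
    Q = quotientMoment
    v = u′ +ᴾ -ᴾ Q t c′
    Q≋ : Q (c′ • t) e ≋ e *ᴾ v
    Q≋ = begin
      Q (c′ • t) e
        ≈⟨ T.solve 2 (λ a b → b T.:= (a T.:+ b) T.:- a) P.refl (e *ᴾ Q t c′) (Q (c′ • t) e) ⟩
      (e *ᴾ Q t c′ +ᴾ Q (c′ • t) e) +ᴾ -ᴾ (e *ᴾ Q t c′)
        ≈⟨ P.+-congʳ { -ᴾ (e *ᴾ Q t c′)} (P.trans (P.sym (quotientMoment-* t e c′))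
             (P.trans (quotientMoment-cong t (e *ᴾ c′) c (P.sym c≋)) u≋)) ⟩
      e *ᴾ u′ +ᴾ -ᴾ (e *ᴾ Q t c′)
        ≈⟨ T.solve 3 (λ e u q → e T.:* u T.:- e T.:* q T.:= e T.:* (u T.:- q)) P.refl e u′ (Q t c′) ⟩
      e *ᴾ v ∎
    v≋[] : v ≋ []
    v≋[] = below-0⇒≋[] (monic-*-below me v (below-weaken (ℕ.≤-reflexive (≡.sym (ℕ.+-identityʳ (suc d))))
      (below-cong Q≋ (quotientMoment-below (c′ • t) e (monic-below me)))))
    Q≋[] : Q (c′ • t) e ≋ []
    Q≋[] = P.trans Q≋ (P.trans (P.*-congˡ {e} v≋[]) (P.zeroʳ e))

  monic-0 : ∀ {c} → Monic 0 c → c ≋ constᴾ 1#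
  monic-0 mc = ⟨ (λ { zero → monic-top mc ; (suc n) → vanish (monic-below mc) (suc n) (s≤s z≤n) }) ⟩

-- Evaluation of the three-term recurrence under a ring homomorphism.

module EvalThreeTerm (R S : CommutativeRing 0ℓ 0ℓ) (φ : CommutativeRing.Carrier R → CommutativeRing.Carrier S)
  (φ-neg : ∀ x → CommutativeRing._≈_ S (φ (CommutativeRing.-_ R x)) (CommutativeRing.-_ S (φ x)))
  (φ-0 : CommutativeRing._≈_ S (φ (CommutativeRing.0# R)) (CommutativeRing.0# S))
  (φ-* : ∀ x y → CommutativeRing._≈_ S (φ (CommutativeRing._*_ R x y)) (CommutativeRing._*_ S (φ x) (φ y)))
  (φ-cong : ∀ x y → CommutativeRing._≈_ R x y → CommutativeRing._≈_ S (φ x) (φ y))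
  (φ-+ : ∀ x y → CommutativeRing._≈_ S (φ (CommutativeRing._+_ R x y)) (CommutativeRing._+_ S (φ x) (φ y))) where
  open PolynomialMap R S φ φ-cong φ-+ φ-* φ-neg φ-0
  private
    module S = CommutativeRing S
    module Rᴾ = Orthogonality R
    module Rᵖ = Polynomials R
    module Sᴾ = Polynomials S
    module PS = CommutativeRing Sᴾ.polynomialRing
    module RR = CommutativeRing R
    module SS = IntegerSolver S

  eval-three-term : ∀ α β prev cur r →
    Sᴾ.eval (mapᴾ (Rᴾ.three-term α β prev cur)) r S.≈
    (r S.+ S.- φ α) S.* Sᴾ.eval (mapᴾ cur) r S.+ S.- (φ β S.* Sᴾ.eval (mapᴾ prev) r)
  eval-three-term α β prev cur r =
    S.trans (Sᴾ.eval-cong (mapᴾ (Rᵖ.X· cur Rᵖ.+ᴾ rest)) (mapᴾ (Rᵖ.X· cur) Sᴾ.+ᴾ (φ (RR.- α) Sᴾ.∙ mapᴾ cur Sᴾ.+ᴾ φ (RR.- β) Sᴾ.∙ mapᴾ prev)) r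
      (PS.trans (map-+ (Rᵖ.X· cur) rest) (PS.+-congˡ {mapᴾ (Rᵖ.X· cur)}
        (PS.trans (map-+ (RR.- α Rᵖ.∙ cur) (RR.- β Rᵖ.∙ prev)) (PS.+-cong (map-∙ (RR.- α) cur) (map-∙ (RR.- β) prev))))))
    (S.trans (Sᴾ.eval-+ (mapᴾ (Rᵖ.X· cur)) (φ (RR.- α) Sᴾ.∙ mapᴾ cur Sᴾ.+ᴾ φ (RR.- β) Sᴾ.∙ mapᴾ prev) r)
    (S.trans (S.+-cong (S.+-congʳ φ-0) (S.trans (Sᴾ.eval-+ (φ (RR.- α) Sᴾ.∙ mapᴾ cur) (φ (RR.- β) Sᴾ.∙ mapᴾ prev) r)
      (S.+-cong (S.trans (Sᴾ.eval-∙ (φ (RR.- α)) (mapᴾ cur) r) (S.*-congʳ (φ-neg α)))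
                (S.trans (Sᴾ.eval-∙ (φ (RR.- β)) (mapᴾ prev) r) (S.*-congʳ (φ-neg β))))))
    (SS.solve 5 (λ r a b v u → (SS.:0 SS.:+ r SS.:* v) SS.:+ ((SS.:- a) SS.:* v SS.:+ (SS.:- b) SS.:* u)
      SS.:= (r SS.:- a) SS.:* v SS.:- b SS.:* u) S.refl r (φ α) (φ β) (Sᴾ.eval (mapᴾ cur) r) (Sᴾ.eval (mapᴾ prev) r))))
    where rest = (RR.- α) Rᵖ.∙ cur Rᵖ.+ᴾ (RR.- β) Rᵖ.∙ prev

-- Traces of powers as a functional.

module PowerSums (R : CommutativeRing 0ℓ 0ℓ) where
  open Moments R
  open Orthogonality R
  open CharacteristicPolynomial R
  private
    module R = CommutativeRing R
    module E = Determinant R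
  open R using (Carrier; _≈_; _+_; _*_; 0#; 1#)
  open SemiringSum R.semiring using (sum; ∑-comm; *-distribˡ-sum; *-distribʳ-sum)

  module _ {n : ℕ} (A : Matrix Carrier n) where
    private
      m = powerEntry A

    •-power-split : ∀ g i k a → (g • m i k) a ≈ sum (λ j → m i j a * (g • m j k) 0)
    •-power-split g i k zero    = R.sym (sum-Iˡ i (λ j → (g • m j k) 0))
    •-power-split g i k (suc a) =
      R.trans (•-powerEntry A g i k a)
      (R.trans (E.sum-cong (λ l → A i l * (g • m l k) a) _ (λ l → R.*-congˡ (•-power-split g l k a)))
      (R.trans (E.sum-cong _ (λ l → sum (λ j → A i l * (m l j a * (g • m j k) 0))) (λ l → *-distribˡ-sum (A i l) (λ j → m l j a * (g • m j k) 0)))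
      (R.trans (∑-comm (λ l j → A i l * (m l j a * (g • m j k) 0)))
      (E.sum-cong (λ j → sum (λ l → A i l * (m l j a * (g • m j k) 0))) _ (λ j →
        R.trans (E.sum-cong (λ l → A i l * (m l j a * (g • m j k) 0)) (λ l → A i l * m l j a * (g • m j k) 0) (λ l → R.sym (R.*-assoc _ _ _)))
        (R.sym (*-distribʳ-sum ((g • m j k) 0) (λ l → A i l * m l j a))))))))

    powerEntry-+ : ∀ i k a b → m i k (b ℕ.+ a) ≈ sum (λ j → m i j a * m j k b)
    powerEntry-+ i k a b = R.trans (R.sym (•-X^ b (m i k) a)) (R.trans (•-power-split (X^ b) i k a)
      (E.sum-cong (λ j → m i j a * (X^ b • m j k) 0) _ (λ j → R.*-congˡ
        (R.trans (•-X^ b (m j k) 0) (R.reflexive (≡.cong (m j k) (ℕ.+-identityʳ b)))))))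

    powerEntry-1 : ∀ i k → m i k 1 ≈ A i k
    powerEntry-1 i k = E.sum-I (A i) k

    -- The transpose of A A ^ a is A ^ a A; `powerEntry-+` with exponents a and 1 moves the extra
    -- factor back to the left.
    powerEntry-symmetric : (∀ i j → A i j ≈ A j i) → ∀ a i j → m i j a ≈ m j i a
    powerEntry-symmetric s zero    i j with i Fin.≟ j
    ... | yes ≡.refl = R.sym (E.I-diagonal n i)
    ... | no  i≢j    = R.sym (E.I-off-diagonal n (i≢j ∘ ≡.sym))
    powerEntry-symmetric s (suc a) i j =
      R.trans (E.sum-cong (λ l → A i l * m l j a) (λ l → m j l a * m l i 1) (λ l → R.trans (R.*-comm _ _)
        (R.*-cong (powerEntry-symmetric s a l j) (R.trans (s i l) (R.sym (powerEntry-1 l i))))))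
      (R.sym (powerEntry-+ j i a 1))

    -- The trace of f(A) g(A) written through entries. For f = g and symmetric A it is a sum of
    -- squares, which is the positivity of the trace functional.
    pair-powerTrace : ∀ f g → pair (powerTrace A) f g ≈ sum (λ i → sum (λ j → (g • m j i) 0 * (f • m i j) 0))
    pair-powerTrace f g = R.trans (•-* f g (powerTrace A) 0)
      (R.trans (•-congʳ f (λ a → R.trans (•-powerTrace A g a) (E.sum-cong (λ i → (g • m i i) a) (λ i → 1# * u i a)
        (λ i → R.trans (•-power-split g i i a) (R.trans (E.sum-cong (λ j → m i j a * (g • m j i) 0) (λ j → (g • m j i) 0 * m i j a)
          (λ j → R.*-comm _ _)) (R.sym (R.*-identityˡ _)))))) 0)
      (R.trans (•-sum f (λ _ → 1#) u 0)
      (E.sum-cong (λ i → 1# * (f • u i) 0) _ (λ i → R.trans (R.*-identityˡ _) (•-sum f (λ j → (g • m j i) 0) (m i) 0)))))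
      where
      u : Fin n → ℕ → Carrier
      u i a = sum (λ j → (g • m j i) 0 * m i j a)

    powerTrace-0 : powerTrace A 0 ≈ n · 1#
    powerTrace-0 = R.trans (E.sum-cong (λ i → E.I n i i) (λ _ → 1#) (E.I-diagonal n)) (sum-replicate n)
      where open SemiringSum R.semiring using (sum-replicate)

  alternate-square : ∀ (f : ℕ → Carrier) k → alternate f k * alternate f k ≈ f k * f k
  alternate-square f zero    = R.refl
  alternate-square f (suc k) = R.trans (S.solve 1 (λ x → (S.:- x) S.:* (S.:- x) S.:= x S.:* x) R.refl (alternate (f ∘ suc) k))
    (alternate-square (f ∘ suc) k)
    where module S = IntegerSolver R

-- Odd powers of a sum with an anticommuting involution.

double : ℕ → ℕ
double zero    = zero
double (suc j) = suc (suc (double j))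

module AnticommutingTrace (M : Ring 0ℓ 0ℓ) (K : CommutativeRing 0ℓ 0ℓ)
  (tr : Ring.Carrier M → CommutativeRing.Carrier K)
  (tr-cong : ∀ x y → Ring._≈_ M x y → CommutativeRing._≈_ K (tr x) (tr y))
  (tr-+ : ∀ x y → CommutativeRing._≈_ K (tr (Ring._+_ M x y)) (CommutativeRing._+_ K (tr x) (tr y)))
  (tr-neg : ∀ x → CommutativeRing._≈_ K (tr (Ring.-_ M x)) (CommutativeRing.-_ K (tr x)))
  (tr-comm : ∀ x y → CommutativeRing._≈_ K (tr (Ring._*_ M x y)) (tr (Ring._*_ M y x)))
  (torsion-free : ∀ x → CommutativeRing._≈_ K x (CommutativeRing.-_ K x) → CommutativeRing._≈_ K x (CommutativeRing.0# K)) where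
  private
    module K = CommutativeRing K
  open Ring M
  open RawSemiringDefs (RawRing.rawSemiring rawRing) using (_^_)
  open RingProperties M using (-‿distribˡ-*; -‿distribʳ-*; -‿involutive)
  open SetoidReasoning setoid

  Commute : Carrier → Carrier → Set
  Commute v w = v * w ≈ w * v

  commute-* : ∀ {v w c} → Commute v c → Commute w c → Commute (v * w) c
  commute-* {v} {w} {c} vc wc = begin
    (v * w) * c   ≈⟨ *-assoc v w c ⟩
    v * (w * c)   ≈⟨ *-congˡ wc ⟩
    v * (c * w)   ≈⟨ *-assoc v c w ⟨
    (v * c) * w   ≈⟨ *-congʳ vc ⟩
    (c * v) * w   ≈⟨ *-assoc c v w ⟩
    c * (v * w)   ∎

  commute-+ : ∀ {v w c} → Commute v c → Commute w c → Commute (v + w) c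
  commute-+ {v} {w} {c} vc wc = trans (distribʳ c v w) (trans (+-cong vc wc) (sym (distribˡ c v w)))

  commute-1 : ∀ c → Commute 1# c
  commute-1 c = trans (*-identityˡ c) (sym (*-identityʳ c))

  commute-0 : ∀ c → Commute 0# c
  commute-0 c = trans (zeroˡ c) (sym (zeroʳ c))

  commute-^ : ∀ {v c} j → Commute v c → Commute (v ^ j) c
  commute-^ {v} {c} ℕ.zero    vc = commute-1 c
  commute-^         (suc j) vc = commute-* vc (commute-^ j vc)

  ^-cong : ∀ {x y} j → x ≈ y → x ^ j ≈ y ^ j
  ^-cong ℕ.zero    e = refl
  ^-cong (suc j) e = *-cong e (^-cong j e)

  -- For the Cartesian product a, d and z become A(Γ₁) ⊗ I, D ⊗ I and I ⊗ A(Γ₂); for the semi-strong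
  -- product they are A(Γ₁), D and I.
  module _ {a d z : Carrier} (d²≈1 : d * d ≈ 1#) (ad≈-da : a * d ≈ - (d * a)) (za : Commute z a) (zd : Commute z d) where

    -- Conjugation by d preserves the trace but sends a v to - a v.
    tr-a* : ∀ v → Commute v d → tr (a * v) K.≈ K.0#
    tr-a* v vd = torsion-free _ (K.trans (tr-cong _ _ (sym (trans (*-congˡ d²≈1) (*-identityʳ _))))
      (K.trans (tr-cong _ _ (sym (*-assoc (a * v) d d))) (K.trans (tr-comm (a * v * d) d)
      (K.trans (tr-cong _ _ conjugate) (tr-neg (a * v))))))
      where
      conjugate : d * (a * v * d) ≈ - (a * v)
      conjugate = begin
        d * (a * v * d)       ≈⟨ *-congˡ (trans (*-assoc a v d) (*-congˡ vd)) ⟩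
        d * (a * (d * v))     ≈⟨ *-congˡ (trans (sym (*-assoc a d v)) (*-congʳ ad≈-da)) ⟩
        d * (- (d * a) * v)   ≈⟨ *-congˡ (trans (sym (-‿distribˡ-* (d * a) v)) (-‿cong (*-assoc d a v))) ⟩
        d * - (d * (a * v))   ≈⟨ -‿distribʳ-* d (d * (a * v)) ⟨
        - (d * (d * (a * v))) ≈⟨ -‿cong (trans (sym (*-assoc d d (a * v))) (trans (*-congʳ d²≈1) (*-identityˡ (a * v)))) ⟩
        - (a * v)             ∎

    a²-commutes-d : Commute (a * a) d
    a²-commutes-d = begin
      (a * a) * d         ≈⟨ trans (*-assoc a a d) (*-congˡ ad≈-da) ⟩
      a * - (d * a)       ≈⟨ -‿distribʳ-* a (d * a) ⟨
      - (a * (d * a))     ≈⟨ -‿cong (trans (sym (*-assoc a d a)) (*-congʳ ad≈-da)) ⟩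
      - (- (d * a) * a)   ≈⟨ -‿cong (-‿distribˡ-* (d * a) a) ⟨
      - - (d * a * a)     ≈⟨ trans (-‿involutive _) (*-assoc d a a) ⟩
      d * (a * a)         ∎

    -- Moving the factor d a cyclically behind a v and then back past it costs one sign.
    tr-da²* : ∀ v → Commute v a → Commute v d → tr (d * (a * a * v)) K.≈ K.0#
    tr-da²* v va vd = torsion-free _ (K.trans (tr-cong _ _ split) (K.trans (tr-comm (d * a) (a * v))
      (K.trans (tr-cong _ _ reorder) (K.trans (tr-neg (d * a * (a * v))) (K.-‿cong (tr-cong _ _ (sym split)))))))
      where
      split : d * (a * a * v) ≈ d * a * (a * v)
      split = trans (*-congˡ (*-assoc a a v)) (sym (*-assoc d a (a * v)))
      reorder : a * v * (d * a) ≈ - (d * a * (a * v))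
      reorder = begin
        a * v * (d * a)       ≈⟨ *-assoc a v (d * a) ⟩
        a * (v * (d * a))     ≈⟨ *-congˡ (trans (sym (*-assoc v d a)) (trans (*-congʳ vd) (trans (*-assoc d v a) (*-congˡ va)))) ⟩
        a * (d * (a * v))     ≈⟨ *-assoc a d (a * v) ⟨
        a * d * (a * v)       ≈⟨ *-congʳ ad≈-da ⟩
        - (d * a) * (a * v)   ≈⟨ -‿distribˡ-* (d * a) (a * v) ⟨
        - (d * a * (a * v))   ∎

    private
      x = a + d * z

    -- The cross terms cancel because a anticommutes with d while z commutes with both.
    square : x * x ≈ a * a + z * z
    square = begin
      x * x
        ≈⟨ trans (distribʳ x a (d * z)) (+-cong (distribˡ a a (d * z)) (distribˡ (d * z) a (d * z))) ⟩
      (a * a + a * (d * z)) + (d * z * a + d * z * (d * z))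
        ≈⟨ +-cong (+-congˡ (trans (sym (*-assoc a d z)) (trans (*-congʳ ad≈-da) (sym (-‿distribˡ-* (d * a) z)))))
                  (+-cong (trans (*-assoc d z a) (trans (*-congˡ za) (sym (*-assoc d a z)))) dzdz) ⟩
      (a * a + - (d * a * z)) + (d * a * z + z * z)
        ≈⟨ +-assoc (a * a) (- (d * a * z)) (d * a * z + z * z) ⟩
      a * a + (- (d * a * z) + (d * a * z + z * z))
        ≈⟨ +-congˡ (trans (sym (+-assoc _ _ _)) (trans (+-congʳ (-‿inverseˡ (d * a * z))) (+-identityˡ (z * z)))) ⟩
      a * a + z * z ∎
      where
      dzdz : d * z * (d * z) ≈ z * z
      dzdz = begin
        d * z * (d * z)     ≈⟨ trans (*-assoc d z (d * z)) (*-congˡ (trans (sym (*-assoc z d z)) (trans (*-congʳ zd) (*-assoc d z z)))) ⟩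
        d * (d * (z * z))   ≈⟨ trans (sym (*-assoc d d (z * z))) (trans (*-congʳ d²≈1) (*-identityˡ (z * z))) ⟩
        z * z               ∎

    z²-commutes-a² : Commute (z * z) (a * a)
    z²-commutes-a² = sym (commute-* {a} {a} {z * z} (sym (commute-* za za)) (sym (commute-* za za)))

    -- In the expansion of (a² + z²) ^ j all terms but z ^ 2j contain a². Only the commutation
    -- properties of the cofactor w are kept, as they are what the two trace lemmas require of it.
    square-power : ∀ j → ∃[ w ] (Commute w a × Commute w d × (x * x) ^ j ≈ (z * z) ^ j + a * a * w)
    square-power ℕ.zero    = 0# , commute-0 a , commute-0 d , sym (trans (+-congˡ (zeroʳ (a * a))) (+-identityʳ 1#))
    square-power (suc j) with square-power j
    ... | w , wa , wd , e = (Z + a * a * w) + z * z * w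
      , commute-+ (commute-+ (commute-^ j (commute-* za za)) (commute-* (*-assoc a a a) wa)) (commute-* (commute-* za za) wa)
      , commute-+ (commute-+ (commute-^ j (commute-* zd zd)) (commute-* a²-commutes-d wd)) (commute-* (commute-* zd zd) wd)
      , (begin
          x * x * (x * x) ^ j                               ≈⟨ *-cong square e ⟩
          (A + B) * (Z + A * w)                             ≈⟨ distribʳ (Z + A * w) A B ⟩
          A * (Z + A * w) + B * (Z + A * w)                 ≈⟨ +-comm _ _ ⟩
          B * (Z + A * w) + A * (Z + A * w)                 ≈⟨ +-congʳ (trans (distribˡ B Z (A * w)) (+-congˡ
                                                                 (trans (sym (*-assoc B A w)) (trans (*-congʳ z²-commutes-a²) (*-assoc A B w))))) ⟩
          (B * Z + A * (B * w)) + A * (Z + A * w)           ≈⟨ +-assoc _ _ _ ⟩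
          B * Z + (A * (B * w) + A * (Z + A * w))           ≈⟨ +-congˡ (trans (+-comm _ _) (sym (distribˡ A (Z + A * w) (B * w)))) ⟩
          B * Z + A * ((Z + A * w) + B * w)                 ∎)
      where
      A = a * a
      B = z * z
      Z = (z * z) ^ j

    -- Multiplying z ^ 2j + a² w by a + d z, the terms starting with a have trace zero by `tr-a*`
    -- and d z a² w by `tr-da²*`; only d z ^ (2j + 1) remains.
    odd-power-trace : ∀ j → tr (x * (x * x) ^ j) K.≈ tr (d * (z * (z * z) ^ j))
    odd-power-trace j with square-power j
    ... | w , wa , wd , e = K.trans (tr-cong _ _ (trans (*-congˡ e) (distribʳ V a (d * z))))
      (K.trans (tr-+ (a * V) (d * z * V))
      (K.trans (K.+-congʳ (tr-a* V (commute-+ (commute-^ j (commute-* zd zd)) (commute-* a²-commutes-d wd))))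
      (K.trans (K.+-identityˡ _)
      (K.trans (tr-cong _ _ (distribˡ (d * z) Z (a * a * w)))
      (K.trans (tr-+ (d * z * Z) (d * z * (a * a * w)))
      (K.trans (K.+-congˡ (K.trans (tr-cong _ _ reorder) (tr-da²* (z * w) (commute-* za wa) (commute-* zd wd))))
      (K.trans (K.+-identityʳ _) (tr-cong _ _ (*-assoc d z Z)))))))))
      where
      Z = (z * z) ^ j
      V = Z + a * a * w
      reorder : d * z * (a * a * w) ≈ d * (a * a * (z * w))
      reorder = trans (*-assoc d z (a * a * w)) (*-congˡ (trans (sym (*-assoc z (a * a) w))
        (trans (*-congʳ (sym (commute-* {a} {a} {z} (sym za) (sym za)))) (*-assoc (a * a) z w))))

-- The matrix ring, traces and Kronecker products.

module MatrixAlgebra (R : CommutativeRing 0ℓ 0ℓ) where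
  private
    module R = CommutativeRing R
    module E = Determinant R
  open R using (Carrier; _≈_; _+_; _*_; -_; 0#; 1#)
  open SemiringSum R.semiring using (sum; ∑-comm; *-distribˡ-sum; *-distribʳ-sum; ∑-distrib-+)
  open MatrixOver R.rawRing using (I; _⊗_)
  open RingProperties R.ring using (-0#≈0#; -‿distribˡ-*)

  infix 4 _≈ᴹ_
  record _≈ᴹ_ {n} (A B : Matrix Carrier n) : Set where
    constructor entrywise
    field entry : ∀ i j → A i j ≈ B i j
  open _≈ᴹ_ public

  _∙ᴹ_ : ∀ {n} → Matrix Carrier n → Matrix Carrier n → Matrix Carrier n
  (A ∙ᴹ B) i k = sum (λ j → A i j * B j k)

  sum-neg : ∀ {n} (f : Fin n → Carrier) → sum (λ i → - f i) ≈ - sum f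
  sum-neg {zero}  f = R.sym -0#≈0#
  sum-neg {suc n} f = R.trans (R.+-congˡ (sum-neg (f ∘ suc))) (⁻¹-∙-comm (f zero) (sum (f ∘ suc)))
    where open AbelianGroupProperties R.+-abelianGroup using (⁻¹-∙-comm)

  sum-product : ∀ {n m} (f : Fin n → Carrier) (g : Fin m → Carrier) → sum (λ i → sum (λ j → f i * g j)) ≈ sum f * sum g
  sum-product f g = R.trans (E.sum-cong _ (λ i → f i * sum g) (λ i → R.sym (*-distribˡ-sum (f i) g))) (R.sym (*-distribʳ-sum (sum g) f))

  private
    ∙ᴹ-assoc : ∀ {n} (A B C : Matrix Carrier n) i l → ((A ∙ᴹ B) ∙ᴹ C) i l ≈ (A ∙ᴹ (B ∙ᴹ C)) i l
    ∙ᴹ-assoc A B C i l =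
      R.trans (E.sum-cong (λ k → sum (λ j → A i j * B j k) * C k l) (λ k → sum (λ j → A i j * (B j k * C k l)))
        (λ k → R.trans (*-distribʳ-sum (C k l) (λ j → A i j * B j k)) (E.sum-cong _ _ (λ j → R.*-assoc (A i j) (B j k) (C k l)))))
      (R.trans (∑-comm (λ k j → A i j * (B j k * C k l)))
        (E.sum-cong _ (λ j → A i j * (B ∙ᴹ C) j l) (λ j → R.sym (*-distribˡ-sum (A i j) (λ k → B j k * C k l)))))

  matrixRing : ℕ → Ring 0ℓ 0ℓ
  matrixRing n = record
    { Carrier = Matrix Carrier n ; _≈_ = _≈ᴹ_
    ; _+_ = λ A B i j → A i j + B i j ; _*_ = _∙ᴹ_ ; -_ = λ A i j → - A i j
    ; 0# = λ _ _ → 0# ; 1# = I n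
    ; isRing = record
      { +-isAbelianGroup = record
        { isGroup = record
          { isMonoid = record
            { isSemigroup = record
              { isMagma = record
                { isEquivalence = record
                  { refl  = entrywise (λ i j → R.refl)
                  ; sym   = λ e → entrywise (λ i j → R.sym (entry e i j))
                  ; trans = λ e f → entrywise (λ i j → R.trans (entry e i j) (entry f i j)) }
                ; ∙-cong = λ e f → entrywise (λ i j → R.+-cong (entry e i j) (entry f i j)) }
              ; assoc = λ A B C → entrywise (λ i j → R.+-assoc (A i j) (B i j) (C i j)) }
            ; identity = (λ A → entrywise (λ i j → R.+-identityˡ (A i j))) , (λ A → entrywise (λ i j → R.+-identityʳ (A i j))) }
          ; inverse = (λ A → entrywise (λ i j → R.-‿inverseˡ (A i j))) , (λ A → entrywise (λ i j → R.-‿inverseʳ (A i j)))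
          ; ⁻¹-cong = λ e → entrywise (λ i j → R.-‿cong (entry e i j)) }
        ; comm = λ A B → entrywise (λ i j → R.+-comm (A i j) (B i j)) }
      ; *-cong = λ e f → entrywise (λ i k → E.sum-cong _ _ (λ j → R.*-cong (entry e i j) (entry f j k)))
      ; *-assoc = λ A B C → entrywise (∙ᴹ-assoc A B C)
      ; *-identity = (λ A → entrywise (λ i k → sum-Iˡ i (λ j → A j k))) , (λ A → entrywise (λ i k → E.sum-I (A i) k))
      ; distrib = (λ A B C → entrywise (λ i k → R.trans (E.sum-cong _ _ (λ j → R.distribˡ (A i j) (B j k) (C j k)))
                    (∑-distrib-+ (λ j → A i j * B j k) (λ j → A i j * C j k))))
                , (λ A B C → entrywise (λ i k → R.trans (E.sum-cong _ _ (λ j → R.distribʳ (A j k) (B i j) (C i j)))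
                    (∑-distrib-+ (λ j → B i j * A j k) (λ j → C i j * A j k)))) } }
    where open CharacteristicPolynomial R using (sum-Iˡ)

  trace : ∀ {n} → Matrix Carrier n → Carrier
  trace A = sum (λ i → A i i)

  trace-cong : ∀ {n} (A B : Matrix Carrier n) → A ≈ᴹ B → trace A ≈ trace B
  trace-cong A B e = E.sum-cong _ _ (λ i → entry e i i)

  trace-comm : ∀ {n} (A B : Matrix Carrier n) → trace (A ∙ᴹ B) ≈ trace (B ∙ᴹ A)
  trace-comm A B = R.trans (∑-comm (λ i j → A i j * B j i)) (E.sum-cong _ (λ i → (B ∙ᴹ A) i i)
    (λ j → E.sum-cong (λ i → A i j * B j i) _ (λ i → R.*-comm (A i j) (B j i))))

  module Pow {n : ℕ} where
    open RawSemiringDefs (RawRing.rawSemiring (Ring.rawRing (matrixRing n))) public using (_^_)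
  open Pow using (_^_)

  -- The power with exponent 2j + 1, in the form that `odd-power-trace` speaks about.
  oddPower : ∀ {n} → Matrix Carrier n → ℕ → Matrix Carrier n
  oddPower A j = A ∙ᴹ ((A ∙ᴹ A) ^ j)

  powerEntry-^ : ∀ {n} (A : Matrix Carrier n) j → (λ i k → CharacteristicPolynomial.powerEntry R A i k (suc (double j))) ≈ᴹ oddPower A j
  powerEntry-^ {n} A j = *-congˡ {A} (even j)
    where
    open Ring (matrixRing n) using (*-congˡ; *-assoc)
    module M = Ring (matrixRing n)
    even : ∀ j → (λ i k → CharacteristicPolynomial.powerEntry R A i k (double j)) ≈ᴹ (A ∙ᴹ A) ^ j
    even zero    = M.refl
    even (suc j) = M.trans (*-congˡ {A} (*-congˡ {A} (even j))) (M.sym (*-assoc A A ((A ∙ᴹ A) ^ j)))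

  -- Kronecker products

  sum-↑ : ∀ m {k} (f : Fin (m ℕ.+ k) → Carrier) → sum f ≈ sum (λ i → f (i Fin.↑ˡ k)) + sum (λ j → f (m Fin.↑ʳ j))
  sum-↑ zero    f = R.sym (R.+-identityˡ _)
  sum-↑ (suc m) f = R.trans (R.+-congˡ (sum-↑ m (f ∘ suc))) (R.sym (R.+-assoc _ _ _))

  sum-combine : ∀ n {m} (f : Fin (n ℕ.* m) → Carrier) → sum f ≈ sum (λ i → sum (λ j → f (Fin.combine {n} i j)))
  sum-combine zero        f = R.refl
  sum-combine (suc n) {m} f = R.trans (sum-↑ m f) (R.+-congˡ (sum-combine n (λ i → f (m Fin.↑ʳ i))))

  sum-remQuot : ∀ n m (f : Fin n × Fin m → Carrier) → sum (λ x → f (Fin.remQuot {n} m x)) ≈ sum (λ i → sum (λ j → f (i , j)))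
  sum-remQuot n m f = R.trans (sum-combine n (λ x → f (Fin.remQuot {n} m x)))
    (E.sum-cong _ _ (λ i → E.sum-cong _ _ (λ j → R.reflexive (≡.cong f (Fin.remQuot-combine {n} {m} i j)))))

  module _ {n m : ℕ} where
    private
      module Mnm = Ring (matrixRing (n ℕ.* m))

    ⊗-cong : ∀ {A A′ : Matrix Carrier n} {B B′ : Matrix Carrier m} → A ≈ᴹ A′ → B ≈ᴹ B′ → A ⊗ B ≈ᴹ A′ ⊗ B′
    ⊗-cong e f = entrywise (λ x y → R.*-cong (entry e _ _) (entry f _ _))

    ⊗-∙ : ∀ (A C : Matrix Carrier n) (B D : Matrix Carrier m) → (A ⊗ B) ∙ᴹ (C ⊗ D) ≈ᴹ (A ∙ᴹ C) ⊗ (B ∙ᴹ D)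
    ⊗-∙ A C B D = entrywise (λ x y →
      let u , i = Fin.remQuot {n} m x
          v , k = Fin.remQuot {n} m y
      in R.trans (sum-remQuot n m (λ (w , j) → A u w * B i j * (C w v * D j k)))
        (R.trans (E.sum-cong _ (λ w → sum (λ j → (A u w * C w v) * (B i j * D j k))) (λ w → E.sum-cong _ _ (λ j →
          S.solve 4 (λ a b c d → a S.:* b S.:* (c S.:* d) S.:= (a S.:* c) S.:* (b S.:* d)) R.refl (A u w) (B i j) (C w v) (D j k))))
        (sum-product (λ w → A u w * C w v) (λ j → B i j * D j k))))
      where module S = IntegerSolver R

    ⊗-neg : ∀ (A : Matrix Carrier n) (B : Matrix Carrier m) → (λ i j → - A i j) ⊗ B ≈ᴹ (λ x y → - (A ⊗ B) x y)
    ⊗-neg A B = entrywise (λ x y → R.sym (-‿distribˡ-* _ _))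

    ⊗-I : I n ⊗ I m ≈ᴹ I (n ℕ.* m)
    ⊗-I = entrywise lemma
      where
      lemma : ∀ x y → (I n ⊗ I m) x y ≈ I (n ℕ.* m) x y
      lemma x y with x Fin.≟ y
      ... | yes ≡.refl = R.trans (R.*-cong (E.I-diagonal n (proj₁ (Fin.remQuot {n} m x))) (E.I-diagonal m (proj₂ (Fin.remQuot {n} m x)))) (R.*-identityˡ 1#)
      ... | no  x≢y    = off (proj₁ p Fin.≟ proj₁ q) (proj₂ p Fin.≟ proj₂ q)
        where
        p = Fin.remQuot {n} m x
        q = Fin.remQuot {n} m y
        off : Dec (proj₁ p ≡ proj₁ q) → Dec (proj₂ p ≡ proj₂ q) → I n (proj₁ p) (proj₁ q) * I m (proj₂ p) (proj₂ q) ≈ 0#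
        off (no ne) _        = R.trans (R.*-congʳ (E.I-off-diagonal n ne)) (R.zeroˡ _)
        off (yes _) (no ne)  = R.trans (R.*-congˡ (E.I-off-diagonal m ne)) (R.zeroʳ _)
        off (yes e) (yes e′) = contradiction (≡.trans (≡.sym (Fin.combine-remQuot {n} m x))
          (≡.trans (≡.cong₂ Fin.combine e e′) (Fin.combine-remQuot {n} m y))) x≢y

    trace-⊗ : ∀ (A : Matrix Carrier n) (B : Matrix Carrier m) → trace (A ⊗ B) ≈ trace A * trace B
    trace-⊗ A B = R.trans (sum-remQuot n m (λ (u , i) → A u u * B i i)) (sum-product (λ u → A u u) (λ i → B i i))

    ⊗-^ : ∀ (A : Matrix Carrier n) (B : Matrix Carrier m) j → (A ⊗ B) ^ j ≈ᴹ (A ^ j) ⊗ (B ^ j)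
    ⊗-^ A B zero    = Mnm.sym ⊗-I
    ⊗-^ A B (suc j) = Mnm.trans (Mnm.*-congˡ {A ⊗ B} (⊗-^ A B j)) (⊗-∙ A (A ^ j) B (B ^ j))

    oddPower-⊗ : ∀ (A : Matrix Carrier n) (B : Matrix Carrier m) j → oddPower (A ⊗ B) j ≈ᴹ oddPower A j ⊗ oddPower B j
    oddPower-⊗ A B j = Mnm.trans (Mnm.*-congˡ {A ⊗ B} (Mnm.trans (^-congᴹ j (⊗-∙ A A B B)) (⊗-^ (A ∙ᴹ A) (B ∙ᴹ B) j)))
      (⊗-∙ A ((A ∙ᴹ A) ^ j) B ((B ∙ᴹ B) ^ j))
      where
      ^-congᴹ : ∀ {A B : Matrix Carrier (n ℕ.* m)} j → A ≈ᴹ B → A ^ j ≈ᴹ B ^ j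
      ^-congᴹ zero    e = Mnm.refl
      ^-congᴹ (suc j) e = Mnm.*-cong e (^-congᴹ j e)

-- Positive functionals over ℚ.

open Moments ℚ-ring
open Orthogonality ℚ-ring
open Reflection ℚ-ring
module Pℚ = CommutativeRing polynomialRing
module ℝᴾ = Moments ℝ-ring

Positive : (ℕ → ℚ) → Set
Positive t = ∀ f → 0ℚ ℚ.≤ pair t f f

private
  pair-square : ∀ t s f g → pair t (s ∙ f +ᴾ g) (s ∙ f +ᴾ g) ≡
    s ℚ.* (s ℚ.* pair t f f) ℚ.+ (s ℚ.* pair t f g ℚ.+ s ℚ.* pair t f g) ℚ.+ pair t g g
  pair-square t s f g = ≡.trans (pair-+ˡ t (s ∙ f) g (s ∙ f +ᴾ g)) (≡.trans
    (≡.cong₂ ℚ._+_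
      (≡.trans (pair-∙ˡ t s f (s ∙ f +ᴾ g)) (≡.cong (s ℚ.*_) (≡.trans (pair-+ʳ t f (s ∙ f) g) (≡.cong (ℚ._+ pair t f g) (pair-∙ʳ t s f f)))))
      (≡.trans (pair-+ʳ t g (s ∙ f) g) (≡.cong (ℚ._+ pair t g g) (≡.trans (pair-∙ʳ t s g f) (≡.cong (s ℚ.*_) (pair-comm t g f))))))
    (ℚS.solve 4 (λ s a b c → s ℚS.:* (s ℚS.:* a ℚS.:+ b) ℚS.:+ (s ℚS.:* b ℚS.:+ c) ℚS.:= s ℚS.:* (s ℚS.:* a) ℚS.:+ (s ℚS.:* b ℚS.:+ s ℚS.:* b) ℚS.:+ c)
      ≡.refl s (pair t f f) (pair t f g) (pair t g g)))

  linear-nonneg⇒0 : ∀ b d → (∀ s → 0ℚ ℚ.≤ (s ℚ.* b ℚ.+ s ℚ.* b) ℚ.+ d) → b ≡ 0ℚ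
  linear-nonneg⇒0 b d h with b ℚ.≟ 0ℚ
  ... | yes b≡0 = b≡0
  ... | no  b≢0 = ⊥-elim (ℚ.<-irrefl ≡.refl (ℚ.≤-<-trans (≡.subst (0ℚ ℚ.≤_) value (h s)) (ℚ.neg-antimono-< (ℚ.positive⁻¹ 1ℚ))))
    where
    i = proj₁ (ℚ-inverse b b≢0)
    -- Chosen so that s b = - e and the supposedly non-negative value becomes d - (d + 1) = - 1.
    e = ½ ℚ.* (d ℚ.+ 1ℚ)
    s = ℚ.- (e ℚ.* i)
    sb : s ℚ.* b ≡ ℚ.- e
    sb = ≡.trans (ℚS.solve 3 (λ e i b → (ℚS.:- (e ℚS.:* i)) ℚS.:* b ℚS.:= ℚS.:- (e ℚS.:* (b ℚS.:* i))) ≡.refl e i b)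
      (≡.cong ℚ.-_ (≡.trans (≡.cong (e ℚ.*_) (proj₂ (ℚ-inverse b b≢0))) (ℚ.*-identityʳ e)))
    value : (s ℚ.* b ℚ.+ s ℚ.* b) ℚ.+ d ≡ ℚ.- 1ℚ
    value = ≡.trans (≡.cong (λ z → (z ℚ.+ z) ℚ.+ d) sb) (≡.trans (ℚS.solve 2 (λ e d → (ℚS.:- e ℚS.:+ ℚS.:- e) ℚS.:+ d ℚS.:= d ℚS.:- (e ℚS.:+ e)) ≡.refl e d)
      (≡.trans (≡.cong (λ z → d ℚ.- z) (½+½ (d ℚ.+ 1ℚ))) (ℚS.solve 2 (λ d o → d ℚS.:- (d ℚS.:+ o) ℚS.:= ℚS.:- o) ≡.refl d 1ℚ)))

-- The degenerate case of the Cauchy-Schwarz inequality: t ((s f + g)²) loses its quadratic term in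
-- s, and a linear function of s that is never negative has slope zero.
isotropic⇒annihilates : ∀ {t} → Positive t → ∀ f → pair t f f ≡ 0ℚ → Annihilates f t
isotropic⇒annihilates {t} pos f ff≡0 = orthogonal⇒annihilates t f (λ g → linear-nonneg⇒0 (pair t f g) (pair t g g)
  (λ s → ≡.subst (0ℚ ℚ.≤_) (≡.trans (pair-square t s f g) (simplify s g)) (pos (s ∙ f +ᴾ g))))
  where
  simplify : ∀ s g → s ℚ.* (s ℚ.* pair t f f) ℚ.+ (s ℚ.* pair t f g ℚ.+ s ℚ.* pair t f g) ℚ.+ pair t g g ≡
             (s ℚ.* pair t f g ℚ.+ s ℚ.* pair t f g) ℚ.+ pair t g g
  simplify s g = ≡.trans (≡.cong (λ z → s ℚ.* (s ℚ.* z) ℚ.+ (s ℚ.* pair t f g ℚ.+ s ℚ.* pair t f g) ℚ.+ pair t g g) ff≡0)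
    (ℚS.solve 3 (λ s b c → s ℚS.:* (s ℚS.:* ℚS.:0) ℚS.:+ (s ℚS.:* b ℚS.:+ s ℚS.:* b) ℚS.:+ c ℚS.:= (s ℚS.:* b ℚS.:+ s ℚS.:* b) ℚS.:+ c)
      ≡.refl s (pair t f g) (pair t g g))

-- Minimal polynomials

record Ideal (J : Poly → Set) : Set where
  field
    J-cong : ∀ {f g} → f ≋ g → J f → J g
    J-+    : ∀ f g → J f → J g → J (f +ᴾ g)
    J-*    : ∀ f g → J g → J (f *ᴾ g)

record Generator (J : Poly → Set) : Set where
  field
    degree    : ℕ
    generator : Poly
    is-monic  : Monic degree generator
    member    : J generator
    minimal   : ∀ f → J f → Below degree f → f ≋ []

≋[]-stable : ∀ f → ¬ ¬ f ≋ [] → f ≋ []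
≋[]-stable f h = ⟨ (λ n → stable n (coeff f n ℚ.≟ 0ℚ)) ⟩
  where
  stable : ∀ n → Dec (coeff f n ≡ 0ℚ) → coeff f n ≡ 0ℚ
  stable n (yes e) = e
  stable n (no ne) = contradiction (λ e → ne (at e n)) h

-- The ideal may be defined by a real root, so whether it has an element of smaller degree is not
-- decidable. Under double negation either the normalised f is minimal or some non-zero element
-- satisfies a smaller bound, and the bound N cannot descend forever.
generator-exists : ∀ {J} → Ideal J → ∀ N f → J f → Below N f → ¬ f ≋ [] → ¬ ¬ Generator J
generator-exists {J} ideal zero    f Jf b f≢0 none = f≢0 (below-0⇒≋[] b)
generator-exists {J} ideal (suc N) f Jf b f≢0 none = case (coeff f N ℚ.≟ 0ℚ)
  where
  open Ideal ideal
  case : Dec (coeff f N ≡ 0ℚ) → ⊥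
  case (yes e) = generator-exists ideal N f Jf (below-step b e) f≢0 none
  case (no ne) = none (record
    { degree    = N
    ; generator = i ∙ f
    ; is-monic  = monic (below-∙ {suc N} {i} {f} b) (≡.trans (coeff-∙ i f N) (≡.trans (ℚ.*-comm i (coeff f N)) (proj₂ (ℚ-inverse (coeff f N) ne))))
    ; member    = J-cong (const-* i f) (J-* (constᴾ i) f Jf)
    ; minimal   = λ g Jg bg → ≋[]-stable g (λ g≢0 → generator-exists ideal N g Jg bg g≢0 none) })
    where i = proj₁ (ℚ-inverse (coeff f N) ne)

module _ {J} (ideal : Ideal J) (gen : Generator J) where
  open Ideal ideal
  open Generator gen

  generator-divides : ∀ f → J f → ∃[ h ] f ≋ generator *ᴾ h
  generator-divides f Jf = quotient , Pℚ.trans division-≋ (Pℚ.trans (Pℚ.+-congˡ {generator *ᴾ quotient} r≋[]) (Pℚ.+-identityʳ _))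
    where
    open Division (divide is-monic f)
    open IntegerSolver polynomialRing
    r≋ : f +ᴾ (-ᴾ quotient) *ᴾ generator ≋ remainder
    r≋ = Pℚ.trans (Pℚ.+-congʳ {(-ᴾ quotient) *ᴾ generator} division-≋)
      (solve 3 (λ c q r → (c :* q :+ r) :+ (:- q) :* c := r) Pℚ.refl generator quotient remainder)
    r≋[] : remainder ≋ []
    r≋[] = minimal remainder (J-cong r≋ (J-+ f ((-ᴾ quotient) *ᴾ generator) Jf (J-* (-ᴾ quotient) generator member))) remainder-below

annihilator-ideal : ∀ t → Ideal (λ f → Annihilates f t)
annihilator-ideal t = record
  { J-cong = annihilates-cong t
  ; J-+    = λ f g zf zg k → ≡.trans (•-+ f g t k) (≡.trans (≡.cong₂ ℚ._+_ (zf k) (zg k)) (ℚ.+-identityˡ 0ℚ))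
  ; J-*    = λ f g → annihilates-* f g t }

-- A real root of a polynomial annihilating a positive functional

fromℚ-cong : ∀ x y → x ≡ y → fromℚ x ≃ fromℚ y
fromℚ-cong x y e = ≗⇒≃ (fromℚ x) (fromℚ y) (λ _ → e)

fromℚ-+ : ∀ x y → fromℚ (x ℚ.+ y) ≃ fromℚ x +ᴿ fromℚ y
fromℚ-+ x y = ≗⇒≃ (fromℚ (x ℚ.+ y)) (fromℚ x +ᴿ fromℚ y) (λ _ → ≡.refl)

fromℚ-* : ∀ x y → fromℚ (x ℚ.* y) ≃ fromℚ x *ᴿ fromℚ y
fromℚ-* x y = ≗⇒≃ (fromℚ (x ℚ.* y)) (fromℚ x *ᴿ fromℚ y) (λ _ → ≡.refl)

fromℚ-neg : ∀ x → fromℚ (ℚ.- x) ≃ -ᴿ fromℚ x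
fromℚ-neg x = ≗⇒≃ (fromℚ (ℚ.- x)) (-ᴿ fromℚ x) (λ _ → ≡.refl)

fromℚ-0 : fromℚ 0ℚ ≃ fromℚ 0ℚ
fromℚ-0 = ≗⇒≃ (fromℚ 0ℚ) (fromℚ 0ℚ) (λ _ → ≡.refl)

open PolynomialMap ℚ-ring ℝ-ring fromℚ fromℚ-cong fromℚ-+ fromℚ-* fromℚ-neg fromℚ-0
open EvalThreeTerm ℚ-ring ℝ-ring fromℚ fromℚ-neg fromℚ-0 fromℚ-* fromℚ-cong fromℚ-+

evalᴿ : Poly → ℝ → ℝ
evalᴿ f r = ℝᴾ.eval (mapᴾ f) r

finalPoly : Poly → Poly → Coefficients → Poly
finalPoly prev cur []             = cur
finalPoly prev cur ((α , β) ∷ cs) = finalPoly cur (three-term α β prev cur) cs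

lastValue-cong : ∀ r U U′ V V′ cs → U ≃ U′ → V ≃ V′ → lastValue r U V cs ≃ lastValue r U′ V′ cs
lastValue-cong r U U′ V V′ []             eU eV = eV
lastValue-cong r U U′ V V′ ((α , β) ∷ cs) eU eV = lastValue-cong r V V′ (next r α β U V) (next r α β U′ V′) cs eV
  (next-cong {r} {r} {U} {U′} {V} {V′} α β (≗⇒≃ r r (λ _ → ≡.refl)) eU eV)

evalᴿ-finalPoly : ∀ r prev cur cs → evalᴿ (finalPoly prev cur cs) r ≃ lastValue r (evalᴿ prev r) (evalᴿ cur r) cs
evalᴿ-finalPoly r prev cur []             = ≗⇒≃ (evalᴿ cur r) (evalᴿ cur r) (λ _ → ≡.refl)
evalᴿ-finalPoly r prev cur ((α , β) ∷ cs) =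
  ≃-trans (evalᴿ (finalPoly cur new cs) r) (lastValue r (evalᴿ cur r) (evalᴿ new r) cs)
          (lastValue r (evalᴿ cur r) (next r α β (evalᴿ prev r) (evalᴿ cur r)) cs)
    (evalᴿ-finalPoly r cur new cs)
    (lastValue-cong r (evalᴿ cur r) (evalᴿ cur r) (evalᴿ new r) (next r α β (evalᴿ prev r) (evalᴿ cur r)) cs
      (≗⇒≃ (evalᴿ cur r) (evalᴿ cur r) (λ _ → ≡.refl))
      (≃-trans (evalᴿ new r) (nextExpression r α β (evalᴿ prev r) (evalᴿ cur r)) (next r α β (evalᴿ prev r) (evalᴿ cur r))
        (eval-three-term α β prev cur r)
        (≃-sym (next r α β (evalᴿ prev r) (evalᴿ cur r)) (nextExpression r α β (evalᴿ prev r) (evalᴿ cur r))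
          (next≃ r α β (evalᴿ prev r) (evalᴿ cur r)))))
  where new = three-term α β prev cur

root-of-finalPoly : ∀ r cs → lastValue r (fromℚ 0ℚ) (fromℚ 1ℚ) cs ≃ fromℚ 0ℚ → evalᴿ (finalPoly [] (constᴾ 1ℚ) cs) r ≃ fromℚ 0ℚ
root-of-finalPoly r cs e =
  ≃-trans (evalᴿ (finalPoly [] (constᴾ 1ℚ) cs) r) (lastValue r (evalᴿ [] r) (evalᴿ (constᴾ 1ℚ) r) cs) (fromℚ 0ℚ)
    (evalᴿ-finalPoly r [] (constᴾ 1ℚ) cs)
    (≃-trans (lastValue r (evalᴿ [] r) (evalᴿ (constᴾ 1ℚ) r) cs) (lastValue r (fromℚ 0ℚ) (fromℚ 1ℚ) cs) (fromℚ 0ℚ)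
      (lastValue-cong r (evalᴿ [] r) (fromℚ 0ℚ) (evalᴿ (constᴾ 1ℚ) r) (fromℚ 1ℚ) cs fromℚ-0
        (≗⇒≃ (evalᴿ (constᴾ 1ℚ) r) (fromℚ 1ℚ) (λ n → ≡.trans (≡.cong (1ℚ ℚ.+_) (ℚ.*-zeroʳ (seq r n))) (ℚ.+-identityʳ 1ℚ))))
      e)

root-of-multiple : ∀ c q h r → c ≋ q *ᴾ h → evalᴿ q r ≃ fromℚ 0ℚ → evalᴿ c r ≃ fromℚ 0ℚ
root-of-multiple c q h r c≋ e =
  ≃-trans (evalᴿ c r) (ℝᴾ.eval (mapᴾ q ℝᴾ.*ᴾ mapᴾ h) r) (fromℚ 0ℚ)
    (ℝᴾ.eval-cong (mapᴾ c) (mapᴾ q ℝᴾ.*ᴾ mapᴾ h) r (ℝᴾ.≋-trans (map-cong c (q *ᴾ h) c≋) (map-* q h)))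
    (≃-trans (ℝᴾ.eval (mapᴾ q ℝᴾ.*ᴾ mapᴾ h) r) (evalᴿ q r *ᴿ evalᴿ h r) (fromℚ 0ℚ) (ℝᴾ.eval-* (mapᴾ q) (mapᴾ h) r)
    (≃-trans (evalᴿ q r *ᴿ evalᴿ h r) (fromℚ 0ℚ *ᴿ evalᴿ h r) (fromℚ 0ℚ)
      (ℝR.*-congʳ {evalᴿ h r} {evalᴿ q r} {fromℚ 0ℚ} e) (ℝR.zeroˡ (evalᴿ h r))))

module _ {t : ℕ → ℚ} (pos : Positive t) {N : ℕ} {c : Poly} (c-monic : Monic N c) (c•t≈0 : Annihilates c t) where

  -- The orthogonal sequence stops at its first polynomial of norm zero, which generates the
  -- annihilator of t. The first pair of coefficients is kept apart because `recurrence-root` needs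
  -- at least one step.
  record Termination (prev cur : Poly) : Set where
    field
      coefficient  : ℚ × ℚ
      coefficients : Coefficients
      positive     : PositiveRecurrence (coefficient ∷ coefficients)
      final-degree : ℕ
      final-monic  : Monic final-degree (finalPoly prev cur (coefficient ∷ coefficients))
      final-zero   : Annihilates (finalPoly prev cur (coefficient ∷ coefficients)) t
      definite     : ∀ f → Below final-degree f → Annihilates f t → f ≋ []

  ≢0⇒>0 : ∀ f → pair t f f ≢ 0ℚ → 0ℚ ℚ.< pair t f f
  ≢0⇒>0 f ne = ℚ.≰⇒> (λ le → ne (ℚ.≤-antisym le (pos f)))

  -- Here j counts the degrees left below that of c. As long as norms are non-zero they are
  -- positive, which makes every β, a quotient of consecutive norms, positive.
  terminate : ∀ j k prev cur β → suc k ℕ.+ j ≡ N → 0ℚ ℚ.< β → Stage t k prev cur β → pair t cur cur ≢ 0ℚ → Termination prev cur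
  terminate j k prev cur β eq 0<β stage ne = case (pair t new new ℚ.≟ 0ℚ) j eq
    where
    n = pair t cur cur
    inv = ℚ-pos-inverse (≢0⇒>0 cur ne)
    i = proj₁ inv
    α = pair t (X· cur) cur ℚ.* i
    new = three-term α β prev cur
    β′ = pair t new new ℚ.* i
    stage′ : Stage t (suc k) cur new β′
    stage′ = next-stage i stage (proj₂ (proj₂ inv))
    case : Dec (pair t new new ≡ 0ℚ) → ∀ j → suc k ℕ.+ j ≡ N → Termination prev cur
    case (yes e) _ _ = record
      { coefficient  = α , β
      ; coefficients = []
      ; positive     = 0<β ∷ []
      ; final-degree = suc k
      ; final-monic  = Stage.cur-monic stage′
      ; final-zero   = isotropic⇒annihilates pos new e
      ; definite     = Stage.definite stage′ }
    -- The degree of c is reached, and there `stage-isotropic` makes the norm vanish.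
    case (no ne′) zero    eq = contradiction (stage-isotropic stage′
      (≡.subst (λ d → Monic d c) (≡.trans (≡.sym eq) (ℕ.+-identityʳ (suc k))) c-monic) c•t≈0) ne′
    case (no ne′) (suc j) eq = record
      { coefficient  = α , β
      ; coefficients = T.coefficient ∷ T.coefficients
      ; positive     = 0<β ∷ T.positive
      ; final-degree = T.final-degree
      ; final-monic  = T.final-monic
      ; final-zero   = T.final-zero
      ; definite     = T.definite }
      where module T = Termination (terminate j (suc k) cur new β′ (≡.trans (≡.sym (ℕ.+-suc (suc k) j)) eq)
                         (ℚ-*-pos (≢0⇒>0 new ne′) (proj₁ (proj₂ inv))) stage′ ne′)

  root-from-termination : Termination [] (constᴾ 1ℚ) → ∃[ r ] evalᴿ c r ≃ fromℚ 0ℚ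
  root-from-termination termination = finish (recurrence-root coefficient coefficients positive)
    where
    open Termination termination
    gen : Generator (λ f → Annihilates f t)
    gen = record { degree = final-degree ; generator = finalPoly [] (constᴾ 1ℚ) (coefficient ∷ coefficients)
                 ; is-monic = final-monic ; member = final-zero ; minimal = λ f z b → definite f b z }
    quotient : ∃[ h ] c ≋ finalPoly [] (constᴾ 1ℚ) (coefficient ∷ coefficients) *ᴾ h
    quotient = generator-divides (annihilator-ideal t) gen c c•t≈0
    finish : ∃[ r ] lastValue r (fromℚ 0ℚ) (fromℚ 1ℚ) (coefficient ∷ coefficients) ≃ fromℚ 0ℚ → ∃[ r ] evalᴿ c r ≃ fromℚ 0ℚ
    finish (r , last≃0) = r , root-of-multiple c (finalPoly [] (constᴾ 1ℚ) (coefficient ∷ coefficients)) (proj₁ quotient) r (proj₂ quotient)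
      (root-of-finalPoly r (coefficient ∷ coefficients) last≃0)

  real-root : t 0 ≢ 0ℚ → ∃[ r ] evalᴿ c r ≃ fromℚ 0ℚ
  -- The initial β multiplies the zero polynomial; the value 1 keeps the recurrence positive.
  real-root t0≢0 = root-from-termination (terminate (proj₁ positive-degree) 0 [] (constᴾ 1ℚ) 1ℚ (proj₂ positive-degree)
    (ℚ.positive⁻¹ 1ℚ) stage₀ (λ e → t0≢0 (≡.trans (≡.sym pair-1) e)))
    where
    pair-1 : pair t (constᴾ 1ℚ) (constᴾ 1ℚ) ≡ t 0
    pair-1 = ≡.trans (•-cong (constᴾ 1ℚ *ᴾ constᴾ 1ℚ) (constᴾ 1ℚ) t 0 (Pℚ.*-identityˡ (constᴾ 1ℚ)))
      (≡.trans (ℚ.+-identityʳ (1ℚ ℚ.* t 0)) (ℚ.*-identityˡ (t 0)))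
    stage₀ : Stage t 0 [] (constᴾ 1ℚ) 1ℚ
    stage₀ = initial-stage t 1ℚ
    degree : ∀ N → Monic N c → ∃[ N′ ] suc 0 ℕ.+ N′ ≡ N
    degree zero    mc = contradiction (≡.trans (≡.sym pair-1) (stage-isotropic stage₀ mc c•t≈0)) t0≢0
    degree (suc N) mc = N , ≡.refl
    positive-degree : ∃[ N′ ] suc 0 ℕ.+ N′ ≡ N
    positive-degree = degree N c-monic

-- Symmetric multiplicities force the odd moments to vanish.

module ℝᴹ = Multiplicity ℝ-ring ℝ-domain

HasMultiplicityᴿ : Poly → ℝ → ℕ → Set
HasMultiplicityᴿ f = Polynomial.HasMultiplicity ℝ-rawRing (mapᴾ f)

monic≢[] : ∀ {d f} → Monic d f → ¬ f ≋ []
monic≢[] {d} mf e = ℚ.<⇒≢ (ℚ.positive⁻¹ 1ℚ) (≡.trans (≡.sym (at e d)) (monic-top mf))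

degree-1+ : ∀ {d c} → Monic d c → (Monic 0 c → ⊥) → ∃[ d′ ] d ≡ suc d′
degree-1+ {zero}  mc h = ⊥-elim (h mc)
degree-1+ {suc d} mc h = d , ≡.refl

module _ {t : ℕ → ℚ} (pos : Positive t) where

  positive-alternate : Positive (alternate t)
  positive-alternate f = ≡.subst (0ℚ ℚ.≤_) (≡.sym (pair-alternate t f)) (pos (reflect f))

  pair-even : ∀ f → pair (even t) f f ≡ pair (alternate t) f f ℚ.+ pair t f f
  pair-even f = ≡.trans (•-linear (f *ᴾ f) 1ℚ (alternate t) t 0) (≡.cong (ℚ._+ pair t f f) (ℚ.*-identityˡ (pair (alternate t) f f)))

  positive-even : Positive (even t)
  positive-even f = ≡.subst (0ℚ ℚ.≤_) (≡.sym (pair-even f)) (ℚ-+-nonneg (positive-alternate f) (pos f))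

  -- The value of `even t` at f² is a sum of two non-negative numbers, so if it is zero then f is
  -- isotropic for both t and `alternate t`.
  annihilates-even : ∀ f → Annihilates f (even t) → Annihilates f t × Annihilates f (alternate t)
  annihilates-even f z = isotropic⇒annihilates pos f (zeroʳ (positive-alternate f) (pos f) sum≡0)
                       , isotropic⇒annihilates positive-alternate f (zeroʳ (pos f) (positive-alternate f) (≡.trans (ℚ.+-comm (pair t f f) (pair (alternate t) f f)) sum≡0))
    where
    sum≡0 : pair (alternate t) f f ℚ.+ pair t f f ≡ 0ℚ
    sum≡0 = ≡.trans (≡.sym (pair-even f)) (pair-annihilated (even t) f f z)
    zeroʳ : ∀ {a b} → 0ℚ ℚ.≤ a → 0ℚ ℚ.≤ b → a ℚ.+ b ≡ 0ℚ → b ≡ 0ℚ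
    zeroʳ {a} {b} 0≤a 0≤b e = ℚ.≤-antisym (≡.subst₂ ℚ._≤_ (ℚ.+-identityˡ b) e (ℚ.+-monoˡ-≤ b 0≤a)) 0≤b

  positive-scaled : ∀ h → Positive ((h *ᴾ h) • t)
  positive-scaled h f = ≡.subst (0ℚ ℚ.≤_) (≡.sym (pair-scaled t h f f)) (pos (h *ᴾ f))

root-ideal : ∀ r → Ideal (λ f → evalᴿ f r ≃ fromℚ 0ℚ)
root-ideal r = record
  { J-cong = λ {f} {g} e z → ≃-trans (evalᴿ g r) (evalᴿ f r) (fromℚ 0ℚ)
      (ℝᴾ.eval-cong (mapᴾ g) (mapᴾ f) r (map-cong g f (Pℚ.sym e))) z
  ; J-+ = λ f g zf zg → ≃-trans (evalᴿ (f +ᴾ g) r) (ℝᴾ.eval (mapᴾ f ℝᴾ.+ᴾ mapᴾ g) r) (fromℚ 0ℚ)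
      (ℝᴾ.eval-cong (mapᴾ (f +ᴾ g)) (mapᴾ f ℝᴾ.+ᴾ mapᴾ g) r (map-+ f g))
      (≃-trans (ℝᴾ.eval (mapᴾ f ℝᴾ.+ᴾ mapᴾ g) r) (evalᴿ f r +ᴿ evalᴿ g r) (fromℚ 0ℚ) (ℝᴾ.eval-+ (mapᴾ f) (mapᴾ g) r)
      (≃-trans (evalᴿ f r +ᴿ evalᴿ g r) (fromℚ 0ℚ +ᴿ fromℚ 0ℚ) (fromℚ 0ℚ)
        (ℝR.+-cong {evalᴿ f r} {fromℚ 0ℚ} {evalᴿ g r} {fromℚ 0ℚ} zf zg) (ℝR.+-identityˡ (fromℚ 0ℚ))))
  ; J-* = λ f g zg → root-of-multiple (f *ᴾ g) g f r (Pℚ.*-comm f g) zg }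

module _ {n : ℕ} {p : Poly} {t : ℕ → ℚ} (p-monic : Monic n p) (p•t≈0 : Annihilates p t)
  (newton : deriv p ≋ quotientMoment t p) (pos : Positive t)
  (symmetric : ∀ x k → HasMultiplicityᴿ p x k → HasMultiplicityᴿ p (-ᴿ x) k) where

  private
    product = p *ᴾ reflect p

    product≢[] : ¬ product ≋ []
    product≢[] e = monic≢[] p-monic (Pℚ.trans (Pℚ.sym (reflect-involutive p)) (reflect-cong (reflect p) [] (monic-cancel p-monic (reflect p) e)))

    product-even : Annihilates product (even t)
    product-even = annihilates-combination 1ℚ product (alternate t) t (product-annihilates-alternate p t p•t≈0) (product-annihilates p t p•t≈0)

    product-odd : Annihilates product (odd t)
    product-odd = annihilates-combination (ℚ.- 1ℚ) product (alternate t) t (product-annihilates-alternate p t p•t≈0) (product-annihilates p t p•t≈0)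

    monic-0⇒odd≡0 : ∀ c → Monic 0 c → Annihilates c (odd t) → ∀ k → odd t k ≡ 0ℚ
    monic-0⇒odd≡0 c mc z k = ≡.trans (≡.sym (≡.trans (ℚ.+-identityʳ (1ℚ ℚ.* odd t k)) (ℚ.*-identityˡ (odd t k))))
      (annihilates-cong (odd t) (monic-0 mc) z k)

    -- Writing the minimal polynomial of the even part as c h, the functional
    -- f ↦ even t (h² f) is positive, non-zero and annihilated by c.
    odd-root : (μ : Generator (λ f → Annihilates f (even t))) (c : Generator (λ f → Annihilates f (odd t))) →
               (∃[ k ] odd t k ≢ 0ℚ) → ∃[ r ] evalᴿ (Generator.generator c) r ≃ fromℚ 0ℚ
    odd-root μ c (k , odd≢0) = real-root (positive-scaled (positive-even pos) h) C.is-monic c•T≈0 T0≢0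
      where
      module μ = Generator μ
      module C = Generator c
      annihilates : Annihilates μ.generator t × Annihilates μ.generator (alternate t)
      annihilates = annihilates-even pos μ.generator μ.member
      quotient : ∃[ h ] μ.generator ≋ C.generator *ᴾ h
      quotient = generator-divides (annihilator-ideal (odd t)) c μ.generator
        (annihilates-combination (ℚ.- 1ℚ) μ.generator (alternate t) t (proj₂ annihilates) (proj₁ annihilates))
      h = proj₁ quotient
      positive-degree : ∃[ d ] C.degree ≡ suc d
      positive-degree = degree-1+ C.is-monic (λ mc → odd≢0 (monic-0⇒odd≡0 C.generator mc C.member k))
      h-below : Below μ.degree h
      h-below = monic-*-below C.is-monic h (below-cong (proj₂ quotient) (below-weaken
        (≡.subst (λ d → suc μ.degree ℕ.≤ d ℕ.+ μ.degree) (≡.sym (proj₂ positive-degree)) (s≤s (ℕ.m≤n+m μ.degree (proj₁ positive-degree))))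
        (monic-below μ.is-monic)))
      h≢[] : ¬ h ≋ []
      h≢[] e = monic≢[] μ.is-monic (Pℚ.trans (proj₂ quotient) (Pℚ.trans (Pℚ.*-congˡ {C.generator} e) (Pℚ.zeroʳ C.generator)))
      -- Otherwise h is isotropic for `even t` and annihilates it. But h has smaller degree than the
      -- minimal polynomial c h, since c is not constant.
      T0≢0 : ((h *ᴾ h) • even t) 0 ≢ 0ℚ
      T0≢0 e = h≢[] (μ.minimal h (isotropic⇒annihilates (positive-even pos) h e) h-below)
      c•T≈0 : Annihilates C.generator ((h *ᴾ h) • even t)
      c•T≈0 j = ≡.trans (≡.sym (•-* C.generator (h *ᴾ h) (even t) j))
        (annihilates-cong (even t) (rearrange C.generator h (proj₂ quotient)) (annihilates-* h μ.generator (even t) μ.member) j)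
        where
        rearrange : ∀ c h → μ.generator ≋ c *ᴾ h → h *ᴾ μ.generator ≋ c *ᴾ (h *ᴾ h)
        rearrange c h e = Pℚ.trans (Pℚ.*-congˡ {h} e) (Pℚ.trans (Pℚ.*-comm h (c *ᴾ h)) (Pℚ.*-assoc c h h))

    wronskianᴿ : ∀ c → Annihilates c (odd t) →
      mapᴾ c ℝᴾ.*ᴾ (ℝᴾ.reflect (mapᴾ p) ℝᴾ.*ᴾ ℝᴾ.deriv (mapᴾ p) ℝᴾ.+ᴾ ℝᴾ.-ᴾ (mapᴾ p ℝᴾ.*ᴾ ℝᴾ.deriv (ℝᴾ.reflect (mapᴾ p)))) ℝᴾ.≋
      mapᴾ p ℝᴾ.*ᴾ ℝᴾ.reflect (mapᴾ p) ℝᴾ.*ᴾ mapᴾ (quotientMoment (odd t) c)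
    wronskianᴿ c z = PS.trans (PS.sym left) (PS.trans (map-cong (c *ᴾ W) (p *ᴾ reflect p *ᴾ u) (wronskian-identity p t p•t≈0 newton z)) right)
      where
      module PS = CommutativeRing ℝᴾ.polynomialRing
      u = quotientMoment (odd t) c
      p⁻ = reflect p
      W = p⁻ *ᴾ deriv p +ᴾ -ᴾ (p *ᴾ deriv p⁻)
      P = mapᴾ p
      P⁻ = ℝᴾ.reflect P
      p⁻≋ : mapᴾ p⁻ ℝᴾ.≋ P⁻
      p⁻≋ = map-reflect p
      left : mapᴾ (c *ᴾ W) ℝᴾ.≋ mapᴾ c ℝᴾ.*ᴾ (P⁻ ℝᴾ.*ᴾ ℝᴾ.deriv P ℝᴾ.+ᴾ ℝᴾ.-ᴾ (P ℝᴾ.*ᴾ ℝᴾ.deriv P⁻))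
      left = PS.trans (map-* c W) (PS.*-congˡ {mapᴾ c} (PS.trans (map-+ (p⁻ *ᴾ deriv p) (-ᴾ (p *ᴾ deriv p⁻))) (PS.+-cong
        (PS.trans (map-* p⁻ (deriv p)) (PS.*-cong p⁻≋ (map-deriv p)))
        (PS.trans (map-neg (p *ᴾ deriv p⁻)) (PS.-‿cong (PS.trans (map-* p (deriv p⁻)) (PS.*-congˡ {P}
          (PS.trans (map-deriv p⁻) (ℝᴾ.deriv-cong (mapᴾ p⁻) P⁻ p⁻≋)))))))))
      right : mapᴾ (p *ᴾ p⁻ *ᴾ u) ℝᴾ.≋ P ℝᴾ.*ᴾ P⁻ ℝᴾ.*ᴾ mapᴾ u
      right = PS.trans (map-* (p *ᴾ p⁻) u) (PS.*-congʳ {mapᴾ u} (PS.trans (map-* p p⁻) (PS.*-congˡ {P} p⁻≋)))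

    pᴿ≢[] : ¬ mapᴾ p ℝᴾ.≋ []
    pᴿ≢[] e = 1≄0 (≃-trans (fromℚ 1ℚ) (fromℚ (coeff p n)) (fromℚ 0ℚ) (fromℚ-cong 1ℚ (coeff p n) (≡.sym (monic-top p-monic)))
      (≃-trans (fromℚ (coeff p n)) (ℝᴾ.coeff (mapᴾ p) n) (fromℚ 0ℚ)
        (≃-sym (ℝᴾ.coeff (mapᴾ p) n) (fromℚ (coeff p n)) (coeff-map p n)) (ℝᴾ.at e n)))

    -- The multiplicity of r in p(-X) is that of - r in p, which by symmetry is the multiplicity k
    -- of r in p; so `wronskian-root` applies. That k exists only under double negation is harmless
    -- because the conclusion is stable.
    quotientMoment-root : ∀ c r → Annihilates c (odd t) → evalᴿ c r ≃ fromℚ 0ℚ → evalᴿ (quotientMoment (odd t) c) r ≃ fromℚ 0ℚ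
    quotientMoment-root c r z cr≃0 = ≃0-stable (evalᴿ (quotientMoment (odd t) c) r) λ u≄0 →
      ℝᴹ.multiplicity-exists (List.length (mapᴾ p)) (mapᴾ p) r (ℝᴾ.below-length (mapᴾ p)) pᴿ≢[] λ (k , m) →
      u≄0 (ℝᴹ.wronskian-root {mapᴾ p} {ℝᴾ.reflect (mapᴾ p)} {mapᴾ c} {mapᴾ (quotientMoment (odd t) c)} {r} {k}
        (wronskianᴿ c z) m
        (ℝᴹ.multiplicity-cong {ℝᴾ.reflect (mapᴾ p)} {ℝᴾ.reflect (mapᴾ p)} { -ᴿ (-ᴿ r)} {r} {k} ℝᴾ.≋-refl (neg-neg)
          (ℝᴹ.multiplicity-reflect {mapᴾ p} { -ᴿ r} {k} (symmetric r k m))) cr≃0)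
      where
      neg-neg : -ᴿ (-ᴿ r) ≃ r
      neg-neg = ≗⇒≃ (-ᴿ (-ᴿ r)) r (λ i → RingProperties.-‿involutive (CommutativeRing.ring ℚ-ring) (seq r i))

    no-common-root : (c : Generator (λ f → Annihilates f (odd t))) → ∀ r → evalᴿ (Generator.generator c) r ≃ fromℚ 0ℚ →
                     ¬ Generator (λ f → evalᴿ f r ≃ fromℚ 0ℚ)
    no-common-root c r cr≃0 e = monic≢[] C.is-monic (Pℚ.trans (proj₂ c-quotient)
        (Pℚ.trans (Pℚ.*-congˡ {E.generator} c′≋[]) (Pℚ.zeroʳ E.generator)))
      where
      module C = Generator c
      module E = Generator e
      u = quotientMoment (odd t) C.generator
      c-quotient : ∃[ c′ ] C.generator ≋ E.generator *ᴾ c′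
      c-quotient = generator-divides (root-ideal r) e C.generator cr≃0
      u-quotient : ∃[ u′ ] u ≋ E.generator *ᴾ u′
      u-quotient = generator-divides (root-ideal r) e u (quotientMoment-root C.generator r C.member cr≃0)
      positive-degree : ∃[ d ] E.degree ≡ suc d
      positive-degree = degree-1+ E.is-monic (λ me → 1≄0 (≃-trans (fromℚ 1ℚ) (evalᴿ (constᴾ 1ℚ) r) (fromℚ 0ℚ)
        (≗⇒≃ (fromℚ 1ℚ) (evalᴿ (constᴾ 1ℚ) r) (λ i → ≡.sym (≡.trans (≡.cong (1ℚ ℚ.+_) (ℚ.*-zeroʳ (seq r i))) (ℚ.+-identityʳ 1ℚ))))
        (Ideal.J-cong (root-ideal r) {E.generator} {constᴾ 1ℚ} (monic-0 me) E.member)))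
      d = proj₁ positive-degree
      e-monic : Monic (suc d) E.generator
      e-monic = ≡.subst (λ d → Monic d E.generator) (proj₂ positive-degree) E.is-monic
      c′ = proj₁ c-quotient
      c′≋[] : c′ ≋ []
      c′≋[] = C.minimal c′ (common-divisor (odd t) e-monic C.member (proj₂ c-quotient) (proj₂ u-quotient))
        (monic-*-below e-monic c′ (below-cong (proj₂ c-quotient) (below-weaken (s≤s (ℕ.m≤n+m C.degree d)) (monic-below C.is-monic))))

    odd-not-nonzero : ¬ (∃[ k ] odd t k ≢ 0ℚ)
    odd-not-nonzero nonzero =
      generator-exists (annihilator-ideal (even t)) N product product-even (below-length product) product≢[] λ μ →
      generator-exists (annihilator-ideal (odd t)) N product product-odd (below-length product) product≢[] λ c →
      continue c (odd-root μ c nonzero)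
      where
      N = List.length product
      continue : (c : Generator (λ f → Annihilates f (odd t))) → ¬ (∃[ r ] evalᴿ (Generator.generator c) r ≃ fromℚ 0ℚ)
      continue c (r , cr≃0) = generator-exists (root-ideal r) (List.length (Generator.generator c)) (Generator.generator c) cr≃0
        (below-length (Generator.generator c)) (monic≢[] (Generator.is-monic c)) (no-common-root c r cr≃0)

  symmetric⇒odd≡0 : ∀ k → odd t k ≡ 0ℚ
  symmetric⇒odd≡0 k = stable (odd t k ℚ.≟ 0ℚ)
    where
    stable : Dec (odd t k ≡ 0ℚ) → odd t k ≡ 0ℚ
    stable (yes e) = e
    stable (no ne) = contradiction (k , ne) odd-not-nonzero

-- Vanishing odd moments give symmetric multiplicities.

open PowerSums ℚ-ring
open CharacteristicPolynomial ℚ-ring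
module Σℚ = SemiringSum (CommutativeRing.semiring ℚ-ring)

sum-nonneg : ∀ {n} (f : Fin n → ℚ) → (∀ i → 0ℚ ℚ.≤ f i) → 0ℚ ℚ.≤ Σℚ.sum f
sum-nonneg {zero}  f h = ℚ.≤-refl
sum-nonneg {suc n} f h = ℚ-+-nonneg (h zero) (sum-nonneg (f ∘ suc) (h ∘ suc))

powerTrace-positive : ∀ {n} (A : Matrix ℚ n) → (∀ i j → A i j ≡ A j i) → Positive (powerTrace A)
powerTrace-positive A s f = ≡.subst (0ℚ ℚ.≤_) (≡.sym (pair-powerTrace A f f))
  (sum-nonneg _ (λ i → sum-nonneg _ (λ j → ≡.subst (λ z → 0ℚ ℚ.≤ z ℚ.* (f • powerEntry A i j) 0)
    (•-congʳ f (λ a → powerEntry-symmetric A s a i j) 0) (ℚ-square-nonneg ((f • powerEntry A i j) 0)))))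

module _ {n : ℕ} {p : Poly} {t : ℕ → ℚ} (p-monic : Monic n p) (p•t≈0 : Annihilates p t)
  (newton : deriv p ≋ quotientMoment t p) (t-0 : t 0 ≡ n ·ℚ 1ℚ) (even-t : ∀ k → alternate t k ≡ t k) where

  private
    module PS = CommutativeRing ℝᴾ.polynomialRing

    multiples-distinct : ∀ {k} x → k ℕ.< n → k ·ℚ x ≡ x ℚ.* t 0 → x ≡ 0ℚ
    multiples-distinct {k} x k<n e = ℚ-domain (λ z → ℚ.<⇒≢ positive (≡.sym z)) (≡.trans (≡.sym (multiple (suc j))) (sub (k ·ℚ x) (suc j ·ℚ x) total))
      where
      j = n ℕ.∸ suc k
      multiple : ∀ i → i ·ℚ x ≡ (i ·ℚ 1ℚ) ℚ.* x
      multiple i = ≡.trans (≡.cong (i ·ℚ_) (≡.sym (ℚ.*-identityˡ x))) (≡.sym (ℚ×.×-assoc-* i 1ℚ x))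
      positive : 0ℚ ℚ.< suc j ·ℚ 1ℚ
      positive = ℚ.+-mono-<-≤ (ℚ.positive⁻¹ 1ℚ) (·ℚ-pos j (ℚ.<⇒≤ (ℚ.positive⁻¹ 1ℚ)))
      n≡ : n ≡ k ℕ.+ suc j
      n≡ = ≡.sym (≡.trans (ℕ.+-suc k j) (≡.trans (≡.cong suc (ℕ.+-comm k j)) (≡.trans (≡.sym (ℕ.+-suc j k)) (ℕ.m∸n+n≡m k<n))))
      total : k ·ℚ x ℚ.+ suc j ·ℚ x ≡ k ·ℚ x
      total = ≡.trans (≡.sym (ℚ×.×-homo-+ x k (suc j))) (≡.trans (≡.cong (_·ℚ x) (≡.sym n≡)) (≡.trans (multiple n)
        (≡.trans (≡.cong (ℚ._* x) (≡.sym t-0)) (≡.trans (ℚ.*-comm (t 0) x) (≡.sym e)))))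
      sub : ∀ a b → a ℚ.+ b ≡ a → b ≡ 0ℚ
      sub a b h = ≡.trans (ℚS.solve 2 (λ a b → b ℚS.:= (a ℚS.:+ b) ℚS.:- a) ≡.refl a b) (≡.trans (≡.cong (ℚ._- a) h) (ℚ.+-inverseʳ a))

    -- If d has degree at most k < n, Newton's identity for its coefficient d_k reads k d_k = t 0
    -- d_k = n d_k, which forces d_k = 0. For k = 0 the annihilation of t by d takes the place of
    -- the identity.
    newton-unique : ∀ d → Annihilates d t → deriv d ≋ quotientMoment t d → ∀ k → k ℕ.≤ n → Below k d → d ≋ []
    newton-unique d z e zero    k≤n b = below-0⇒≋[] b
    newton-unique d z e (suc k) k<n b = newton-unique d z e k (ℕ.<⇒≤ k<n) (below-step b (multiples-distinct (coeff d k) k<n (≡.trans (newton-coeff k) (leading k b))))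
      where
      newton-coeff : ∀ k → k ·ℚ coeff d k ≡ (List.drop k d • t) 0
      newton-coeff zero    = ≡.sym (z 0)
      newton-coeff (suc k) = ≡.trans (≡.sym (coeff-deriv d k)) (≡.trans (at e k) (drop-quotientMoment t d k))
      leading : ∀ k → Below (suc k) d → (List.drop k d • t) 0 ≡ coeff d k ℚ.* t 0
      leading k b = ≡.trans (below-• (List.drop k d) t (below-drop k d (below-weaken (ℕ.≤-reflexive (ℕ.+-comm 1 k)) b)))
        (≡.cong (ℚ._* t 0) (≡.trans (coeff-drop k d 0) (≡.cong (coeff d) (ℕ.+-identityʳ k))))

    p⁻ = reflect p
    s = coeff p⁻ n

    s*s≡1 : s ℚ.* s ≡ 1ℚ
    s*s≡1 = ≡.trans (≡.cong₂ ℚ._*_ (coeff-reflect p n) (coeff-reflect p n)) (≡.trans (alternate-square (coeff p) n)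
      (≡.trans (≡.cong₂ ℚ._*_ (monic-top p-monic) (monic-top p-monic)) (ℚ.*-identityˡ 1ℚ)))

    p⁻-annihilates : Annihilates p⁻ t
    p⁻-annihilates k = ≡.trans (•-congʳ p⁻ (λ j → ≡.sym (even-t j)) k) (annihilates-reflect p t p•t≈0 k)

    p⁻-newton : deriv p⁻ ≋ quotientMoment t p⁻
    p⁻-newton = Pℚ.trans (newton-reflect p t p•t≈0 newton) (quotientMoment-congˡ p⁻ even-t)

    p⁻-below : Below (suc n) p⁻
    p⁻-below = below (λ k l → ≡.trans (coeff-reflect p k) (alternate-vanishes (coeff p) k (vanish (monic-below p-monic) k l)))
      where
      alternate-vanishes : ∀ (f : ℕ → ℚ) k → f k ≡ 0ℚ → alternate f k ≡ 0ℚ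
      alternate-vanishes f zero    e = e
      alternate-vanishes f (suc k) e = ≡.cong ℚ.-_ (alternate-vanishes (f ∘ suc) k e)

    -- As s is 1 or - 1, s p(-X) is monic. The difference therefore has degree below n and, the odd
    -- moments being zero, inherits Newton's identities and the annihilation of t.
    d = p +ᴾ -ᴾ (s ∙ p⁻)

    d-below : Below n d
    d-below = below-step (below-+ (monic-below p-monic) (below-neg (below-∙ {suc n} {s} {p⁻} p⁻-below)))
      (≡.trans (coeff-+ p (-ᴾ (s ∙ p⁻)) n) (≡.trans (≡.cong₂ ℚ._+_ (monic-top p-monic)
        (≡.trans (coeff-neg (s ∙ p⁻) n) (≡.cong ℚ.-_ (≡.trans (coeff-∙ s p⁻ n) s*s≡1)))) (ℚ.+-inverseʳ 1ℚ)))

    d-annihilates : Annihilates d t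
    d-annihilates k = ≡.trans (•-+ p (-ᴾ (s ∙ p⁻)) t k) (≡.cong₂ ℚ._+_ (p•t≈0 k)
      (≡.trans (•-neg (s ∙ p⁻) t k) (≡.cong ℚ.-_ (≡.trans (•-∙ s p⁻ t k) (≡.trans (≡.cong (s ℚ.*_) (p⁻-annihilates k)) (ℚ.*-zeroʳ s))))))

    d-newton : deriv d ≋ quotientMoment t d
    d-newton = Pℚ.trans (deriv-+ p (-ᴾ (s ∙ p⁻))) (Pℚ.trans
      (Pℚ.+-cong newton (Pℚ.trans (deriv-neg (s ∙ p⁻)) (Pℚ.trans (Pℚ.-‿cong (Pℚ.trans (deriv-∙ s p⁻)
        (Pℚ.trans (∙-cong {s} ≡.refl p⁻-newton) (Pℚ.sym (quotientMoment-∙ t s p⁻))))) (Pℚ.sym (quotientMoment-neg t (s ∙ p⁻))))))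
      (Pℚ.sym (quotientMoment-+ t p (-ᴾ (s ∙ p⁻)))))

    p≋s∙p⁻ : p ≋ s ∙ p⁻
    p≋s∙p⁻ = Pℚ.trans (solve 2 (λ p q → p := (p :+ :- q) :+ q) Pℚ.refl p (s ∙ p⁻))
      (Pℚ.trans (Pℚ.+-congʳ {s ∙ p⁻} (newton-unique d d-annihilates d-newton n ℕ.≤-refl d-below)) (Pℚ.+-identityˡ (s ∙ p⁻)))
      where open IntegerSolver polynomialRing

  even⇒self-reflective : p ≋ reflect p ⊎ p ≋ -ᴾ reflect p
  even⇒self-reflective = signs (s ℚ.≟ 1ℚ)
    where
    signs : Dec (s ≡ 1ℚ) → p ≋ reflect p ⊎ p ≋ -ᴾ reflect p
    signs (yes s≡1) = inj₁ (Pℚ.trans p≋s∙p⁻ (Pℚ.trans (∙-cong s≡1 Pℚ.refl) (1∙ p⁻)))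
    signs (no  s≢1) = inj₂ (Pℚ.trans p≋s∙p⁻ (Pℚ.trans (∙-cong s≡-1 Pℚ.refl) ⟨ (λ k → ≡.trans (coeff-∙ (ℚ.- 1ℚ) p⁻ k)
      (≡.trans (≡.trans (≡.sym (ℚ.neg-distribˡ-* 1ℚ (coeff p⁻ k))) (≡.cong ℚ.-_ (ℚ.*-identityˡ (coeff p⁻ k)))) (≡.sym (coeff-neg p⁻ k)))) ⟩))
      where
      s-1≢0 : s ℚ.- 1ℚ ≢ 0ℚ
      s-1≢0 e = s≢1 (≡.trans (ℚS.solve 2 (λ a b → a ℚS.:= (a ℚS.:- b) ℚS.:+ b) ≡.refl s 1ℚ) (≡.trans (≡.cong (ℚ._+ 1ℚ) e) (ℚ.+-identityˡ 1ℚ)))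
      s+1≡0 : s ℚ.+ 1ℚ ≡ 0ℚ
      s+1≡0 = ℚ-domain s-1≢0 (≡.trans (ℚS.solve 1 (λ a → (a ℚS.:- ℚS.:1) ℚS.:* (a ℚS.:+ ℚS.:1) ℚS.:= a ℚS.:* a ℚS.:- ℚS.:1) ≡.refl s)
        (≡.trans (≡.cong (ℚ._- 1ℚ) s*s≡1) (ℚ.+-inverseʳ 1ℚ)))
      s≡-1 : s ≡ ℚ.- 1ℚ
      s≡-1 = ≡.trans (ℚS.solve 2 (λ a b → a ℚS.:= (a ℚS.:+ b) ℚS.:- b) ≡.refl s 1ℚ) (≡.trans (≡.cong (ℚ._- 1ℚ) s+1≡0) (ℚ.+-identityˡ (ℚ.- 1ℚ)))

  even⇒symmetric : ∀ x k → HasMultiplicityᴿ p x k → HasMultiplicityᴿ p (-ᴿ x) k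
  even⇒symmetric x k m = [ same , opposite ]′ even⇒self-reflective
    where
    reflected : Polynomial.HasMultiplicity ℝ-rawRing (ℝᴾ.reflect (mapᴾ p)) (-ᴿ x) k
    reflected = ℝᴹ.multiplicity-reflect {mapᴾ p} {x} {k} m
    refl-x : -ᴿ x ≃ -ᴿ x
    refl-x = ≗⇒≃ (-ᴿ x) (-ᴿ x) (λ _ → ≡.refl)
    same : p ≋ reflect p → HasMultiplicityᴿ p (-ᴿ x) k
    same e = ℝᴹ.multiplicity-cong {ℝᴾ.reflect (mapᴾ p)} {mapᴾ p} { -ᴿ x} { -ᴿ x} {k}
      (PS.sym (PS.trans (map-cong p (reflect p) e) (map-reflect p))) refl-x reflected
    opposite : p ≋ -ᴾ reflect p → HasMultiplicityᴿ p (-ᴿ x) k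
    opposite e = ℝᴹ.multiplicity-cong {ℝᴾ.-ᴾ ℝᴾ.reflect (mapᴾ p)} {mapᴾ p} { -ᴿ x} { -ᴿ x} {k}
      (PS.sym (PS.trans (map-cong p (-ᴾ reflect p) e) (PS.trans (map-neg (reflect p)) (PS.-‿cong (map-reflect p))))) refl-x
      (ℝᴹ.multiplicity-neg {ℝᴾ.reflect (mapᴾ p)} { -ᴿ x} {k} reflected)

-- Symmetric spectra in terms of odd traces.

open MatrixAlgebra ℚ-ring
module ℚᴰ = Determinant ℚ-ring
module ℝᴾR = CommutativeRing ℝᴾ.polynomialRing

adjacencyℚ : ∀ {n} → SignedGraph n → Matrix ℚ n
adjacencyℚ Γ u v = cast (adjacency Γ u v)

charPoly-map : ∀ {n} (A : Matrix ℤ n) → mapᴾ (charpoly (λ u v → cast (A u v))) ℝᴾ.≋ charPoly (λ u v → fromℤ (A u v))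
charPoly-map {n} A = det-related (CommutativeRing.rawRing polynomialRing) (Polynomial.Poly-rawRing ℝ-rawRing) _~_
  ℝᴾR.refl ℝᴾR.refl (λ {a} {b} {c} {d} → ~+ {a} {b} {c} {d}) (λ {a} {b} {c} {d} → ~* {a} {b} {c} {d}) (λ {a} {b} → ~neg {a} {b}) entries
  where
  _~_ : Poly → ℝᴾ.Poly → Set
  f ~ g = mapᴾ f ℝᴾ.≋ g
  ~+ : ∀ {a b c d} → a ~ b → c ~ d → (a +ᴾ c) ~ (b ℝᴾ.+ᴾ d)
  ~+ {a} {b} {c} {d} e f = ℝᴾR.trans (map-+ a c) (ℝᴾR.+-cong e f)
  ~* : ∀ {a b c d} → a ~ b → c ~ d → (a *ᴾ c) ~ (b ℝᴾ.*ᴾ d)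
  ~* {a} {b} {c} {d} e f = ℝᴾR.trans (map-* a c) (ℝᴾR.*-cong e f)
  ~neg : ∀ {a b} → a ~ b → (-ᴾ a) ~ (ℝᴾ.-ᴾ b)
  ~neg {a} e = ℝᴾR.trans (map-neg a) (ℝᴾR.-‿cong e)
  ~I : ∀ i j → MatrixOver.I (CommutativeRing.rawRing polynomialRing) n i j ~ MatrixOver.I (Polynomial.Poly-rawRing ℝ-rawRing) n i j
  ~I i j with i Fin.≟ j
  ... | yes _ = ℝᴾR.refl
  ... | no  _ = ℝᴾR.refl
  entries : ∀ i j → charMatrix (λ u v → cast (A u v)) i j ~
    ((MatrixOver.I (Polynomial.Poly-rawRing ℝ-rawRing) n i j ℝᴾ.*ᴾ ℝᴾ.X) ℝᴾ.+ᴾ ℝᴾ.-ᴾ ℝᴾ.constᴾ (fromℤ (A i j)))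
  entries i j = ~+ {MatrixOver.I (CommutativeRing.rawRing polynomialRing) n i j *ᴾ X} {_} { -ᴾ constᴾ (cast (A i j))} {_}
    (~* {MatrixOver.I (CommutativeRing.rawRing polynomialRing) n i j} {_} {X} {ℝᴾ.X} (~I i j) ℝᴾR.refl)
    (~neg {constᴾ (cast (A i j))} {ℝᴾ.constᴾ (fromℤ (A i j))} ℝᴾR.refl)

adjacency-symmetric : ∀ {n} (Γ : SignedGraph n) u v → adjacency Γ u v ≡ adjacency Γ v u
adjacency-symmetric Γ u v with adj? Γ u v | adj? Γ v u
... | yes e | yes e′ = ≡.cong signToℤ (σ-sym Γ e e′)
... | yes e | no ne  = contradiction (adj-sym Γ e) ne
... | no ne | yes e  = contradiction (adj-sym Γ e) ne
... | no _  | no _   = ≡.refl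

alternate-double : ∀ t j → alternate t (double j) ≡ t (double j)
alternate-double t zero    = ≡.refl
alternate-double t (suc j) = ≡.trans (RingProperties.-‿involutive (CommutativeRing.ring ℚ-ring) (alternate (λ k → t (suc (suc k))) (double j)))
  (alternate-double (λ k → t (suc (suc k))) j)

parity : ∀ k → (∃[ j ] k ≡ double j) ⊎ (∃[ j ] k ≡ suc (double j))
parity zero    = inj₁ (0 , ≡.refl)
parity (suc k) = [ (λ (j , e) → inj₂ (j , ≡.cong suc e)) , (λ (j , e) → inj₁ (suc j , ≡.cong suc e)) ]′ (parity k)

torsion-free : ∀ x → x ≡ ℚ.- x → x ≡ 0ℚ
torsion-free x e = ≡.trans (≡.sym (½+½ x)) (≡.trans (≡.cong (λ z → ½ ℚ.* x ℚ.+ ½ ℚ.* z) e)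
  (ℚS.solve 2 (λ h x → h ℚS.:* x ℚS.:+ h ℚS.:* (ℚS.:- x) ℚS.:= ℚS.:0) ≡.refl ½ x))

OddTraces : ∀ {n} → SignedGraph n → Set
OddTraces Γ = ∀ j → powerTrace (adjacencyℚ Γ) (suc (double j)) ≡ 0ℚ

module _ {n} (Γ : SignedGraph n) where
  private
    A = adjacencyℚ Γ
    p = charpoly A
    t = powerTrace A

    toᴿ : ∀ x k → EigenvalueMultiplicity (λ u v → fromℤ (adjacency Γ u v)) x k → HasMultiplicityᴿ p x k
    toᴿ x k = ℝᴹ.multiplicity-cong {_} {mapᴾ p} {x} {x} {k} (ℝᴾR.sym (charPoly-map (adjacency Γ))) (≗⇒≃ x x (λ _ → ≡.refl))

    fromᴿ : ∀ x k → HasMultiplicityᴿ p x k → EigenvalueMultiplicity (λ u v → fromℤ (adjacency Γ u v)) x k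
    fromᴿ x k = ℝᴹ.multiplicity-cong {mapᴾ p} {_} {x} {x} {k} (charPoly-map (adjacency Γ)) (≗⇒≃ x x (λ _ → ≡.refl))

  symmetricSpectrum⇒oddTraces : SymmetricSpectrum Γ → OddTraces Γ
  -- The odd part being zero, t and `alternate t` agree; at an odd index they are also opposite, so
  -- the trace equals its own negative.
  symmetricSpectrum⇒oddTraces sym j = torsion-free (t (suc (double j))) (≡.trans
    (≡.trans (ℚS.solve 2 (λ a b → b ℚS.:= (ℚS.:- ℚS.:1 ℚS.:* a ℚS.:+ b) ℚS.:+ a) ≡.refl (alternate t (suc (double j))) (t (suc (double j))))
      (≡.trans (≡.cong (ℚ._+ alternate t (suc (double j))) odd≡0) (ℚ.+-identityˡ (alternate t (suc (double j))))))
    (≡.cong ℚ.-_ (alternate-double (t ∘ suc) j)))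
    where
    odd≡0 : odd t (suc (double j)) ≡ 0ℚ
    odd≡0 = symmetric⇒odd≡0 {n} {p} {t} (charpoly-monic A) (charpoly-annihilates A) (newton A)
      (powerTrace-positive A (λ u v → ≡.cong cast (adjacency-symmetric Γ u v)))
      (λ x k m → toᴿ (-ᴿ x) k (Equivalence.to (sym x k) (fromᴿ x k m))) (suc (double j))

  oddTraces⇒symmetricSpectrum : OddTraces Γ → SymmetricSpectrum Γ
  oddTraces⇒symmetricSpectrum odd≡0 x k = mk⇔ (λ m → fromᴿ (-ᴿ x) k (symmetric x (toᴿ x k m)))
    (λ m → fromᴿ x k (ℝᴹ.multiplicity-cong {mapᴾ p} {mapᴾ p} { -ᴿ (-ᴿ x)} {x} {k} ℝᴾR.refl
      (≗⇒≃ (-ᴿ (-ᴿ x)) x (λ i → RingProperties.-‿involutive (CommutativeRing.ring ℚ-ring) (seq x i)))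
      (symmetric (-ᴿ x) (toᴿ (-ᴿ x) k m))))
    where
    even-t : ∀ k → alternate t k ≡ t k
    even-t k = [ (λ (j , e) → ≡.subst (λ k → alternate t k ≡ t k) (≡.sym e) (alternate-double t j))
               , (λ (j , e) → ≡.subst (λ k → alternate t k ≡ t k) (≡.sym e)
                   (≡.trans (≡.cong ℚ.-_ (≡.trans (alternate-double (t ∘ suc) j) (odd≡0 j))) (≡.sym (odd≡0 j)))) ]′ (parity k)
    symmetric : ∀ x → HasMultiplicityᴿ p x k → HasMultiplicityᴿ p (-ᴿ x) k
    symmetric x = even⇒symmetric {n} {p} {t} (charpoly-monic A) (charpoly-annihilates A) (newton A) (powerTrace-0 A) even-t x k

-- The bipartition

sign : Sign → ℚ
sign s = cast (signToℤ s)

-- The function `side` expressed by vector lookup, so that its values can be summed by induction on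
-- the subset.
sideOf : ∀ {n} → Subset n → Fin n → Sign
sideOf V u = if Vec.lookup V u then Sign.+ else Sign.-

side-lookup : ∀ {n} (Γ : SignedBipartiteGraph n) u → side Γ u ≡ sideOf (V₁ Γ) u
side-lookup Γ u with u ∈? V₁ Γ
... | yes u∈V = ≡.sym (≡.cong (λ b → if b then Sign.+ else Sign.-) (Vec.[]=⇒lookup u∈V))
... | no  u∉V = ≡.sym (≡.cong (λ b → if b then Sign.+ else Sign.-) (Bool.¬-not (λ e → u∉V (Vec.lookup⇒[]= u (V₁ Γ) e))))

sum-sides : ∀ {n} (V : Subset n) → Σℚ.sum (λ u → sign (sideOf V u)) ℚ.+ cast (ℤ.+ ∣ ∁ V ∣) ≡ cast (ℤ.+ ∣ V ∣)
sum-sides []            = ≡.refl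
sum-sides (true  ∷ V) = ≡.trans (ℚ.+-assoc 1ℚ (Σℚ.sum (λ u → sign (sideOf V u))) (cast (ℤ.+ ∣ ∁ V ∣)))
  (≡.trans (≡.cong (1ℚ ℚ.+_) (sum-sides V)) (≡.sym (cast-+ (ℤ.+ 1) (ℤ.+ ∣ V ∣))))
sum-sides (false ∷ V) = ≡.trans (≡.cong ((ℚ.- 1ℚ ℚ.+ S) ℚ.+_) (cast-+ (ℤ.+ 1) (ℤ.+ ∣ ∁ V ∣)))
  (≡.trans (ℚS.solve 3 (λ o s c → (ℚS.:- o ℚS.:+ s) ℚS.:+ (o ℚS.:+ c) ℚS.:= s ℚS.:+ c) ≡.refl 1ℚ S (cast (ℤ.+ ∣ ∁ V ∣))) (sum-sides V))
  where S = Σℚ.sum (λ u → sign (sideOf V u))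

cast-injective : ∀ i j → cast i ≡ cast j → i ≡ j
cast-injective i j e with ℤ.<-cmp i j
... | tri< i<j _ _ = contradiction e (ℚ.<⇒≢ (cast-mono-< i<j))
... | tri≈ _ i≡j _ = i≡j
... | tri> _ _ j<i = contradiction (≡.sym e) (ℚ.<⇒≢ (cast-mono-< j<i))

module _ {n} (Γ : SignedBipartiteGraph n) where
  private
    module M = Ring (matrixRing n)
    A = adjacencyℚ (graph Γ)
    s : Fin n → ℚ
    s u = sign (side Γ u)

  diagonal : Matrix ℚ n
  diagonal u v = cast (D Γ u v)

  private
    diagonalˡ : ∀ u v → diagonal u v ≡ s u ℚ.* ℚᴰ.I n u v
    diagonalˡ u v with u Fin.≟ v
    ... | yes _ = ≡.sym (ℚ.*-identityʳ (s u))
    ... | no  _ = ≡.sym (ℚ.*-zeroʳ (s u))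

    diagonalʳ : ∀ u v → diagonal u v ≡ ℚᴰ.I n u v ℚ.* s v
    diagonalʳ u v with u Fin.≟ v
    ... | yes ≡.refl = ≡.sym (ℚ.*-identityˡ (s u))
    ... | no  _      = ≡.sym (ℚ.*-zeroˡ (s v))

    sign-square : ∀ t → sign t ℚ.* sign t ≡ 1ℚ
    sign-square Sign.+ = ≡.refl
    sign-square Sign.- = ≡.refl

    diagonal-∙ : ∀ B u v → (diagonal ∙ᴹ B) u v ≡ s u ℚ.* B u v
    diagonal-∙ B u v = ≡.trans (ℚᴰ.sum-cong (λ w → diagonal u w ℚ.* B w v) (λ w → s u ℚ.* (ℚᴰ.I n u w ℚ.* B w v))
        (λ w → ≡.trans (≡.cong (ℚ._* B w v) (diagonalˡ u w)) (ℚ.*-assoc (s u) (ℚᴰ.I n u w) (B w v))))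
      (≡.trans (≡.sym (Σℚ.*-distribˡ-sum (s u) (λ w → ℚᴰ.I n u w ℚ.* B w v))) (≡.cong (s u ℚ.*_) (sum-Iˡ u (λ w → B w v))))

    ∙-diagonal : ∀ B u v → (B ∙ᴹ diagonal) u v ≡ B u v ℚ.* s v
    ∙-diagonal B u v = ≡.trans (ℚᴰ.sum-cong (λ w → B u w ℚ.* diagonal w v) (λ w → B u w ℚ.* ℚᴰ.I n w v ℚ.* s v)
        (λ w → ≡.trans (≡.cong (B u w ℚ.*_) (diagonalʳ w v)) (≡.sym (ℚ.*-assoc (B u w) (ℚᴰ.I n w v) (s v)))))
      (≡.trans (≡.sym (Σℚ.*-distribʳ-sum (s v) (λ w → B u w ℚ.* ℚᴰ.I n w v))) (≡.cong (ℚ._* s v) (ℚᴰ.sum-I (B u) v)))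

    side-∈ : ∀ {u} → u ∈ V₁ Γ → side Γ u ≡ Sign.+
    side-∈ {u} h with u ∈? V₁ Γ
    ... | yes _ = ≡.refl
    ... | no  n = contradiction h n

    side-∉ : ∀ {u} → u ∉ V₁ Γ → side Γ u ≡ Sign.-
    side-∉ {u} h with u ∈? V₁ Γ
    ... | yes y = contradiction y h
    ... | no  _ = ≡.refl

    opposite-sides : ∀ {u v} → Adj (graph Γ) u v → s v ≡ ℚ.- s u
    opposite-sides e =
      [ (λ (u∈ , v∉) → ≡.trans (≡.cong sign (side-∉ v∉)) (≡.cong (ℚ.-_ ∘ sign) (≡.sym (side-∈ u∈))))
      , (λ (u∉ , v∈) → ≡.trans (≡.cong sign (side-∈ v∈)) (≡.cong (ℚ.-_ ∘ sign) (≡.sym (side-∉ u∉)))) ]′ (bipartite Γ e)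

    -- The ends of an edge lie on opposite sides, so the two scalings differ in sign; at
    -- non-adjacent vertices both are zero.
    anticommute : ∀ u v → A u v ℚ.* s v ≡ ℚ.- (s u ℚ.* A u v)
    anticommute u v with adj? (graph Γ) u v
    ... | yes e = ≡.trans (≡.cong (sign (σ (graph Γ) e) ℚ.*_) (opposite-sides e))
      (ℚS.solve 2 (λ a s → a ℚS.:* (ℚS.:- s) ℚS.:= ℚS.:- (s ℚS.:* a)) ≡.refl (sign (σ (graph Γ) e)) (s u))
    ... | no  _ = ≡.trans (ℚ.*-zeroˡ (s v)) (≡.sym (≡.cong ℚ.-_ (ℚ.*-zeroʳ (s u))))

  diagonal-square : diagonal ∙ᴹ diagonal ≈ᴹ ℚᴰ.I n
  diagonal-square = entrywise (λ u v → ≡.trans (diagonal-∙ diagonal u v) (≡.trans (≡.cong (s u ℚ.*_) (diagonalˡ u v))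
    (≡.trans (≡.sym (ℚ.*-assoc (s u) (s u) (ℚᴰ.I n u v))) (≡.trans (≡.cong (ℚ._* ℚᴰ.I n u v) (sign-square (side Γ u))) (ℚ.*-identityˡ (ℚᴰ.I n u v))))))

  adjacency-diagonal : A ∙ᴹ diagonal ≈ᴹ M.- (diagonal ∙ᴹ A)
  adjacency-diagonal = entrywise (λ u v → ≡.trans (∙-diagonal A u v) (≡.trans (anticommute u v) (≡.cong ℚ.-_ (≡.sym (diagonal-∙ A u v)))))

  private
    trace-sides : trace diagonal ℚ.+ cast (ℤ.+ ∣ ∁ (V₁ Γ) ∣) ≡ cast (ℤ.+ ∣ V₁ Γ ∣)
    trace-sides = ≡.trans (≡.cong (ℚ._+ cast (ℤ.+ ∣ ∁ (V₁ Γ) ∣)) (ℚᴰ.sum-cong (λ u → diagonal u u) (λ u → sign (sideOf (V₁ Γ) u))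
      (λ u → ≡.trans (diagonalˡ u u) (≡.trans (≡.cong (s u ℚ.*_) (ℚᴰ.I-diagonal n u)) (≡.trans (ℚ.*-identityʳ (s u)) (≡.cong sign (side-lookup Γ u)))))))
      (sum-sides (V₁ Γ))

  balanced⇒trace≡0 : Balanced Γ → trace diagonal ≡ 0ℚ
  balanced⇒trace≡0 b = ≡.trans (ℚS.solve 2 (λ t c → t ℚS.:= (t ℚS.:+ c) ℚS.:- c) ≡.refl (trace diagonal) c)
    (≡.trans (≡.cong (ℚ._- c) (≡.trans trace-sides (≡.cong (λ k → cast (ℤ.+ k)) b))) (ℚ.+-inverseʳ c))
    where c = cast (ℤ.+ ∣ ∁ (V₁ Γ) ∣)

  trace≡0⇒balanced : trace diagonal ≡ 0ℚ → Balanced Γ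
  trace≡0⇒balanced e = ℤ.+-injective (cast-injective (ℤ.+ ∣ V₁ Γ ∣) (ℤ.+ ∣ ∁ (V₁ Γ) ∣)
    (≡.trans (≡.sym trace-sides) (≡.trans (≡.cong (ℚ._+ cast (ℤ.+ ∣ ∁ (V₁ Γ) ∣)) e) (ℚ.+-identityˡ (cast (ℤ.+ ∣ ∁ (V₁ Γ) ∣))))))

-- Odd traces of the two products.

module _ {n : ℕ} where
  private
    module M = Ring (matrixRing n)

  trace-neg : ∀ (B : Matrix ℚ n) → trace (M.- B) ≡ ℚ.- trace B
  trace-neg B = sum-neg (λ i → B i i)

  open AnticommutingTrace (matrixRing n) ℚ-ring trace trace-cong (λ B C → Σℚ.∑-distrib-+ (λ i → B i i) (λ i → C i i))
    trace-neg trace-comm torsion-free public using (odd-power-trace; ^-cong)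

  oddPower-cong : ∀ {A B : Matrix ℚ n} j → A ≈ᴹ B → oddPower A j ≈ᴹ oddPower B j
  oddPower-cong j e = M.*-cong e (^-cong j (M.*-cong e e))

  oddPower-I : ∀ j → oddPower (ℚᴰ.I n) j ≈ᴹ ℚᴰ.I n
  oddPower-I j = M.trans (M.*-identityˡ _) (power j)
    where
    power : ∀ j → (ℚᴰ.I n ∙ᴹ ℚᴰ.I n) Pow.^ j ≈ᴹ ℚᴰ.I n
    power zero    = M.refl
    power (suc j) = M.trans (M.*-cong (M.*-identityˡ (ℚᴰ.I n)) (power j)) (M.*-identityˡ (ℚᴰ.I n))

  trace-odd-power : ∀ (A : Matrix ℚ n) j → powerTrace A (suc (double j)) ≡ trace (oddPower A j)
  trace-odd-power A j = trace-cong _ (oddPower A j) (powerEntry-^ A j)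

module _ {n m : ℕ} (Γ₁ : SignedBipartiteGraph n) (Γ₂ : SignedGraph m) where
  private
    open MatrixOver (CommutativeRing.rawRing ℚ-ring) using (_⊗_)
    module Mn  = Ring (matrixRing n)
    module Mm  = Ring (matrixRing m)
    module Mnm = Ring (matrixRing (n ℕ.* m))
    A₁ = adjacencyℚ (graph Γ₁)
    A₂ = adjacencyℚ Γ₂
    Δ  = diagonal Γ₁
    Iₙ = ℚᴰ.I n
    Iₘ = ℚᴰ.I m
    -- Both products of `d` and `z` equal Δ ⊗ A₂, so `a + d z` is the adjacency matrix of the
    -- Cartesian product.
    a = A₁ ⊗ Iₘ
    d = Δ ⊗ Iₘ
    z = Iₙ ⊗ A₂

    cast-I : ∀ i j → cast (MatrixOver.I ℤ.+-*-rawRing m i j) ≡ Iₘ i j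
    cast-I i j with i Fin.≟ j
    ... | yes _ = ≡.refl
    ... | no  _ = ≡.refl

    ⊗-I⊗ : ∀ (B : Matrix ℚ n) (C : Matrix ℚ m) → (B ⊗ Iₘ) ∙ᴹ (Iₙ ⊗ C) ≈ᴹ B ⊗ C
    ⊗-I⊗ B C = Mnm.trans (⊗-∙ B Iₙ Iₘ C) (⊗-cong {n} {m} {B ∙ᴹ Iₙ} {B} {Iₘ ∙ᴹ C} {C} (Mn.*-identityʳ B) (Mm.*-identityˡ C))

    I⊗-⊗ : ∀ (B : Matrix ℚ n) (C : Matrix ℚ m) → (Iₙ ⊗ C) ∙ᴹ (B ⊗ Iₘ) ≈ᴹ B ⊗ C
    I⊗-⊗ B C = Mnm.trans (⊗-∙ Iₙ B C Iₘ) (⊗-cong {n} {m} {Iₙ ∙ᴹ B} {B} {C ∙ᴹ Iₘ} {C} (Mn.*-identityˡ B) (Mm.*-identityʳ C))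

    commute : ∀ (B : Matrix ℚ n) (C : Matrix ℚ m) → (Iₙ ⊗ C) ∙ᴹ (B ⊗ Iₘ) ≈ᴹ (B ⊗ Iₘ) ∙ᴹ (Iₙ ⊗ C)
    commute B C = Mnm.trans (I⊗-⊗ B C) (Mnm.sym (⊗-I⊗ B C))

    d²≈1 : d ∙ᴹ d ≈ᴹ ℚᴰ.I (n ℕ.* m)
    d²≈1 = Mnm.trans (⊗-∙ Δ Δ Iₘ Iₘ) (Mnm.trans (⊗-cong {n} {m} {Δ ∙ᴹ Δ} {Iₙ} {Iₘ ∙ᴹ Iₘ} {Iₘ} (diagonal-square Γ₁) (Mm.*-identityˡ Iₘ)) (⊗-I {n} {m}))

    ad≈-da : a ∙ᴹ d ≈ᴹ Mnm.- (d ∙ᴹ a)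
    ad≈-da = Mnm.trans (⊗-∙ A₁ Δ Iₘ Iₘ) (Mnm.trans (⊗-cong {n} {m} {A₁ ∙ᴹ Δ} {Mn.- (Δ ∙ᴹ A₁)} {Iₘ ∙ᴹ Iₘ} {Iₘ ∙ᴹ Iₘ} (adjacency-diagonal Γ₁) Mm.refl)
      (Mnm.trans (⊗-neg (Δ ∙ᴹ A₁) (Iₘ ∙ᴹ Iₘ)) (Mnm.-‿cong (Mnm.sym (⊗-∙ Δ A₁ Iₘ Iₘ)))))

    □-matrix : adjacencyℚ (Γ₁ □̃ Γ₂) ≈ᴹ a Mnm.+ d ∙ᴹ z
    □-matrix = Mnm.trans (entrywise entries) (Mnm.+-congˡ {a} (Mnm.sym (⊗-I⊗ Δ A₂)))
      where
      entries : ∀ x y → adjacencyℚ (Γ₁ □̃ Γ₂) x y ≡ (a Mnm.+ (Δ ⊗ A₂)) x y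
      entries x y = ≡.trans (≡.cong cast (adjacency-□̃ Γ₁ Γ₂ x y)) (≡.trans (cast-+ (P ℤ.* J) (Q ℤ.* S))
        (≡.cong₂ ℚ._+_ (≡.trans (cast-* P J) (≡.cong (cast P ℚ.*_) (cast-I i j))) (cast-* Q S)))
        where
        u = proj₁ (Fin.remQuot {n} m x)
        v = proj₁ (Fin.remQuot {n} m y)
        i = proj₂ (Fin.remQuot {n} m x)
        j = proj₂ (Fin.remQuot {n} m y)
        P = adjacency (graph Γ₁) u v
        J = MatrixOver.I ℤ.+-*-rawRing m i j
        Q = D Γ₁ u v
        S = adjacency Γ₂ i j

    ⋈-matrix : adjacencyℚ (Γ₁ ⋈̃ Γ₂) ≈ᴹ (A₁ Mn.+ Δ) ⊗ A₂
    ⋈-matrix = entrywise (λ x y →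
      let u , i = Fin.remQuot {n} m x
          v , j = Fin.remQuot {n} m y
      in ≡.trans (≡.cong cast (adjacency-⋈̃ Γ₁ Γ₂ x y))
        (≡.trans (cast-* (adjacency (graph Γ₁) u v ℤ.+ D Γ₁ u v) (adjacency Γ₂ i j))
          (≡.cong (ℚ._* A₂ i j) (cast-+ (adjacency (graph Γ₁) u v) (D Γ₁ u v)))))

    oddTrace : ℕ → ℚ
    oddTrace j = powerTrace A₂ (suc (double j))

  -- After `odd-power-trace` only d z ^ (2j + 1), that is Δ ⊗ A₂ ^ (2j + 1), is left, and the trace
  -- of a Kronecker product is the product of the traces.
  □-oddTrace : ∀ j → powerTrace (adjacencyℚ (Γ₁ □̃ Γ₂)) (suc (double j)) ≡ trace Δ ℚ.* oddTrace j
  □-oddTrace j =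
    ≡.trans (trace-odd-power (adjacencyℚ (Γ₁ □̃ Γ₂)) j)
    (≡.trans (trace-cong (oddPower (adjacencyℚ (Γ₁ □̃ Γ₂)) j) (oddPower (a Mnm.+ d ∙ᴹ z) j) (oddPower-cong j □-matrix))
    (≡.trans (odd-power-trace {a = a} {d} {z} d²≈1 ad≈-da (commute A₁ A₂) (commute Δ A₂) j)
    (≡.trans (trace-cong (d ∙ᴹ oddPower z j) (Δ ⊗ oddPower A₂ j)
      (Mnm.trans (Mnm.*-congˡ {d} (Mnm.trans (oddPower-⊗ Iₙ A₂ j) (⊗-cong {n} {m} {oddPower Iₙ j} {Iₙ} {oddPower A₂ j} {oddPower A₂ j} (oddPower-I j) Mm.refl))) (⊗-I⊗ Δ (oddPower A₂ j))))
    (≡.trans (trace-⊗ Δ (oddPower A₂ j)) (≡.cong (trace Δ ℚ.*_) (≡.sym (trace-odd-power A₂ j)))))))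

  -- Powers of a Kronecker product factor. The odd powers of A₁ + Δ are handled by `odd-power-trace`
  -- with the identity matrix as `z`, and all have the trace of Δ.
  ⋈-oddTrace : ∀ j → powerTrace (adjacencyℚ (Γ₁ ⋈̃ Γ₂)) (suc (double j)) ≡ trace Δ ℚ.* oddTrace j
  ⋈-oddTrace j =
    ≡.trans (trace-odd-power (adjacencyℚ (Γ₁ ⋈̃ Γ₂)) j)
    (≡.trans (trace-cong (oddPower (adjacencyℚ (Γ₁ ⋈̃ Γ₂)) j) (oddPower (A₁ Mn.+ Δ) j ⊗ oddPower A₂ j)
      (Mnm.trans (oddPower-cong j ⋈-matrix) (oddPower-⊗ (A₁ Mn.+ Δ) A₂ j)))
    (≡.trans (trace-⊗ (oddPower (A₁ Mn.+ Δ) j) (oddPower A₂ j))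
    (≡.cong₂ ℚ._*_ first (≡.sym (trace-odd-power A₂ j)))))
    where
    first : trace (oddPower (A₁ Mn.+ Δ) j) ≡ trace Δ
    first = ≡.trans (trace-cong (oddPower (A₁ Mn.+ Δ) j) (oddPower (A₁ Mn.+ Δ ∙ᴹ Iₙ) j)
        (oddPower-cong j (Mn.+-congˡ {A₁} (Mn.sym (Mn.*-identityʳ Δ)))))
      (≡.trans (odd-power-trace {a = A₁} {Δ} {Iₙ} (diagonal-square Γ₁) (adjacency-diagonal Γ₁)
          (Mn.trans (Mn.*-identityˡ A₁) (Mn.sym (Mn.*-identityʳ A₁))) (Mn.trans (Mn.*-identityˡ Δ) (Mn.sym (Mn.*-identityʳ Δ))) j)
        (trace-cong (Δ ∙ᴹ oddPower Iₙ j) Δ (Mn.trans (Mn.*-congˡ {Δ} (oddPower-I j)) (Mn.*-identityʳ Δ))))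

  -- Balance is decidable and selects the disjunct: when it fails, the trace of Δ is a non-zero
  -- factor that can be cancelled from all odd traces at once.
  symmetric⇔ : (Γ : SignedGraph (n ℕ.* m)) → (∀ j → powerTrace (adjacencyℚ Γ) (suc (double j)) ≡ trace Δ ℚ.* oddTrace j) →
               SymmetricSpectrum Γ ⇔ (Balanced Γ₁ ⊎ SymmetricSpectrum Γ₂)
  symmetric⇔ Γ traces = mk⇔ forward backward
    where
    forward : SymmetricSpectrum Γ → Balanced Γ₁ ⊎ SymmetricSpectrum Γ₂
    forward h with ∣ V₁ Γ₁ ∣ ℕ.≟ ∣ ∁ (V₁ Γ₁) ∣
    ... | yes balanced   = inj₁ balanced
    ... | no  unbalanced = inj₂ (oddTraces⇒symmetricSpectrum Γ₂ (λ j → ℚ-domain (unbalanced ∘ trace≡0⇒balanced Γ₁)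
      (≡.trans (≡.sym (traces j)) (symmetricSpectrum⇒oddTraces Γ h j))))
    backward : Balanced Γ₁ ⊎ SymmetricSpectrum Γ₂ → SymmetricSpectrum Γ
    backward h = oddTraces⇒symmetricSpectrum Γ (λ j → ≡.trans (traces j) (factor-zero j h))
      where
      factor-zero : ∀ j → Balanced Γ₁ ⊎ SymmetricSpectrum Γ₂ → trace Δ ℚ.* oddTrace j ≡ 0ℚ
      factor-zero j (inj₁ b) = ≡.trans (≡.cong (ℚ._* oddTrace j) (balanced⇒trace≡0 Γ₁ b)) (ℚ.*-zeroˡ (oddTrace j))
      factor-zero j (inj₂ h) = ≡.trans (≡.cong (trace Δ ℚ.*_) (symmetricSpectrum⇒oddTraces Γ₂ h j)) (ℚ.*-zeroʳ (trace Δ))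

theorem4p3 : ∀ {n m : ℕ} (Γ₁ : SignedBipartiteGraph n) (Γ₂ : SignedGraph m) →
    (SymmetricSpectrum (Γ₁ □̃ Γ₂) ⇔ (Balanced Γ₁ ⊎ SymmetricSpectrum Γ₂)) ×
    (SymmetricSpectrum (Γ₁ ⋈̃ Γ₂) ⇔ (Balanced Γ₁ ⊎ SymmetricSpectrum Γ₂))
theorem4p3 Γ₁ Γ₂ = symmetric⇔ Γ₁ Γ₂ (Γ₁ □̃ Γ₂) (□-oddTrace Γ₁ Γ₂) , symmetric⇔ Γ₁ Γ₂ (Γ₁ ⋈̃ Γ₂) (⋈-oddTrace Γ₁ Γ₂)
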